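{- Let $x$ and $t$ be integers with $t \geq 1$, $x \geq 2$, and $x$ not a multiple of $6$. Put $v = 6xt$, $N = 2x$ and $\beta = 3xt - 2$. Then a solution to $\mathrm{HWP}(v;6,N;1,\beta)$ exists if and only if $6 \mid v$ and $N \mid v$, except possibly when $\gcd(6,N) = 1$, or when $\gcd(6,N) = 2$ and $x = 3$.
   Context: For integers $M,N \geq 3$ and $v$, a solution to the uniform Hamilton–Waterloo problem $\mathrm{HWP}(v;M,N;\alpha,\beta)$ is a decomposition of the edge set of $K_v$ (if $v$ is odd) or of $K_v - F$ for some 1-factor (perfect matching) $F$ of $K_v$ (if $v$ is even) into $\alpha$ $C_M$-factors and $\beta$ $C_N$-factors. Here a $C_M$-factor is a spanning subgraph all of whose connected components are cycles of length $M$. -}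

module Defs where

open import Data.Nat using (ℕ; zero; suc; _%_)
open import Data.Nat.DivMod using (m%n<n)
open import Data.Fin using (Fin; toℕ; fromℕ<)
open import Data.Product using (Σ; _×_; ∃; _,_)
open import Data.Sum using (_⊎_; inj₁; inj₂)
open import Function.Bundles using (Bijection)
open import Relation.Binary.PropositionalEquality using (_≡_; _≢_; setoid)
open import Relation.Nullary using (¬_)

next : ∀ {M} → Fin M → Fin M
next {suc m} j = fromℕ< (m%n<n (suc (toℕ j)) (suc m))

-- A C_M-factor on vertex set Fin v: k vertex-disjoint cycles of length M
-- covering all vertices.  Cycle i visits cyc i 0, cyc i 1, ..., cyc i (M-1)
-- and back; the map (i , j) ↦ cyc i j is a bijection Fin k × Fin M → Fin v,
-- so the cycles are vertex-disjoint, each has M distinct vertices, and they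
-- span all vertices.
record CycleFactor (v M : ℕ) : Set where
  field
    k     : ℕ
    cyc   : Fin k → Fin M → Fin v
    cover : Bijection (setoid (Fin k × Fin M)) (setoid (Fin v))
    coverIsCyc : ∀ i j → Bijection.to cover (i , j) ≡ cyc i j

Adj : ∀ {v M} → CycleFactor v M → Fin v → Fin v → Set
Adj C u w =
  Σ (Fin (CycleFactor.k C)) λ i → Σ (Fin _) λ j →
    (CycleFactor.cyc C i j ≡ u × CycleFactor.cyc C i (next j) ≡ w)
    ⊎ (CycleFactor.cyc C i j ≡ w × CycleFactor.cyc C i (next j) ≡ u)

record OneFactor (v : ℕ) : Set where
  field
    mate     : Fin v → Fin v
    noFix    : ∀ u → mate u ≢ u
    involut  : ∀ u → mate (mate u) ≡ u

-- Decomposition of the graph on Fin v with edge relation E (symmetric,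
-- irreflexive, given by the caller) into α C_M-factors and β C_N-factors:
-- every factor edge is an edge of E, every edge of E lies in some factor,
-- and no edge lies in two different factors.
InFactor : ∀ {v M N α β} → (Fin α → CycleFactor v M) → (Fin β → CycleFactor v N)
         → (Fin α ⊎ Fin β) → Fin v → Fin v → Set
InFactor F G (inj₁ a) u w = Adj (F a) u w
InFactor F G (inj₂ b) u w = Adj (G b) u w

Decomposition : (v M N α β : ℕ) → (Fin v → Fin v → Set) → Set
Decomposition v M N α β E =
  Σ (Fin α → CycleFactor v M) λ F →
  Σ (Fin β → CycleFactor v N) λ G →
     (∀ i u w → InFactor F G i u w → E u w)
   × (∀ u w → E u w → ∃ λ i → InFactor F G i u w)
   × (∀ i j u w → InFactor F G i u w → InFactor F G j u w → i ≡ j)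

KEdge : ∀ {v} → Fin v → Fin v → Set
KEdge u w = u ≢ w

KminusF : ∀ {v} → OneFactor v → Fin v → Fin v → Set
KminusF F u w = u ≢ w × w ≢ OneFactor.mate F u

HWP : (v M N α β : ℕ) → Set
HWP v M N α β =
  (v % 2 ≡ 1 × Decomposition v M N α β KEdge)
  ⊎ (v % 2 ≡ 0 × Σ (OneFactor v) λ F → Decomposition v M N α β (KminusF F))

{-# OPTIONS --safe #-}

-- Both divisibility conditions always hold, so a solution must be constructed for all x ≥ 2 and t ≥ 1.
-- It suffices to find 3xt - 1 edge-disjoint 2-factors avoiding a perfect matching: counting neighbours, they then
-- cover every other edge.
--
-- For odd x, split the vertices into t groups of 6x.  The edges between groups lie over Walecki's Hamilton cycles of
-- K_t.  Such a cycle with every vertex replaced by 3x vertices has a Hamilton decomposition, and doubling the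
-- vertices turns every Hamilton cycle into two C_2x-factors (Häggkvist).  What is left is a copy of K_6x in every group
-- (t odd) or a copy of K_12x in every pair of groups (t even).  Arrange its vertices in x columns and R = 6 or 12
-- rows; over all but one of the Hamilton cycles of the columns, matchings of the rows give C_2x-factors.  The last one is
-- used together with the columns: a perfect matching and one hexagon factor of K_R in every column provide the
-- 1-factor and the C_6-factor, and every further hexagon factor combines with the rails between its antipodal rows into
-- two C_2x-factors.  These wind once around the columns and close up because x steps ±1 in ℤ/3 can add up to 0.
--
-- For even x, split the vertices into 2t groups of 3x; the edges between groups lie over Hamilton cycles of K_2t and
-- form copies of K_{x,x}, which split into cycles using two consecutive differences.  In a remaining K_6x, with 6 rows of
-- length x, two row matchings forming a hexagon give the C_6-factor (difference 1), and (difference 0) two C_2x-factors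
-- together with a Hamilton cycle of the columns in every row.  A ladder argument shows that the complete graph on two
-- rows of length x still splits into Hamilton cycles and a perfect matching when that Hamilton cycle is removed from both
-- rows.

module Submission where

open import Defs
open import Data.Bool using (Bool; true; false; not; _xor_; _∧_) renaming (_≟_ to _≟B_)
open import Data.Bool.Properties
  using (not-involutive; not-¬; xor-same; xor-comm; xor-assoc; xor-identityʳ; not-distribˡ-xor; not-distribʳ-xor)
open import Data.Empty using (⊥; ⊥-elim)
open import Data.Fin using (Fin; zero; suc; #_; toℕ; fromℕ; fromℕ<; inject₁; opposite; combine; remQuot)
open import Data.Fin.Properties
  using (toℕ-fromℕ<; toℕ-injective; toℕ<n; toℕ-combine; opposite-involutive; opposite-prop; remQuot-combine;
         combine-remQuot; toℕ-inject₁; toℕ-fromℕ; *↔×; +↔⊎; 2↔Bool; pigeonhole; all?; any?)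
  renaming (_≟_ to _≟F_)
open import Data.Nat
  using (ℕ; zero; suc; _+_; _*_; _∸_; _≤_; _<_; _≥_; z≤n; s≤s; nonZero; _%_; ⌊_/2⌋; _<?_)
  renaming (_≟_ to _≟ℕ_)
open import Data.Nat.Divisibility using (_∣_; divides)
open import Data.Nat.DivMod using (m<n⇒m%n≡m; n%n≡0; %-distribˡ-+; [m+kn]%n≡m%n; _mod_; m*n%n≡0)
open import Data.Nat.GCD using (gcd)
open import Data.Nat.Properties
  using (≤-antisym; ≮⇒≥; suc-injective; +-comm; +-assoc; *-comm; *-suc; +-suc; +-identityʳ; *-zeroʳ; ≤-trans; ≤-refl;
         <-irrefl; n<1+n; m≤m+n; +-monoʳ-≤; +-monoˡ-≤; *-monoʳ-≤; m+[n∸m]≡n; m∸n+n≡m; <⇒≤; ≤-reflexive; +-cancelˡ-≡;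
         <-≤-trans; m+n∸n≡m; n≤1+n; 1+n≢n; 1+n≰n; <-trans; m∸[m∸n]≡n; +-∸-assoc; +-mono-≤; ∸-monoʳ-≤; ∸-monoˡ-≤;
         ≤-pred; n≡⌊n+n/2⌋; n≡⌈n+n/2⌉; m≤n⇒m∸n≡0; module ≤-Reasoning)
open import Data.Nat.Solver using (module +-*-Solver)
open import Data.Product using (Σ; _×_; _,_; proj₁; proj₂; ∃; uncurry)
open import Data.Product.Algebra using (×-assoc)
open import Data.Product.Function.NonDependent.Propositional using (_×-↔_)
open import Data.Product.Properties using (,-injectiveʳ)
open import Data.Sum using (_⊎_; inj₁; inj₂; [_,_]′)
open import Data.Sum.Function.Propositional using (_⊎-↔_)
open import Data.Unit using (tt)
open import Data.Vec using (Vec; []; _∷_; lookup)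
open import Function.Base using (case_of_)
open import Function.Bundles using (_⇔_; _↔_; Inverse; mk↔ₛ′; mk⇔)
open import Function.Properties.Inverse using (↔-refl; ↔-sym; ↔-trans; ↔⇒⤖)
open import Level using (0ℓ)
open import Relation.Binary.Construct.Closure.Symmetric using (SymClosure; fwd; bwd; symmetric; gmap; fold)
open import Relation.Binary.PropositionalEquality
  using (_≡_; _≢_; refl; sym; trans; cong; cong₂; subst; subst₂; module ≡-Reasoning)
open import Relation.Nullary using (¬_; Dec; yes; no)
open import Relation.Nullary.Decidable using (toWitness; True; _×-dec_; _⊎-dec_; _→-dec_; ¬?)

-- Cyclic order, cycle factors and families of edge-disjoint factors

-- The parity of x decides the method. Two rows of even length x span a `K_{x,x}` of even degree,
-- which splits into Hamilton cycles. For odd x its degree is odd, so cycles of length 2x come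
-- instead from doubling cycles whose length is a multiple of x. Merging the groups in pairs is
-- forced when their number is even, since edge-disjoint Hamilton cycles of a complete graph of even
-- order always leave something over, here a perfect matching of the groups. For even x the groups
-- have half the size, so that this is always the situation. The obstacle inside a cell is that only
-- one `C_6`-factor is wanted. For odd x the other hexagons in the columns have the wrong length in
-- general and must be opened up by rails. For even x, once the hexagon rows have given away
-- difference 1, their difference 0 consists of closed hexagons inside the columns; these are opened
-- with edges inside the rows, which is why the ladders have to give up a Hamilton cycle.

to : {A B : Set} → A ↔ B → A → B
to = Inverse.to

from : {A B : Set} → A ↔ B → B → A
from = Inverse.from

to-from : {A B : Set} (f : A ↔ B) → ∀ y → to f (from f y) ≡ y
to-from f = Inverse.strictlyInverseˡ f

from-to : {A B : Set} (f : A ↔ B) → ∀ x → from f (to f x) ≡ x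
from-to f = Inverse.strictlyInverseʳ f

to-injective : {A B : Set} (f : A ↔ B) → ∀ {x y} → to f x ≡ to f y → x ≡ y
to-injective f {x} {y} e = trans (sym (from-to f x)) (trans (cong (from f) e) (from-to f y))

from-injective : {A B : Set} (f : A ↔ B) → ∀ {x y} → from f x ≡ from f y → x ≡ y
from-injective f = to-injective (↔-sym f)

nextView : ∀ {M} (j : Fin M) →
  (toℕ (next j) ≡ suc (toℕ j)) ⊎ (suc (toℕ j) ≡ M × toℕ (next j) ≡ 0)
nextView {suc m} j with suc (toℕ j) <? suc m
... | yes p = inj₁ (trans (toℕ-fromℕ< _) (m<n⇒m%n≡m p))
... | no ¬p = inj₂ (e , trans (toℕ-fromℕ< _) (trans (cong (_% suc m) e) (n%n≡0 (suc m))))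
  where e = ≤-antisym (toℕ<n j) (≮⇒≥ ¬p)

next-step : ∀ {M} {j j' : Fin M} → suc (toℕ j) ≡ toℕ j' → next j ≡ j'
next-step {j = j} {j'} e with nextView j
... | inj₁ p = toℕ-injective (trans p e)
... | inj₂ (p , _) = ⊥-elim (<-irrefl (trans (sym e) p) (toℕ<n j'))

next-wrap : ∀ {M} {j j' : Fin M} → suc (toℕ j) ≡ M → toℕ j' ≡ 0 → next j ≡ j'
next-wrap {j = j} e z with nextView j
... | inj₁ p = ⊥-elim (<-irrefl (trans p e) (toℕ<n (next j)))
... | inj₂ (_ , p) = toℕ-injective (trans p (sym z))

prev : ∀ {M} → Fin M → Fin M
prev {suc m} zero = fromℕ m
prev {suc m} (suc j) = inject₁ j

next-prev : ∀ {M} (j : Fin M) → next (prev j) ≡ j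
next-prev {suc m} zero = next-wrap (cong suc (toℕ-fromℕ m)) refl
next-prev {suc m} (suc j) = next-step (cong suc (toℕ-inject₁ j))

next-injective : ∀ {M} {i j : Fin M} → next i ≡ next j → i ≡ j
next-injective {i = i} {j} e with nextView i | nextView j | cong toℕ e
... | inj₁ p | inj₁ q | r = toℕ-injective (suc-injective (trans (sym p) (trans r q)))
... | inj₂ (p , _) | inj₂ (q , _) | r = toℕ-injective (suc-injective (trans p (sym q)))
... | inj₁ p | inj₂ (_ , q) | r = case trans (sym p) (trans r q) of λ ()
... | inj₂ (_ , p) | inj₁ q | r = case trans (sym p) (trans r q) of λ ()

prev-next : ∀ {M} (j : Fin M) → prev (next j) ≡ j
prev-next j = next-injective (next-prev (next j))

next≢ : ∀ {M} → 2 ≤ M → (j : Fin M) → next j ≢ j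
next≢ {M} h j e with nextView j
... | inj₁ p = 1+n≢n (trans (sym p) (cong toℕ e))
... | inj₂ (p , q) = 1+n≰n (subst (2 ≤_) (trans (sym p) (cong suc (trans (cong toℕ (sym e)) q))) h)

next²≢ : ∀ {M} → 3 ≤ M → (j : Fin M) → next (next j) ≢ j
next²≢ {M} h j e with nextView j | nextView (next j) | cong toℕ e
... | inj₁ p | inj₁ q | r = m≢2+m (trans (sym r) (trans q (cong suc p)))
  where m≢2+m : ∀ {m} → m ≢ suc (suc m)
        m≢2+m {zero} ()
        m≢2+m {suc m} x = m≢2+m (suc-injective x)
... | inj₁ p | inj₂ (q , z) | r =
  1+n≰n (subst (3 ≤_) (trans (sym q) (cong suc (trans p (cong suc (trans (sym r) z))))) h)
... | inj₂ (p , z) | inj₁ q | r =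
  1+n≰n (subst (3 ≤_) (trans (sym p) (cong suc (trans (sym r) (trans q (cong suc z))))) h)
... | inj₂ (p , z) | inj₂ (q , _) | r =
  1+n≰n (≤-trans (s≤s (s≤s z≤n)) (subst (3 ≤_) (trans (sym q) (cong suc z)) h))

-- Cyclic successor on Fin (A * B) in base-B digits.
Carry : ∀ {A B} → Fin A × Fin B → Fin A × Fin B → Set
Carry {A} {B} (a , b) (a' , b') =
  (a' ≡ a × toℕ b' ≡ suc (toℕ b)) ⊎ (a' ≡ next a × suc (toℕ b) ≡ B × toℕ b' ≡ 0)

next-combine : ∀ {A B} (a : Fin A) (b : Fin B) →
  ∃ λ p → next (combine a b) ≡ uncurry combine p × Carry (a , b) p
next-combine {A} {B} a b with nextView b
... | inj₁ q = (a , next b) , next-step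
        (trans (cong suc (toℕ-combine a b)) (trans (sym (+-suc _ _)) (trans (cong (B * toℕ a +_) (sym q)) (sym (toℕ-combine a (next b))))))
      , inj₁ (refl , q)
... | inj₂ (q , z) = (next a , next b) , lem , inj₂ (refl , q , z)
  where
  e : suc (toℕ (combine a b)) ≡ B * suc (toℕ a)
  e = trans (cong suc (toℕ-combine a b)) (trans (sym (+-suc _ _)) (trans (cong (B * toℕ a +_) q)
        (trans (+-comm _ B) (sym (*-suc B (toℕ a))))))
  lem : next (combine a b) ≡ combine (next a) (next b)
  lem with nextView a
  ... | inj₁ r = next-step (trans e (sym (trans (toℕ-combine (next a) (next b))
          (trans (cong₂ _+_ (cong (B *_) r) z) (+-identityʳ _)))))
  ... | inj₂ (r , y) = next-wrap (trans e (trans (cong (B *_) r) (*-comm B A)))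
          (trans (toℕ-combine (next a) (next b)) (trans (cong₂ _+_ (cong (B *_) y) z) (trans (+-identityʳ _) (*-zeroʳ B))))

next-remQuot : ∀ {A} B (j : Fin (A * B)) → Carry (remQuot {A} B j) (remQuot {A} B (next j))
next-remQuot {A} B j = lem (next-combine (proj₁ (remQuot {A} B j)) (proj₂ (remQuot {A} B j)))
  where
  lem : (∃ λ p → next (uncurry combine (remQuot {A} B j)) ≡ uncurry combine p × Carry (remQuot {A} B j) p) →
        Carry (remQuot {A} B j) (remQuot {A} B (next j))
  lem (p , e , c) = subst (Carry (remQuot {A} B j)) (sym (trans
    (cong (remQuot {A} B) (trans (cong next (sym (combine-remQuot {A} B j))) e)) (remQuot-combine (proj₁ p) (proj₂ p)))) c

-- The vertex set is arbitrary so that factors can be built on products such as columns times rows;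
-- the passage to `Fin v` happens at the end, in `design⇒HWP`.
record Factor (V : Set) (N : ℕ) : Set where
  field
    count : ℕ
    pt    : (Fin count × Fin N) ↔ V

open Factor public

data Step {V : Set} {N : ℕ} (F : Factor V N) (u w : V) : Set where
  step : ∀ i j → to (pt F) (i , j) ≡ u → to (pt F) (i , next j) ≡ w → Step F u w

Edge : ∀ {V N} → Factor V N → V → V → Set
Edge F = SymClosure (Step F)

-- Positions on a cycle get two digits because most cycles here consist of A similar runs of length
-- B: a step either moves on inside a run or carries into the next one.
mkFactor : ∀ {K V : Set} {k A B} → K ↔ Fin k → (K × (Fin A × Fin B)) ↔ V → Factor V (A * B)
mkFactor {k = k} {A} {B} f g = record { count = k ; pt = ↔-trans (↔-sym f ×-↔ *↔× {A} {B}) g }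

mkFactor-step : ∀ {K V : Set} {k A B} (f : K ↔ Fin k) (g : (K × (Fin A × Fin B)) ↔ V) {u w} →
  Step (mkFactor f g) u w →
  Σ K λ κ → Σ (Fin A × Fin B) λ p → Σ (Fin A × Fin B) λ q → Carry p q × to g (κ , p) ≡ u × to g (κ , q) ≡ w
mkFactor-step {A = A} {B} f g (step i j e₁ e₂) = from f i , remQuot B j , remQuot B (next j) , next-remQuot B j , e₁ , e₂

mkFactor-elim : ∀ {K V : Set} {k A B} (f : K ↔ Fin k) (g : (K × (Fin A × Fin B)) ↔ V) (E : V → V → Set) →
  (∀ κ p q → Carry p q → E (to g (κ , p)) (to g (κ , q))) → ∀ {u w} → Step (mkFactor f g) u w → E u w
mkFactor-elim f g E h s = let (κ , p , q , c , e , e') = mkFactor-step f g s in subst₂ E e e' (h κ p q c)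

mapFactor : ∀ {V V' : Set} {N} → V ↔ V' → Factor V N → Factor V' N
mapFactor f F = record { count = count F ; pt = ↔-trans (pt F) f }

mapFactor-step : ∀ {V V' : Set} {N} (f : V ↔ V') (F : Factor V N) {u w} →
  Step (mapFactor f F) u w → Step F (from f u) (from f w)
mapFactor-step f F (step i j refl refl) = step i j (sym (from-to f _)) (sym (from-to f _))

copyFactor : ∀ {B V : Set} {b N} → B ↔ Fin b → Factor V N → Factor (B × V) N
copyFactor {b = b} f F = record { count = b * count F
  ; pt = ↔-trans (↔-trans (*↔× ×-↔ ↔-refl) (×-assoc 0ℓ _ _ _)) (↔-sym f ×-↔ pt F) }

copyFactor-step : ∀ {B V : Set} {b N} (f : B ↔ Fin b) (F : Factor V N) {c d u w} →
  Step (copyFactor f F) (c , u) (d , w) → c ≡ d × Step F u w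
copyFactor-step f F (step i j refl refl) = refl , step _ j refl refl

-- Families record disjointness alone; covering comes at the end from the degree count in
-- `place-onto`. The relation `E` serves to keep different families apart in `unionFam`.
record Fam (V : Set) (N : ℕ) (I : Set) (E : V → V → Set) : Set where
  field
    factor : I → Factor V N
    within : ∀ i {u w} → Edge (factor i) u w → E u w
    disj   : ∀ {i j u w} → Edge (factor i) u w → Edge (factor j) u w → i ≡ j

open Fam public

-- The end points are explicit because edge relations are usually defined by computation.
Symmetric : {V : Set} → (V → V → Set) → Set
Symmetric E = ∀ u w → E u w → E w u

SymClosure-sym : {V : Set} {E : V → V → Set} → Symmetric (SymClosure E)
SymClosure-sym _ _ = symmetric _

mapFam : ∀ {V V' N I E} {E' : V' → V' → Set} (f : V ↔ V') → (∀ {u w} → E u w → E' (to f u) (to f w)) →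
  Fam V N I E → Fam V' N I E'
mapFam {E' = E'} f h F = record
  { factor = λ i → mapFactor f (factor F i)
  ; within = λ i {u} {w} e → subst₂ E' (to-from f u) (to-from f w) (h (within F i (lift i e)))
  ; disj = λ {i} {j} e e' → disj F (lift i e) (lift j e') }
  where
  lift : ∀ i {u w} → Edge (mapFactor f (factor F i)) u w → Edge (factor F i) (from f u) (from f w)
  lift i = gmap (from f) (mapFactor-step f (factor F i))

Copies : {B V : Set} → (V → V → Set) → B × V → B × V → Set
Copies E (b , u) (c , w) = b ≡ c × E u w

copyFactor-edge : ∀ {B V : Set} {b N} (f : B ↔ Fin b) (F : Factor V N) {c d u w} →
  Edge (copyFactor f F) (c , u) (d , w) → c ≡ d × Edge F u w
copyFactor-edge f F (fwd s) with copyFactor-step f F s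
... | e , s' = e , fwd s'
copyFactor-edge f F (bwd s) with copyFactor-step f F s
... | e , s' = sym e , bwd s'

copyFam : ∀ {B V : Set} {b N I E} → B ↔ Fin b → Fam V N I E → Fam (B × V) N I (Copies E)
copyFam f F = record
  { factor = λ i → copyFactor f (factor F i)
  ; within = λ { i {c , u} {d , w} e → let (p , q) = copyFactor-edge f (factor F i) e in p , within F i q }
  ; disj = λ { {i} {j} {c , u} {d , w} e e' →
      disj F (proj₂ (copyFactor-edge f (factor F i) e)) (proj₂ (copyFactor-edge f (factor F j) e')) } }

unionFam : ∀ {V N I J E E'} → (∀ {u w} → E u w → E' u w → ⊥) → Fam V N I E → Fam V N J E' →
  Fam V N (I ⊎ J) (λ u w → E u w ⊎ E' u w)
unionFam {V} {N} {I} {J} {E} {E'} apart F G = record { factor = fac ; within = wi ; disj = λ {i} {j} → di i j }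
  where
  fac : I ⊎ J → Factor V N
  fac (inj₁ i) = factor F i
  fac (inj₂ j) = factor G j
  wi : ∀ i {u w} → Edge (fac i) u w → E u w ⊎ E' u w
  wi (inj₁ i) e = inj₁ (within F i e)
  wi (inj₂ j) e = inj₂ (within G j e)
  di : ∀ i j {u w} → Edge (fac i) u w → Edge (fac j) u w → i ≡ j
  di (inj₁ i) (inj₁ j) e e' = cong inj₁ (disj F e e')
  di (inj₁ i) (inj₂ j) e e' = ⊥-elim (apart (within F i e) (within G j e'))
  di (inj₂ i) (inj₁ j) e e' = ⊥-elim (apart (within F j e') (within G i e))
  di (inj₂ i) (inj₂ j) e e' = cong inj₂ (disj G e e')

weakenFam : ∀ {V N I E E'} → (∀ {u w} → E u w → E' u w) → Fam V N I E → Fam V N I E'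
weakenFam h F = record { factor = factor F ; within = λ i e → h (within F i e) ; disj = disj F }

-- Once the classes are symmetric and pairwise disjoint, only the oriented steps of each factor have
-- to be located.
classFam : ∀ {V N I E} (F : I → Factor V N) (C : I → V → V → Set) →
  (∀ i → Symmetric (C i)) → (∀ i {u w} → Step (F i) u w → C i u w) →
  (∀ i j {u w} → C i u w → C j u w → i ≡ j) → (∀ i {u w} → C i u w → E u w) → Fam V N I E
classFam F C s st d h = record { factor = F
  ; within = λ i e → h i (fold (s i _ _) (st i) e)
  ; disj = λ {i} {j} e e' → d i j (fold (s i _ _) (st i) e) (fold (s j _ _) (st j) e') }

Ring : {W : Set} {n : ℕ} → Fin n × W → Fin n × W → Set
Ring (a , _) (b , _) = b ≡ next a ⊎ a ≡ next b

Rail : {W : Set} {n : ℕ} → (Fin n → W → W → Set) → Fin n × W → Fin n × W → Set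
Rail r (a , p) (b , q) = b ≡ next a × r a p q

-- Reading a common edge in opposite directions would give `next (next a) ≡ a`, impossible on a
-- cycle of length at least 3. So both readings have the same direction, and disjointness of the
-- `r j` applies.
railDisj : ∀ {W J : Set} {n} → 3 ≤ n → (r : J → Fin n → W → W → Set) →
  (∀ i j {a p q} → r i a p q → r j a p q → i ≡ j) →
  ∀ i j {u w} → SymClosure (Rail (r i)) u w → SymClosure (Rail (r j)) u w → i ≡ j
railDisj h r d i j {a , p} {b , q} (fwd (_ , x)) (fwd (_ , y)) = d i j x y
railDisj h r d i j {a , p} {b , q} (bwd (_ , x)) (bwd (_ , y)) = d i j x y
railDisj h r d i j {a , p} {b , q} (fwd (x , _)) (bwd (y , _)) = ⊥-elim (next²≢ h a (sym (trans y (cong next x))))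
railDisj h r d i j {a , p} {b , q} (bwd (x , _)) (fwd (y , _)) = ⊥-elim (next²≢ h a (sym (trans x (cong next y))))

railFamIn : ∀ {W J : Set} {n N} {E : Fin n × W → Fin n × W → Set} → 3 ≤ n →
  (F : J → Factor (Fin n × W) N) (r : J → Fin n → W → W → Set) →
  (∀ j {u w} → Step (F j) u w → SymClosure (Rail (r j)) u w) →
  (∀ i j {a p q} → r i a p q → r j a p q → i ≡ j) →
  (∀ j {u w} → SymClosure (Rail (r j)) u w → E u w) → Fam (Fin n × W) N J E
railFamIn h F r st d = classFam F (λ j → SymClosure (Rail (r j))) (λ _ → SymClosure-sym) st (railDisj h r d)

railFam : ∀ {W J : Set} {n N} → 3 ≤ n → (F : J → Factor (Fin n × W) N) (r : J → Fin n → W → W → Set) →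
  (∀ j {u w} → Step (F j) u w → SymClosure (Rail (r j)) u w) →
  (∀ i j {a p q} → r i a p q → r j a p q → i ≡ j) → Fam (Fin n × W) N J Ring
railFam h F r st d = railFamIn h F r st d
  λ { _ {_ , _} {_ , _} (fwd (e , _)) → inj₁ e ; _ {_ , _} {_ , _} (bwd (e , _)) → inj₂ e }

sumFam : ∀ {V I J N} {E : I → V → V → Set} → (∀ i j {u w} → E i u w → E j u w → i ≡ j) →
  (∀ i → Fam V N J (E i)) → Fam V N (I × J) (λ u w → ∃ λ i → E i u w)
sumFam {V} {I} {J} d F = record
  { factor = λ { (i , j) → factor (F i) j }
  ; within = λ { (i , j) e → i , within (F i) j e }
  ; disj = λ { {i , j} {i' , j'} e e' → lem i j i' j' (d i i' (within (F i) j e) (within (F i') j' e')) e e' } }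
  where
  lem : ∀ i j i' j' → i ≡ i' → ∀ {u w} → Edge (factor (F i) j) u w → Edge (factor (F i') j') u w → (i , j) ≡ (i' , j')
  lem i j .i j' refl e e' = cong (i ,_) (disj (F i) e e')

On : {B W : Set} → (B → B → Set) → B × W → B × W → Set
On C (b , _) (c , _) = C b c

-- Substituting a ring family for every cycle of a set of edge-disjoint Hamilton cycles.
blowFam : ∀ {B W I J : Set} {n N} (order : I → Fin n ↔ B) (C : I → B → B → Set) →
  (∀ i → Symmetric (C i)) → (∀ i a → C i (to (order i) a) (to (order i) (next a))) →
  (∀ i j {b c} → C i b c → C j b c → i ≡ j) →
  Fam (Fin n × W) N J Ring → Fam (B × W) N (I × J) (λ u w → ∃ λ i → On (C i) u w)
blowFam order C s st d R = sumFam (λ i j → d i j) λ i →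
  mapFam (order i ×-↔ ↔-refl) (λ { {a , _} {b , _} (inj₁ refl) → st i a ; {a , _} {b , _} (inj₂ refl) → s i _ _ (st i b) }) R

-- Finite cyclic groups and zigzag Hamilton cycles

par : ℕ → Bool
par zero = false
par (suc n) = not (par n)

par-+ : ∀ m n → par (m + n) ≡ par m xor par n
par-+ zero n = refl
par-+ (suc m) n = trans (cong not (par-+ m n)) (not-distribˡ-xor (par m) (par n))

par-double : ∀ n → par (n + n) ≡ false
par-double n = trans (par-+ n n) (xor-same (par n))

infixl 6 _⊕_
infix 8 ⊖_

opaque
  [_] : ∀ {m} → ℕ → Fin (suc m)
  [ n ] = n mod suc _

  toℕ-[] : ∀ {m} n → toℕ {suc m} [ n ] ≡ n % suc m
  toℕ-[] n = toℕ-fromℕ< _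

  []-cong : ∀ {m} a b → a % suc m ≡ b % suc m → [_] {m} a ≡ [ b ]
  []-cong a b e = toℕ-injective (trans (toℕ-[] a) (trans e (sym (toℕ-[] b))))

  toℕ-[]< : ∀ {m n} → n < suc m → toℕ {suc m} [ n ] ≡ n
  toℕ-[]< {m} {n} h = trans (toℕ-[] n) (m<n⇒m%n≡m h)

  []-toℕ : ∀ {m} (a : Fin (suc m)) → [ toℕ a ] ≡ a
  []-toℕ a = toℕ-injective (toℕ-[]< (toℕ<n a))

  [M]≡0 : ∀ {m} → [_] {m} (suc m) ≡ zero
  [M]≡0 {m} = toℕ-injective (trans (toℕ-[] (suc m)) (n%n≡0 (suc m)))

  _⊕_ : ∀ {m} → Fin (suc m) → Fin (suc m) → Fin (suc m)
  a ⊕ b = [ toℕ a + toℕ b ]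

  ⊖_ : ∀ {m} → Fin (suc m) → Fin (suc m)
  ⊖_ {m} a = [ suc m ∸ toℕ a ]

  []-⊕ : ∀ {m} a b → [_] {m} a ⊕ [ b ] ≡ [ a + b ]
  []-⊕ {m} a b = []-cong (toℕ {suc m} [ a ] + toℕ {suc m} [ b ]) (a + b)
    (trans (cong₂ (λ p q → (p + q) % suc m) (toℕ-[] a) (toℕ-[] b)) (sym (%-distribˡ-+ a b (suc m))))

  ⊕-comm : ∀ {m} (a b : Fin (suc m)) → a ⊕ b ≡ b ⊕ a
  ⊕-comm a b = cong [_] (+-comm (toℕ a) (toℕ b))

  ⊕-assoc : ∀ {m} (a b c : Fin (suc m)) → (a ⊕ b) ⊕ c ≡ a ⊕ (b ⊕ c)
  ⊕-assoc a b c = begin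
    [ toℕ a + toℕ b ] ⊕ c                 ≡⟨ cong ([ toℕ a + toℕ b ] ⊕_) ([]-toℕ c) ⟨
    [ toℕ a + toℕ b ] ⊕ [ toℕ c ]         ≡⟨ []-⊕ (toℕ a + toℕ b) (toℕ c) ⟩
    [ (toℕ a + toℕ b) + toℕ c ]           ≡⟨ cong [_] (+-assoc (toℕ a) (toℕ b) (toℕ c)) ⟩
    [ toℕ a + (toℕ b + toℕ c) ]           ≡⟨ []-⊕ (toℕ a) (toℕ b + toℕ c) ⟨
    [ toℕ a ] ⊕ (b ⊕ c)                   ≡⟨ cong (_⊕ (b ⊕ c)) ([]-toℕ a) ⟩
    a ⊕ (b ⊕ c)                           ∎
    where open ≡-Reasoning

  ⊕-identityˡ : ∀ {m} (a : Fin (suc m)) → zero ⊕ a ≡ a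
  ⊕-identityˡ = []-toℕ

  ⊕-identityʳ : ∀ {m} (a : Fin (suc m)) → a ⊕ zero ≡ a
  ⊕-identityʳ a = trans (⊕-comm a zero) ([]-toℕ a)

  ⊕-inverseʳ : ∀ {m} (a : Fin (suc m)) → a ⊕ ⊖ a ≡ zero
  ⊕-inverseʳ {m} a = begin
    a ⊕ ⊖ a                          ≡⟨ cong (_⊕ ⊖ a) ([]-toℕ a) ⟨
    [ toℕ a ] ⊕ [ suc m ∸ toℕ a ]    ≡⟨ []-⊕ (toℕ a) (suc m ∸ toℕ a) ⟩
    [ toℕ a + (suc m ∸ toℕ a) ]      ≡⟨ cong [_] (m+[n∸m]≡n (<⇒≤ (toℕ<n a))) ⟩
    [ suc m ]                        ≡⟨ [M]≡0 ⟩
    zero                             ∎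
    where open ≡-Reasoning

  ⊖-def : ∀ {m} (a : Fin (suc m)) → ⊖ a ≡ [ suc m ∸ toℕ a ]
  ⊖-def a = refl

  next≡⊕1 : ∀ {m} (a : Fin (suc m)) → next a ≡ a ⊕ [ 1 ]
  next≡⊕1 {m} a = begin
    [ suc (toℕ a) ]     ≡⟨ cong [_] (+-comm 1 (toℕ a)) ⟩
    [ toℕ a + 1 ]       ≡⟨ []-⊕ (toℕ a) 1 ⟨
    [ toℕ a ] ⊕ [ 1 ]   ≡⟨ cong (_⊕ [ 1 ]) ([]-toℕ a) ⟩
    a ⊕ [ 1 ]           ∎
    where open ≡-Reasoning

⊕-inverseˡ : ∀ {m} (a : Fin (suc m)) → ⊖ a ⊕ a ≡ zero
⊕-inverseˡ a = trans (⊕-comm (⊖ a) a) (⊕-inverseʳ a)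

⊕⊖ : ∀ {m} (a b : Fin (suc m)) → (a ⊕ b) ⊕ ⊖ b ≡ a
⊕⊖ a b = trans (⊕-assoc a b (⊖ b)) (trans (cong (a ⊕_) (⊕-inverseʳ b)) (⊕-identityʳ a))

⊖⊕ : ∀ {m} (a b : Fin (suc m)) → (a ⊕ ⊖ b) ⊕ b ≡ a
⊖⊕ a b = trans (⊕-assoc a (⊖ b) b) (trans (cong (a ⊕_) (⊕-inverseˡ b)) (⊕-identityʳ a))

⊕-cancelʳ : ∀ {m} (c : Fin (suc m)) {a b} → a ⊕ c ≡ b ⊕ c → a ≡ b
⊕-cancelʳ c {a} {b} e = trans (sym (⊕⊖ a c)) (trans (cong (_⊕ ⊖ c) e) (⊕⊖ b c))

⊕-cancelˡ : ∀ {m} (c : Fin (suc m)) {a b} → c ⊕ a ≡ c ⊕ b → a ≡ b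
⊕-cancelˡ c {a} {b} e = ⊕-cancelʳ c (trans (⊕-comm a c) (trans e (⊕-comm c b)))

⊖-unique : ∀ {m} {a b : Fin (suc m)} → a ⊕ b ≡ zero → ⊖ a ≡ b
⊖-unique {a = a} e = ⊕-cancelˡ a (trans (⊕-inverseʳ a) (sym e))

⊖-involutive : ∀ {m} (a : Fin (suc m)) → ⊖ ⊖ a ≡ a
⊖-involutive a = ⊖-unique (⊕-inverseˡ a)

⊕-interchange : ∀ {m} (a b c d : Fin (suc m)) → (a ⊕ b) ⊕ (c ⊕ d) ≡ (a ⊕ c) ⊕ (b ⊕ d)
⊕-interchange a b c d = begin
  (a ⊕ b) ⊕ (c ⊕ d)   ≡⟨ ⊕-assoc a b (c ⊕ d) ⟩
  a ⊕ (b ⊕ (c ⊕ d))   ≡⟨ cong (a ⊕_) (⊕-assoc b c d) ⟨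
  a ⊕ ((b ⊕ c) ⊕ d)   ≡⟨ cong (λ z → a ⊕ (z ⊕ d)) (⊕-comm b c) ⟩
  a ⊕ ((c ⊕ b) ⊕ d)   ≡⟨ cong (a ⊕_) (⊕-assoc c b d) ⟩
  a ⊕ (c ⊕ (b ⊕ d))   ≡⟨ ⊕-assoc a c (b ⊕ d) ⟨
  (a ⊕ c) ⊕ (b ⊕ d)   ∎
  where open ≡-Reasoning

⊖-⊕ : ∀ {m} (a b : Fin (suc m)) → ⊖ (a ⊕ b) ≡ ⊖ a ⊕ ⊖ b
⊖-⊕ a b = ⊖-unique (trans (⊕-interchange a b (⊖ a) (⊖ b))
  (trans (cong₂ _⊕_ (⊕-inverseʳ a) (⊕-inverseʳ b)) (⊕-identityʳ zero)))

-- If y were missed, putting it in front of the values of `f` would inject n + 1 elements into n.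
injective⇒section : ∀ {n} (f : Fin n → Fin n) → (∀ {i j} → f i ≡ f j → i ≡ j) → ∀ y → ∃ λ i → f i ≡ y
injective⇒section {n} f inj y with any? (λ i → f i ≟F y)
... | yes p = p
... | no ¬p = ⊥-elim (lem (pigeonhole (n<1+n n) g))
  where
  g : Fin (suc n) → Fin n
  g zero = y
  g (suc i) = f i
  lem : (∃ λ i → ∃ λ j → toℕ i < toℕ j × g i ≡ g j) → ⊥
  lem (zero , suc j , _ , e) = ¬p (j , sym e)
  lem (suc i , suc j , s≤s lt , e) = <-irrefl (cong toℕ (inj e)) lt

-- Between finite sets of equal size a section is injective, hence onto, and the other inverse law
-- follows. This halves the work for explicit orders and tables.
section↔ : ∀ {A V : Set} {n} → A ↔ Fin n → V ↔ Fin n → (f : A → V) (g : V → A) → (∀ v → f (g v) ≡ v) → A ↔ V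
section↔ {A} {V} {n} α υ f g fg = mk↔ₛ′ f g fg gf
  where
  g' : Fin n → Fin n
  g' i = to α (g (from υ i))
  g'-inj : ∀ {i j} → g' i ≡ g' j → i ≡ j
  g'-inj {i} {j} e = from-injective υ (trans (sym (fg _)) (trans (cong f (to-injective α e)) (fg _)))
  gf : ∀ a → g (f a) ≡ a
  gf a with injective⇒section g' g'-inj (to α a)
  ... | i , e = trans (cong (λ b → g (f b)) (sym h)) (trans (cong g (fg (from υ i))) h)
    where h : g (from υ i) ≡ a
          h = to-injective α e

bit : ∀ {m} → Bool → Fin (suc m)
bit false = zero
bit true = [ 1 ]

module Zigzag (m : ℕ) where

  M : ℕ
  M = suc m

  -- 0, 1, -1, 2, -2, …
  zig : ℕ → Fin M
  zig zero = zero
  zig (suc n) = bit (not (par n)) ⊕ ⊖ zig n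

  zig-sum : ∀ n → zig n ⊕ zig (suc n) ≡ bit (not (par n))
  zig-sum n = trans (⊕-comm _ _) (⊖⊕ (bit (not (par n))) (zig n))

  zig-even : ∀ r → zig (r + r) ≡ ⊖ [ r ]
  zig-odd : ∀ r → zig (suc (r + r)) ≡ [ suc r ]
  zig-even zero = sym (⊖-unique (trans (⊕-identityʳ [ 0 ]) ([]-toℕ zero)))
  zig-even (suc r) = begin
    zig (suc r + suc r)                                   ≡⟨ cong (λ z → zig (suc z)) (+-suc r r) ⟩
    bit (not (not (par (r + r)))) ⊕ ⊖ zig (suc (r + r))   ≡⟨ cong (λ b → bit (not (not b)) ⊕ ⊖ zig (suc (r + r))) (par-double r) ⟩
    zero ⊕ ⊖ zig (suc (r + r))                            ≡⟨ ⊕-identityˡ _ ⟩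
    ⊖ zig (suc (r + r))                                   ≡⟨ cong ⊖_ (zig-odd r) ⟩
    ⊖ [ suc r ]                                           ∎
    where open ≡-Reasoning
  zig-odd r = begin
    bit (not (par (r + r))) ⊕ ⊖ zig (r + r)   ≡⟨ cong₂ (λ b z → bit (not b) ⊕ ⊖ z) (par-double r) (zig-even r) ⟩
    [ 1 ] ⊕ ⊖ ⊖ [ r ]                         ≡⟨ cong ([ 1 ] ⊕_) (⊖-involutive [ r ]) ⟩
    [ 1 ] ⊕ [ r ]                             ≡⟨ []-⊕ 1 r ⟩
    [ suc r ]                                 ∎
    where open ≡-Reasoning

  -- A nonzero y in the lower half stands at position 2y - 1; one in the upper half equals -(M - y)
  -- and stands at 2(M - y).
  zigpos : Fin M → Fin M
  zigpos zero = zero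
  zigpos y@(suc i) with suc (toℕ i + toℕ i) <? M
  ... | yes p = fromℕ< p
  ... | no ¬p = fromℕ< {(M ∸ toℕ y) + (M ∸ toℕ y)} (lem (toℕ i) m (≮⇒≥ ¬p) (<⇒≤ (toℕ<n y)))
    where
    lem : ∀ i m → suc m ≤ suc (i + i) → suc i ≤ suc m → (m ∸ i) + (m ∸ i) < suc m
    lem i m (s≤s h) (s≤s h') = s≤s (begin
      (m ∸ i) + (m ∸ i)  ≤⟨ +-monoʳ-≤ (m ∸ i) (≤-trans (∸-monoˡ-≤ i h) (≤-reflexive (m+n∸n≡m i i))) ⟩
      (m ∸ i) + i        ≡⟨ m∸n+n≡m h' ⟩
      m                  ∎)
      where open ≤-Reasoning

  zig-zigpos : ∀ y → zig (toℕ (zigpos y)) ≡ y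
  zig-zigpos zero = refl
  zig-zigpos y@(suc i) with suc (toℕ i + toℕ i) <? M
  ... | yes p = trans (cong zig (toℕ-fromℕ< p)) (trans (zig-odd (toℕ i)) ([]-toℕ y))
  ... | no ¬p = trans (cong zig (toℕ-fromℕ< {(M ∸ toℕ y) + (M ∸ toℕ y)} _)) (trans (zig-even (M ∸ toℕ y)) (trans (cong ⊖_ (sym (⊖-def y))) (⊖-involutive y)))

  zig↔ : Fin M ↔ Fin M
  zig↔ = section↔ ↔-refl ↔-refl (λ j → zig (toℕ j)) zigpos zig-zigpos

  -- This makes the edge from the last term to ∞ continue the alternation of sums. If m = 2r, the
  -- last term is -r, and -2r = 1 modulo 2r + 1; if m = 2r + 1, it is r + 1, and 2r + 2 = 0.
  zig-last : zig m ⊕ zig m ≡ bit (not (par m))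
  zig-last with half m
    where
    half : ∀ n → (∃ λ r → n ≡ r + r) ⊎ (∃ λ r → n ≡ suc (r + r))
    half zero = inj₁ (0 , refl)
    half (suc n) with half n
    ... | inj₁ (r , e) = inj₂ (r , cong suc e)
    ... | inj₂ (r , e) = inj₁ (suc r , trans (cong suc e) (cong suc (sym (+-suc r r))))
  ... | inj₁ (r , e) = ⊕-cancelʳ ([ r ] ⊕ [ r ]) (begin
      (zig m ⊕ zig m) ⊕ ([ r ] ⊕ [ r ])            ≡⟨ cong (λ z → (z ⊕ z) ⊕ ([ r ] ⊕ [ r ])) (trans (cong zig e) (zig-even r)) ⟩
      (⊖ [ r ] ⊕ ⊖ [ r ]) ⊕ ([ r ] ⊕ [ r ])        ≡⟨ ⊕-interchange _ _ _ _ ⟩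
      (⊖ [ r ] ⊕ [ r ]) ⊕ (⊖ [ r ] ⊕ [ r ])        ≡⟨ cong₂ _⊕_ (⊕-inverseˡ [ r ]) (⊕-inverseˡ [ r ]) ⟩
      zero ⊕ zero                                  ≡⟨ ⊕-identityʳ zero ⟩
      zero                                         ≡⟨ [M]≡0 ⟨
      [ suc m ]                                    ≡⟨ cong (λ z → [ suc z ]) e ⟩
      [ 1 + (r + r) ]                              ≡⟨ []-⊕ 1 (r + r) ⟨
      [ 1 ] ⊕ [ r + r ]                            ≡⟨ cong ([ 1 ] ⊕_) ([]-⊕ r r) ⟨
      [ 1 ] ⊕ ([ r ] ⊕ [ r ])                      ≡⟨ cong (λ b → bit (not b) ⊕ ([ r ] ⊕ [ r ])) (trans (cong par e) (par-double r)) ⟨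
      bit (not (par m)) ⊕ ([ r ] ⊕ [ r ])          ∎)
    where open ≡-Reasoning
  ... | inj₂ (r , e) = begin
      zig m ⊕ zig m               ≡⟨ cong (λ z → z ⊕ z) (trans (cong zig e) (zig-odd r)) ⟩
      [ suc r ] ⊕ [ suc r ]       ≡⟨ []-⊕ (suc r) (suc r) ⟩
      [ suc (r + suc r) ]         ≡⟨ cong [_] (cong suc (trans (+-suc r r) (sym e))) ⟩
      [ suc m ]                   ≡⟨ [M]≡0 ⟩
      zero                        ≡⟨ cong (λ b → bit (not (not b))) (par-double r) ⟨
      bit (not (not (par (r + r))))  ≡⟨ cong (λ z → bit (not (par z))) e ⟨
      bit (not (par m))           ∎
    where open ≡-Reasoning

  -- The complete graph on ℤ/M together with a point zero = ∞; a pair {∞ , a} gets the sum a + a.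
  S : Fin (suc M) → Fin (suc M) → Fin M
  S zero zero = zero
  S zero (suc a) = a ⊕ a
  S (suc a) zero = a ⊕ a
  S (suc a) (suc b) = a ⊕ b

  S-comm : ∀ u w → S u w ≡ S w u
  S-comm zero zero = refl
  S-comm zero (suc a) = refl
  S-comm (suc a) zero = refl
  S-comm (suc a) (suc b) = ⊕-comm a b

  ∞+ : Fin M ↔ Fin M → Fin (suc M) ↔ Fin (suc M)
  ∞+ f = mk↔ₛ′ t g tg gt
    where
    t g : Fin (suc M) → Fin (suc M)
    t zero = zero
    t (suc a) = suc (to f a)
    g zero = zero
    g (suc a) = suc (from f a)
    tg : ∀ y → t (g y) ≡ y
    tg zero = refl
    tg (suc a) = cong suc (to-from f a)
    gt : ∀ y → g (t y) ≡ y
    gt zero = refl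
    gt (suc a) = cong suc (from-to f a)

  zigzag : Fin M ↔ Fin M → Fin (suc M) ↔ Fin (suc M)
  zigzag f = ∞+ (↔-trans zig↔ f)

  -- The plain zigzag has alternating sums 0 and 1, and `f` acts on sums through `h`. The convention
  -- S ∞ a = a + a lets both edges at ∞ follow the pattern. Translations, negation and doubling are
  -- of this kind.
  zigzag-sum : (f : Fin M ↔ Fin M) (h : Fin M → Fin M) → (∀ a b → to f a ⊕ to f b ≡ h (a ⊕ b)) →
    ∀ j → S (to (zigzag f) j) (to (zigzag f) (next j)) ≡ h (bit (par (toℕ j)))
  zigzag-sum f h hom zero = trans (cong (λ j → S zero (to (zigzag f) j)) (next-step {j = zero} {suc zero} refl)) (trans (hom zero zero) (cong h (⊕-identityʳ zero)))
  zigzag-sum f h hom (suc i) with nextView i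
  ... | inj₁ e = trans (cong (λ j → S (to (zigzag f) (suc i)) (to (zigzag f) j)) (next-step {j = suc i} {suc (next i)} (cong suc (sym e))))
        (trans (hom _ _) (cong h (trans (cong (zig (toℕ i) ⊕_) (cong zig e)) (zig-sum (toℕ i)))))
  ... | inj₂ (e , _) = trans (cong (λ j → S (to (zigzag f) (suc i)) (to (zigzag f) j)) (next-wrap {j = suc i} {zero} (cong suc e) refl))
        (trans (hom _ _) (cong h (subst (λ n → zig n ⊕ zig n ≡ bit (not (par n))) (sym (suc-injective e)) zig-last)))

  shift : Fin M → Fin M ↔ Fin M
  shift t = mk↔ₛ′ (_⊕ t) (_⊕ ⊖ t) (λ a → ⊖⊕ a t) (λ a → ⊕⊖ a t)

  negate : Fin M ↔ Fin M
  negate = mk↔ₛ′ ⊖_ ⊖_ ⊖-involutive ⊖-involutive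

-- From edge-disjoint factors to decompositions

nbr : ∀ {V N} → Factor V N → Bool → V → V
nbr F false u = to (pt F) (proj₁ (from (pt F) u) , next (proj₂ (from (pt F) u)))
nbr F true u = to (pt F) (proj₁ (from (pt F) u) , prev (proj₂ (from (pt F) u)))

nbr-edge : ∀ {V N} (F : Factor V N) b u → Edge F u (nbr F b u)
nbr-edge F false u = fwd (step _ _ (to-from (pt F) u) refl)
nbr-edge F true u = bwd (step _ (prev _) refl (trans (cong (λ j → to (pt F) (_ , j)) (next-prev _)) (to-from (pt F) u)))

step-irrefl : ∀ {V N} → 3 ≤ N → (F : Factor V N) → ∀ {u} → ¬ Step F u u
step-irrefl h F (step i j e e') = next≢ (≤-trans (n≤1+n 2) h) j (,-injectiveʳ (to-injective (pt F) (trans e' (sym e))))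

edge-irrefl : ∀ {V N} → 3 ≤ N → (F : Factor V N) → ∀ {u} → ¬ Edge F u u
edge-irrefl h F (fwd s) = step-irrefl h F s
edge-irrefl h F (bwd s) = step-irrefl h F s

nbr-distinct : ∀ {V N} → 3 ≤ N → (F : Factor V N) → ∀ b c u → nbr F b u ≡ nbr F c u → b ≡ c
nbr-distinct h F false false u e = refl
nbr-distinct h F true true u e = refl
nbr-distinct h F false true u e = ⊥-elim (next²≢ h _ (trans (cong next (,-injectiveʳ (to-injective (pt F) e))) (next-prev _)))
nbr-distinct h F true false u e = ⊥-elim (next²≢ h _ (trans (cong next (sym (,-injectiveʳ (to-injective (pt F) e)))) (next-prev _)))

record Design (V : Set) (N c : ℕ) : Set where
  field
    mate     : V → V
    noFix    : ∀ u → mate u ≢ u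
    involut  : ∀ u → mate (mate u) ≡ u
    hex      : Factor V 6
    main     : Fin c → Factor V N
    hexMate  : ∀ {u w} → Edge hex u w → w ≢ mate u
    mainMate : ∀ i {u w} → Edge (main i) u w → w ≢ mate u
    hexMain  : ∀ i {u w} → Edge hex u w → Edge (main i) u w → ⊥
    mainDisj : ∀ {i j u w} → Edge (main i) u w → Edge (main j) u w → i ≡ j

open Design public

mkDesign : ∀ {V N c I} {Eh E : V → V → Set} (m : V → V) → (∀ u → m u ≢ u) → (∀ u → m (m u) ≡ u) →
  (h : Factor V 6) → (∀ {u w} → Edge h u w → Eh u w) → Fam V N I E → I ↔ Fin c →
  (∀ u → ¬ Eh u (m u)) → (∀ u → ¬ E u (m u)) → (∀ {u w} → Eh u w → E u w → ⊥) → Design V N c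
mkDesign m nf inv h hE F f hm em he = record
  { mate = m ; noFix = nf ; involut = inv ; hex = h ; main = λ i → factor F (from f i)
  ; hexMate = λ { {u} e refl → hm u (hE e) }
  ; mainMate = λ { i {u} e refl → em u (within F _ e) }
  ; hexMain = λ i e e' → he (hE e) (within F _ e')
  ; mainDisj = λ e e' → from-injective f (disj F e e') }

mapDesign : ∀ {V V' N c} → V ↔ V' → Design V N c → Design V' N c
mapDesign f D = record
  { mate = λ u → to f (mate D (from f u))
  ; noFix = λ u e → noFix D (from f u) (trans (sym (from-to f _)) (cong (from f) e))
  ; involut = λ u → trans (cong (λ z → to f (mate D z)) (from-to f _)) (trans (cong (to f) (involut D _)) (to-from f u))
  ; hex = mapFactor f (hex D)
  ; main = λ i → mapFactor f (main D i)
  ; hexMate = λ e e' → hexMate D (lift (hex D) e) (trans (cong (from f) e') (from-to f _))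
  ; mainMate = λ i e e' → mainMate D i (lift (main D i) e) (trans (cong (from f) e') (from-to f _))
  ; hexMain = λ i e e' → hexMain D i (lift (hex D) e) (lift (main D i) e')
  ; mainDisj = λ {i} {j} e e' → mainDisj D (lift (main D i) e) (lift (main D j) e') }
  where
  lift : ∀ {N} (F : Factor _ N) {u w} → Edge (mapFactor f F) u w → Edge F (from f u) (from f w)
  lift F = gmap (from f) (mapFactor-step f F)

toCycleFactor : ∀ {v N} → Factor (Fin v) N → CycleFactor v N
toCycleFactor F = record { k = count F ; cyc = λ i j → to (pt F) (i , j) ; cover = ↔⇒⤖ (pt F) ; coverIsCyc = λ _ _ → refl }

Edge⇒Adj : ∀ {v N} (F : Factor (Fin v) N) {u w} → Edge F u w → Adj (toCycleFactor F) u w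
Edge⇒Adj F (fwd (step i j e e')) = i , j , inj₁ (e , e')
Edge⇒Adj F (bwd (step i j e e')) = i , j , inj₂ (e , e')

Adj⇒Edge : ∀ {v N} (F : Factor (Fin v) N) {u w} → Adj (toCycleFactor F) u w → Edge F u w
Adj⇒Edge F (i , j , inj₁ (e , e')) = fwd (step i j e e')
Adj⇒Edge F (i , j , inj₂ (e , e')) = bwd (step i j e e')

oneFactor : ∀ {v N c} → Design (Fin v) N c → OneFactor v
oneFactor D = record { mate = mate D ; noFix = noFix D ; involut = involut D }

module _ {v N c : ℕ} (N≥3 : 3 ≤ N) (total : 2 + (1 + c) * 2 ≡ v) (D : Design (Fin v) N c) where

  private
    Ix : Set
    Ix = Fin 1 ⊎ Fin c

    EdgeAt : Ix → Fin v → Fin v → Set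
    EdgeAt (inj₁ _) = Edge (hex D)
    EdgeAt (inj₂ i) = Edge (main D i)

    nb : Ix → Bool → Fin v → Fin v
    nb (inj₁ _) = nbr (hex D)
    nb (inj₂ i) = nbr (main D i)

    nb-edge : ∀ i b u → EdgeAt i u (nb i b u)
    nb-edge (inj₁ _) = nbr-edge (hex D)
    nb-edge (inj₂ i) = nbr-edge (main D i)

    nb-distinct : ∀ i b b' u → nb i b u ≡ nb i b' u → b ≡ b'
    nb-distinct (inj₁ _) = nbr-distinct (s≤s (s≤s (s≤s z≤n))) (hex D)
    nb-distinct (inj₂ i) = nbr-distinct N≥3 (main D i)

    irrefl : ∀ i {u} → ¬ EdgeAt i u u
    irrefl (inj₁ _) = edge-irrefl (s≤s (s≤s (s≤s z≤n))) (hex D)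
    irrefl (inj₂ i) = edge-irrefl N≥3 (main D i)

    notMate : ∀ i {u w} → EdgeAt i u w → w ≢ mate D u
    notMate (inj₁ _) = hexMate D
    notMate (inj₂ i) = mainMate D i

    edge-disj : ∀ i j {u w} → EdgeAt i u w → EdgeAt j u w → i ≡ j
    edge-disj (inj₁ zero) (inj₁ zero) _ _ = refl
    edge-disj (inj₁ _) (inj₂ j) e e' = ⊥-elim (hexMain D j e e')
    edge-disj (inj₂ i) (inj₁ _) e e' = ⊥-elim (hexMain D i e' e)
    edge-disj (inj₂ i) (inj₂ j) e e' = cong inj₂ (mainDisj D e e')

    Nbr : Set
    Nbr = Bool ⊎ (Ix × Bool)

    place : Fin v → Nbr → Fin v
    place u (inj₁ false) = u
    place u (inj₁ true) = mate D u
    place u (inj₂ (i , b)) = nb i b u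

    place-injective : ∀ u {p q} → place u p ≡ place u q → p ≡ q
    place-injective u {inj₁ false} {inj₁ false} e = refl
    place-injective u {inj₁ true} {inj₁ true} e = refl
    place-injective u {inj₁ false} {inj₁ true} e = ⊥-elim (noFix D u (sym e))
    place-injective u {inj₁ true} {inj₁ false} e = ⊥-elim (noFix D u e)
    place-injective u {inj₁ false} {inj₂ (i , b)} e = ⊥-elim (irrefl i (subst (EdgeAt i u) (sym e) (nb-edge i b u)))
    place-injective u {inj₂ (i , b)} {inj₁ false} e = ⊥-elim (irrefl i (subst (EdgeAt i u) e (nb-edge i b u)))
    place-injective u {inj₁ true} {inj₂ (i , b)} e = ⊥-elim (notMate i (nb-edge i b u) (sym e))
    place-injective u {inj₂ (i , b)} {inj₁ true} e = ⊥-elim (notMate i (nb-edge i b u) e)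
    place-injective u {inj₂ (i , b)} {inj₂ (j , d)} e with edge-disj i j (nb-edge i b u) (subst (EdgeAt j u) (sym e) (nb-edge j d u))
    ... | refl = cong (λ x → inj₂ (i , x)) (nb-distinct i b d u e)

    number : Fin v ↔ Nbr
    number = subst (λ n → Fin n ↔ Nbr) total (↔-trans +↔⊎ (2↔Bool ⊎-↔ (↔-trans *↔× (+↔⊎ ×-↔ 2↔Bool))))

    -- u, its mate and its two neighbours in every factor are v distinct vertices, hence all vertices.
    place-onto : ∀ u w → ∃ λ p → place u p ≡ w
    place-onto u w = let (i , e) = injective⇒section (λ i → place u (to number i))
                                     (λ e → to-injective number (place-injective u e)) w
                     in to number i , e

  design⇒decomposition : Decomposition v 6 N 1 c (KminusF (oneFactor D))
  design⇒decomposition = (λ _ → toCycleFactor (hex D)) , (λ i → toCycleFactor (main D i)) , sound , complete , unique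
    where
    edge : ∀ i {u w} → InFactor (λ (_ : Fin 1) → toCycleFactor (hex D)) (λ i → toCycleFactor (main D i)) i u w → EdgeAt i u w
    edge (inj₁ _) = Adj⇒Edge (hex D)
    edge (inj₂ i) = Adj⇒Edge (main D i)
    adj : ∀ i {u w} → EdgeAt i u w → InFactor (λ (_ : Fin 1) → toCycleFactor (hex D)) (λ i → toCycleFactor (main D i)) i u w
    adj (inj₁ _) = Edge⇒Adj (hex D)
    adj (inj₂ i) = Edge⇒Adj (main D i)
    sound : ∀ i u w → _ → u ≢ w × w ≢ mate D u
    sound i u w a = (λ { refl → irrefl i (edge i a) }) , notMate i (edge i a)
    complete : ∀ u w → u ≢ w × w ≢ mate D u → _
    complete u w (u≢w , w≢m) with place-onto u w
    ... | inj₁ false , e = ⊥-elim (u≢w e)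
    ... | inj₁ true , e = ⊥-elim (w≢m (sym e))
    ... | inj₂ (i , b) , e = i , adj i (subst (EdgeAt i u) e (nb-edge i b u))
    unique : ∀ i j u w → _ → _ → i ≡ j
    unique i j u w a a' = edge-disj i j (edge i a) (edge j a')

design⇒HWP : ∀ {V v N c} → V ↔ Fin v → 3 ≤ N → 2 + (1 + c) * 2 ≡ v → v % 2 ≡ 0 → Design V N c → HWP v 6 N 1 c
design⇒HWP f h total even D = inj₂ (even , oneFactor (mapDesign f D) , design⇒decomposition h total (mapDesign f D))

-- Doubled cycles

xor-self : ∀ a b → a xor (a xor b) ≡ b
xor-self a b = trans (sym (xor-assoc a a b)) (cong (_xor b) (xor-same a))

xor-cancelʳ : ∀ a b → (b xor a) xor a ≡ b
xor-cancelʳ a b = trans (xor-assoc b a a) (trans (cong (b xor_) (xor-same a)) (xor-identityʳ b))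

not-xorˡ : ∀ a b → not a xor b ≡ not (a xor b)
not-xorˡ a b = sym (not-distribˡ-xor a b)

not-xorʳ : ∀ a b → a xor not b ≡ not (a xor b)
not-xorʳ a b = sym (not-distribʳ-xor a b)

bool : Fin 2 → Bool
bool = to 2↔Bool

unbool : Bool → Fin 2
unbool = from 2↔Bool

bool-next : ∀ b → bool (next b) ≡ not (bool b)
bool-next zero = refl
bool-next (suc zero) = refl

carry-step : ∀ {A x} {a a' : Fin A} {j j' : Fin x} → Carry (a , j) (a' , j') → next j ≡ j'
carry-step (inj₁ (_ , e)) = next-step (sym e)
carry-step (inj₂ (_ , e , z)) = next-wrap e z

spread : {K A R : Set} → (K × Bool) ↔ R → (K × (A × Bool)) ↔ (A × R)
spread f = ↔-trans (mk↔ₛ′ (λ { (k , a , e) → a , k , e }) (λ { (a , k , e) → k , a , e }) (λ _ → refl) (λ _ → refl)) (↔-refl ×-↔ f)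

-- For odd x the rails joining the two rows of every pair in both directions form cycles of length 2x.
module Cross {R K : Set} {r x : ℕ} (odd : par x ≡ true) (fK : K ↔ Fin r) (rows : (K × Bool) ↔ R) where

  pts : (K × (Fin 2 × Fin x)) ↔ (Fin x × R)
  pts = mk↔ₛ′ f g fg gf
    where
    f : K × (Fin 2 × Fin x) → Fin x × R
    f (k , b , a) = a , to rows (k , bool b xor par (toℕ a))
    g : Fin x × R → K × (Fin 2 × Fin x)
    g (a , p) = proj₁ (from rows p) , unbool (proj₂ (from rows p) xor par (toℕ a)) , a
    fg : ∀ v → f (g v) ≡ v
    fg (a , p) = cong (a ,_) (trans (cong (λ b → to rows (proj₁ (from rows p) , b))
      (trans (cong (_xor par (toℕ a)) (to-from 2↔Bool (proj₂ (from rows p) xor par (toℕ a)))) (xor-cancelʳ (par (toℕ a)) _))) (to-from rows p))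
    gf : ∀ v → g (f v) ≡ v
    gf (k , b , a) rewrite from-to rows (k , bool b xor par (toℕ a)) =
      cong (λ z → k , z , a) (trans (cong unbool (xor-cancelʳ (par (toℕ a)) (bool b))) (from-to 2↔Bool b))

  crossFactor : Factor (Fin x × R) (2 * x)
  crossFactor = mkFactor fK pts

  crossRail : Fin x → R → R → Set
  crossRail _ p q = ∃ λ k → ∃ λ b → p ≡ to rows (k , b) × q ≡ to rows (k , not b)

  cross-step : ∀ {u w} → Step crossFactor u w → SymClosure (Rail crossRail) u w
  cross-step s with mkFactor-step fK pts s
  ... | k , (b , a) , (b' , a') , c , refl , refl = fwd (sym (carry-step c) , k , bool b xor par (toℕ a) , refl , cong (λ z → to rows (k , z)) (lem c))
    where
    lem : Carry (b , a) (b' , a') → bool b' xor par (toℕ a') ≡ not (bool b xor par (toℕ a))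
    lem (inj₁ (refl , e)) = trans (cong (λ z → bool b xor par z) e) (not-xorʳ (bool b) _)
    -- A lap has x steps and x is odd, so it ends on the other side; the lap digit `b` records this,
    -- and the cycle closes after two laps.
    lem (inj₂ (refl , e , z)) = trans (cong₂ (λ p q → p xor par q) (bool-next b) z)
      (trans (not-xorˡ (bool b) false) (cong (λ p → not (bool b xor p)) (sym (lem' _ (trans (cong par e) odd)))))
      where lem' : ∀ b → not b ≡ true → b ≡ false
            lem' false _ = refl

carry-unique : ∀ {A B} {p q q' : Fin A × Fin B} → Carry p q → Carry p q' → q ≡ q'
carry-unique {q = _ , j} {_ , j'} (inj₁ (refl , e)) (inj₁ (refl , e')) = cong (_ ,_) (toℕ-injective (trans e (sym e')))
carry-unique {q = _ , j} {_ , j'} (inj₂ (refl , _ , e)) (inj₂ (refl , _ , e')) = cong (_ ,_) (toℕ-injective (trans e (sym e')))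
carry-unique {q = _ , j} (inj₁ (_ , e)) (inj₂ (_ , e' , _)) = ⊥-elim (<-irrefl (trans e e') (toℕ<n j))
carry-unique {q' = _ , j} (inj₂ (_ , e' , _)) (inj₁ (_ , e)) = ⊥-elim (<-irrefl (trans e e') (toℕ<n j))

carry⇒next : ∀ {A B} (p q : Fin A × Fin B) → Carry p q → uncurry combine q ≡ next (uncurry combine p)
carry⇒next (a , b) q c with next-combine a b
... | q' , e , c' = trans (cong (uncurry combine) (carry-unique c c')) (sym e)

-- Häggkvist's doubling: C_n[2] with n = k x splits into two C_2x-factors.
module Häggkvist (k y : ℕ) where

  x : ℕ
  x = suc (suc y)

  -- Inside a segment the factor `h` follows two disjoint paths: they are parallel for `h` false and
  -- change copy at every step for `h` true.
  strand : Bool → ℕ → Bool → Bool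
  strand h j σ = σ xor (h ∧ par j)

  strand-involutive : ∀ h j σ → strand h j (strand h j σ) ≡ σ
  strand-involutive h j σ = xor-cancelʳ (h ∧ par j) σ

  -- Cycle b starts at copy `h` of the first vertex of segment b, follows one strand to copy `not h`
  -- of the first vertex of the next segment and returns on the other strand: two end points and two
  -- strands of x - 1 vertices.
  pts : Bool → (Fin k × (Fin 2 × Fin x)) ↔ ((Fin k × Fin x) × Bool)
  pts h = mk↔ₛ′ f g fg gf
    where
    f : Fin k × (Fin 2 × Fin x) → (Fin k × Fin x) × Bool
    f (b , zero , zero) = (b , zero) , h
    f (b , zero , suc j) = (b , suc j) , strand h (suc (toℕ j)) false
    f (b , suc zero , zero) = (next b , zero) , not h
    f (b , suc zero , suc j) = (b , suc (opposite j)) , strand h (suc (toℕ (opposite j))) true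

    g₀ : Fin k → Bool → Fin k × (Fin 2 × Fin x)
    g₀ b false = b , zero , zero
    g₀ b true = prev b , suc zero , zero

    g₁ : Fin k → Fin (suc y) → Bool → Fin k × (Fin 2 × Fin x)
    g₁ b j false = b , zero , suc j
    g₁ b j true = b , suc zero , suc (opposite j)

    g : (Fin k × Fin x) × Bool → Fin k × (Fin 2 × Fin x)
    g ((b , zero) , e) = g₀ b (e xor h)
    g ((b , suc j) , e) = g₁ b j (strand h (suc (toℕ j)) e)

    fg₀ : ∀ b c → f (g₀ b c) ≡ ((b , zero) , c xor h)
    fg₀ b false = refl
    fg₀ b true = cong (λ z → (z , zero) , not h) (next-prev b)

    fg₁ : ∀ b j c → f (g₁ b j c) ≡ ((b , suc j) , strand h (suc (toℕ j)) c)
    fg₁ b j false = refl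
    fg₁ b j true = cong (λ z → (b , suc z) , strand h (suc (toℕ z)) true) (opposite-involutive j)

    fg : ∀ v → f (g v) ≡ v
    fg ((b , zero) , e) = trans (fg₀ b (e xor h)) (cong ((b , zero) ,_) (xor-cancelʳ h e))
    fg ((b , suc j) , e) = trans (fg₁ b j _) (cong ((b , suc j) ,_) (strand-involutive h (suc (toℕ j)) e))

    gf : ∀ v → g (f v) ≡ v
    gf (b , zero , zero) = cong (g₀ b) (xor-same h)
    gf (b , zero , suc j) = cong (g₁ b j) (strand-involutive h (suc (toℕ j)) false)
    gf (b , suc zero , zero) = trans (cong (g₀ (next b)) (trans (not-xorˡ h h) (cong not (xor-same h)))) (cong (λ z → z , suc zero , zero) (prev-next b))
    gf (b , suc zero , suc j) = trans (cong (g₁ b (opposite j)) (strand-involutive h (suc (toℕ (opposite j))) true))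
      (cong (λ z → b , suc zero , suc z) (opposite-involutive j))

  ringFactor : Bool → Factor (Fin (k * x) × Bool) (2 * x)
  ringFactor h = mapFactor (↔-sym *↔× ×-↔ ↔-refl) (mkFactor ↔-refl (pts h))

  -- The factor containing the edge from (j , e) to (j + 1 , e').
  colour : Fin x → Bool → Bool → Bool
  colour zero e e' = e
  colour (suc j) e e' with suc (toℕ j) ≟ℕ suc y
  ... | yes _ = not e'
  ... | no _ = e xor e'

  rail : Bool → Fin (k * x) → Bool → Bool → Set
  rail h a e e' = colour (proj₂ (remQuot {k} x a)) e e' ≡ h

  Rail' : Bool → (Fin k × Fin x) × Bool → (Fin k × Fin x) × Bool → Set
  Rail' h (p , e) (q , e') = Carry p q × colour (proj₂ p) e e' ≡ h

  colour-last : ∀ h j e → suc (toℕ j) ≡ suc y → colour (suc j) e (not h) ≡ h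
  colour-last h j e q with suc (toℕ j) ≟ℕ suc y
  ... | yes _ = not-involutive h
  ... | no ¬q = ⊥-elim (¬q q)

  colour-mid : ∀ h (j j' : Fin (suc y)) σ → toℕ j' ≡ suc (toℕ j) →
    colour (suc j) (strand h (suc (toℕ j)) σ) (strand h (suc (toℕ j')) σ) ≡ h
  colour-mid h j j' σ q with suc (toℕ j) ≟ℕ suc y
  ... | yes e = ⊥-elim (<-irrefl (trans q e) (toℕ<n j'))
  ... | no _ = trans (cong (λ z → strand h (suc (toℕ j)) σ xor strand h (suc z) σ) q) (lem h (par (toℕ j)) σ)
    where
    lem : ∀ h p σ → (σ xor (h ∧ not p)) xor (σ xor (h ∧ not (not p))) ≡ h
    lem false p false = refl
    lem false p true = refl
    lem true false false = refl
    lem true false true = refl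
    lem true true false = refl
    lem true true true = refl

  pts-step : ∀ h {u w} → Step (mkFactor {k = k} ↔-refl (pts h)) u w → SymClosure (Rail' h) u w
  pts-step h s with mkFactor-step ↔-refl (pts h) s
  ... | b , (zero , zero) , (.zero , suc j) , inj₁ (refl , q) , refl , refl = fwd (inj₁ (refl , q) , refl)
  ... | b , (zero , zero) , (.zero , zero) , inj₁ (refl , ()) , refl , refl
  ... | b , (zero , suc i) , (.zero , suc j) , inj₁ (refl , q) , refl , refl = fwd (inj₁ (refl , q) , colour-mid h i j false (suc-injective q))
  ... | b , (zero , zero) , (c , j) , inj₂ (e , () , z) , refl , refl
  ... | b , (zero , suc i) , (.(next zero) , zero) , inj₂ (refl , q , z) , refl , refl = fwd (inj₂ (refl , q , refl) , colour-last h i _ (suc-injective q))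
  ... | b , (suc zero , zero) , (.(suc zero) , suc j) , inj₁ (refl , q) , refl , refl =
        bwd (inj₂ (refl , cong suc l , refl) , colour-last h (opposite j) _ l)
    where l : suc (toℕ (opposite j)) ≡ suc y
          l = cong suc (trans (opposite-prop j) (cong (y ∸_) (suc-injective q)))
  ... | b , (suc zero , suc i) , (.(suc zero) , suc j) , inj₁ (refl , q) , refl , refl =
        bwd (inj₁ (refl , cong suc l) , colour-mid h (opposite j) (opposite i) true l)
    where l : toℕ (opposite i) ≡ suc (toℕ (opposite j))
          l = trans (opposite-prop i) (trans (cong (suc y ∸_) (sym (suc-injective q)))
                (trans (+-∸-assoc 1 {y} {toℕ j} (≤-pred (toℕ<n j))) (cong suc (sym (opposite-prop j)))))
  ... | b , (suc zero , suc i) , (.(next (suc zero)) , zero) , inj₂ (refl , q , z) , refl , refl =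
        bwd (inj₁ (refl , cong suc l) , refl)
    where l : toℕ (opposite i) ≡ 0
          l = trans (opposite-prop i) (trans (cong (suc y ∸_) (suc-injective q)) (m≤n⇒m∸n≡0 {suc y} ≤-refl))

  ring-step : ∀ h {u w} → Step (ringFactor h) u w → SymClosure (Rail (rail h)) u w
  ring-step h {a , e} {a' , e'} s = lem (pts-step h (mapFactor-step (↔-sym *↔× ×-↔ ↔-refl) (mkFactor ↔-refl (pts h)) s))
    where
    nx : ∀ a b → Carry (remQuot {k} x a) (remQuot {k} x b) → b ≡ next a
    nx a b c = trans (sym (combine-remQuot {k} x b)) (trans (carry⇒next _ _ c) (cong next (combine-remQuot {k} x a)))
    lem : SymClosure (Rail' h) (remQuot {k} x a , e) (remQuot {k} x a' , e') → SymClosure (Rail (rail h)) (a , e) (a' , e')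
    lem (fwd (c , r)) = fwd (nx a a' c , r)
    lem (bwd (c , r)) = bwd (nx a' a c , r)

doubleFam : ∀ n k x → n ≡ k * x → 2 ≤ x → 3 ≤ n → Fam (Fin n × Bool) (2 * x) Bool Ring
doubleFam n k (suc (suc y)) refl _ h = railFam h ringFactor rail ring-step (λ i j p q → trans (sym p) q)
  where open Häggkvist k y
doubleFam n k (suc zero) e (s≤s ()) h

-- Multiplication by k + 1 is halving, as 2(k + 1) = 1 modulo 2k + 1.
double↔ : ∀ k → Fin (suc (k + k)) ↔ Fin (suc (k + k))
double↔ k = section↔ ↔-refl ↔-refl (λ a → a ⊕ a) (λ a → [ suc k * toℕ a ]) λ a →
  trans ([]-⊕ (suc k * toℕ a) (suc k * toℕ a)) (trans ([]-cong _ _ (trans (cong (_% suc (k + k)) (lem k (toℕ a)))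
    ([m+kn]%n≡m%n (toℕ a) (toℕ a) (suc (k + k))))) ([]-toℕ a))
  where
  open +-*-Solver
  lem : ∀ k a → suc k * a + suc k * a ≡ a + a * suc (k + k)
  lem = solve 2 (λ k a → (con 1 :+ k) :* a :+ (con 1 :+ k) :* a := a :+ a :* (con 1 :+ (k :+ k))) refl

-- C_L[w] splits into Hamilton cycles indexed by κ ∈ ℤ/w: the cycle visits (i , r + e_i κ) at time r L + i,
-- where e = 0, 1, 0, 1, … except that e_{L-1} = 2 for odd L.
module Wreath (L k : ℕ) (L≥3 : 3 ≤ L) where

  w : ℕ
  w = suc (k + k)

  last? : (i : Fin L) → Dec (suc (toℕ i) ≡ L)
  last? i = suc (toℕ i) ≟ℕ L

  pick : ∀ {P : Set} → Dec P → Bool → Bool → Fin w → Fin w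
  pick (yes _) true _ κ = κ ⊕ κ
  pick (yes _) false true κ = κ
  pick (yes _) false false κ = zero
  pick (no _) _ true κ = κ
  pick (no _) _ false κ = zero

  off : Fin L → Fin w → Fin w
  off i = pick (last? i) (par L) (par (toℕ i))

  -- Stepping from position L - 1 to position 0 begins the next round, which raises r by 1.
  wrap : ∀ {P : Set} → Dec P → Fin w
  wrap (yes _) = [ 1 ]
  wrap (no _) = zero

  wrap-yes : ∀ {P : Set} (d : Dec P) → P → wrap d ≡ [ 1 ]
  wrap-yes (yes _) _ = refl
  wrap-yes (no ¬p) p = ⊥-elim (¬p p)

  wrap-no : ∀ {P : Set} (d : Dec P) → ¬ P → wrap d ≡ zero
  wrap-no (yes p) ¬p = ⊥-elim (¬p p)
  wrap-no (no _) _ = refl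

  data Kind : (Fin w → Fin w) → (Fin w → Fin w) → Set where
    0→κ : Kind (λ _ → zero) (λ κ → κ)
    κ→0 : Kind (λ κ → κ) (λ _ → zero)
    κ→2κ : Kind (λ κ → κ) (λ κ → κ ⊕ κ)
    2κ→0 : Kind (λ κ → κ ⊕ κ) (λ _ → zero)

  off-zero : ∀ i → toℕ i ≡ 0 → ∀ κ → off i κ ≡ zero
  off-zero i z κ with last? i
  ... | yes e = ⊥-elim (1+n≰n (≤-trans (s≤s (s≤s z≤n)) (subst (3 ≤_) (trans (sym e) (cong suc z)) L≥3)))
  ... | no _ rewrite z = refl

  off-last : ∀ i → suc (toℕ i) ≡ L → (∀ κ → off i κ ≡ κ ⊕ κ) ⊎ (∀ κ → off i κ ≡ κ)
  off-last i e with last? i | par L in p | par (toℕ i) in q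
  ... | no ¬e | _ | _ = ⊥-elim (¬e e)
  ... | yes _ | true | _ = inj₁ (λ _ → refl)
  ... | yes _ | false | true = inj₂ (λ _ → refl)
  ... | yes _ | false | false = case trans (sym p) (trans (cong par (sym e)) (cong not q)) of λ ()

  kind : ∀ i → ∃ λ f → ∃ λ g → Kind f g × (∀ κ → off i κ ≡ f κ) × (∀ κ → off (next i) κ ≡ g κ)
  kind i with nextView i
  ... | inj₂ (e , z) with off-last i e
  ...   | inj₁ o = _ , _ , 2κ→0 , o , off-zero (next i) z
  ...   | inj₂ o = _ , _ , κ→0 , o , off-zero (next i) z
  kind i | inj₁ e with last? i
  ...   | yes l = ⊥-elim (<-irrefl (trans e l) (toℕ<n (next i)))
  ...   | no _ with last? (next i) | par L in p | par (toℕ i) in q | par (toℕ (next i)) in q' | cong par e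
  ...     | _ | _ | false | false | ()
  ...     | _ | _ | true | true | ()
  ...     | no _ | _ | false | true | _ = _ , _ , 0→κ , (λ _ → refl) , (λ _ → refl)
  ...     | no _ | _ | true | false | _ = _ , _ , κ→0 , (λ _ → refl) , (λ _ → refl)
  ...     | yes l | true | true | false | _ = _ , _ , κ→2κ , (λ _ → refl) , (λ _ → refl)
  ...     | yes l | false | true | false | _ = _ , _ , κ→0 , (λ _ → refl) , (λ _ → refl)
  ...     | yes l | false | false | true | _ = _ , _ , 0→κ , (λ _ → refl) , (λ _ → refl)
  ...     | yes l | true | false | true | r = case trans (sym p) (trans (cong par (sym l)) (cong not q')) of λ ()

  rail : Fin w → Fin L → Fin w → Fin w → Set
  rail κ i c c' = c' ⊕ off i κ ≡ (c ⊕ off (next i) κ) ⊕ wrap (last? i)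

  -- The displacement along a rail contains κ times e_{i+1} - e_i, which is 1, -1 or -2. These are
  -- invertible modulo the odd number w, so the end points determine κ. For odd L the final value 2
  -- is what avoids a difference 0.
  rail-disj : ∀ κ κ' {i c c'} → rail κ i c c' → rail κ' i c c' → κ ≡ κ'
  rail-disj κ κ' {i} {c} {c'} p p' with kind i
  ... | f , g , K , ef , eg = lem K (eq κ p) (eq κ' p')
    where
    W = wrap (last? i)
    eq : ∀ κ → rail κ i c c' → c' ⊕ f κ ≡ (c ⊕ g κ) ⊕ W
    eq κ p = trans (cong (c' ⊕_) (sym (ef κ))) (trans p (cong (λ z → (c ⊕ z) ⊕ W) (eg κ)))
    lem : ∀ {f g} → Kind f g → c' ⊕ f κ ≡ (c ⊕ g κ) ⊕ W → c' ⊕ f κ' ≡ (c ⊕ g κ') ⊕ W → κ ≡ κ'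
    lem 0→κ p q = ⊕-cancelˡ c (⊕-cancelʳ W (trans (sym p) q))
    lem κ→0 p q = ⊕-cancelˡ c' (trans p (sym q))
    lem 2κ→0 p q = to-injective (double↔ k) (⊕-cancelˡ c' (trans p (sym q)))
    lem κ→2κ p q = ⊕-cancelˡ c (⊕-cancelʳ W (trans (sym (red κ p)) (red κ' q)))
      where
      red : ∀ κ → c' ⊕ κ ≡ (c ⊕ (κ ⊕ κ)) ⊕ W → c' ≡ (c ⊕ κ) ⊕ W
      red κ p = ⊕-cancelʳ κ (begin
        c' ⊕ κ                ≡⟨ p ⟩
        (c ⊕ (κ ⊕ κ)) ⊕ W     ≡⟨ cong (_⊕ W) (⊕-assoc c κ κ) ⟨
        ((c ⊕ κ) ⊕ κ) ⊕ W     ≡⟨ ⊕-assoc (c ⊕ κ) κ W ⟩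
        (c ⊕ κ) ⊕ (κ ⊕ W)     ≡⟨ cong ((c ⊕ κ) ⊕_) (⊕-comm κ W) ⟩
        (c ⊕ κ) ⊕ (W ⊕ κ)     ≡⟨ ⊕-assoc (c ⊕ κ) W κ ⟨
        ((c ⊕ κ) ⊕ W) ⊕ κ     ∎)
        where open ≡-Reasoning

  skew : Fin w → (Fin w × Fin L) ↔ (Fin L × Fin w)
  skew κ = mk↔ₛ′ (λ { (r , i) → i , r ⊕ off i κ }) (λ { (i , c) → c ⊕ ⊖ off i κ , i })
    (λ { (i , c) → cong (i ,_) (⊖⊕ c (off i κ)) }) (λ { (r , i) → cong (_, i) (⊕⊖ r (off i κ)) })

  order : Fin w → Fin (w * L) ↔ (Fin L × Fin w)
  order κ = ↔-trans *↔× (skew κ)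

  skew-rail : ∀ κ p q → Carry p q → Rail (rail κ) (to (skew κ) p) (to (skew κ) q)
  skew-rail κ (r , i) (.r , i') (inj₁ (refl , e)) with next-step (sym e)
  ... | refl = refl , lem
    where
    lem : (r ⊕ off i' κ) ⊕ off i κ ≡ ((r ⊕ off i κ) ⊕ off i' κ) ⊕ wrap (last? i)
    lem = begin
      (r ⊕ off i' κ) ⊕ off i κ             ≡⟨ ⊕-assoc r (off i' κ) (off i κ) ⟩
      r ⊕ (off i' κ ⊕ off i κ)             ≡⟨ cong (r ⊕_) (⊕-comm (off i' κ) (off i κ)) ⟩
      r ⊕ (off i κ ⊕ off i' κ)             ≡⟨ ⊕-assoc r (off i κ) (off i' κ) ⟨
      (r ⊕ off i κ) ⊕ off i' κ             ≡⟨ ⊕-identityʳ _ ⟨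
      ((r ⊕ off i κ) ⊕ off i' κ) ⊕ zero    ≡⟨ cong (((r ⊕ off i κ) ⊕ off i' κ) ⊕_) (wrap-no (last? i) (λ l → <-irrefl (trans e l) (toℕ<n i'))) ⟨
      ((r ⊕ off i κ) ⊕ off i' κ) ⊕ wrap (last? i)   ∎
      where open ≡-Reasoning
  skew-rail κ (r , i) (.(next r) , i') (inj₂ (refl , l , z)) with next-wrap l z
  ... | refl = refl , lem
    where
    lem : (next r ⊕ off i' κ) ⊕ off i κ ≡ ((r ⊕ off i κ) ⊕ off i' κ) ⊕ wrap (last? i)
    lem = begin
      (next r ⊕ off i' κ) ⊕ off i κ         ≡⟨ cong (λ t → (t ⊕ off i' κ) ⊕ off i κ) (next≡⊕1 r) ⟩
      ((r ⊕ [ 1 ]) ⊕ off i' κ) ⊕ off i κ    ≡⟨ ⊕-assoc (r ⊕ [ 1 ]) (off i' κ) (off i κ) ⟩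
      (r ⊕ [ 1 ]) ⊕ (off i' κ ⊕ off i κ)    ≡⟨ cong ((r ⊕ [ 1 ]) ⊕_) (⊕-comm (off i' κ) (off i κ)) ⟩
      (r ⊕ [ 1 ]) ⊕ (off i κ ⊕ off i' κ)    ≡⟨ ⊕-interchange r [ 1 ] (off i κ) (off i' κ) ⟩
      (r ⊕ off i κ) ⊕ ([ 1 ] ⊕ off i' κ)    ≡⟨ cong ((r ⊕ off i κ) ⊕_) (⊕-comm [ 1 ] (off i' κ)) ⟩
      (r ⊕ off i κ) ⊕ (off i' κ ⊕ [ 1 ])    ≡⟨ ⊕-assoc (r ⊕ off i κ) (off i' κ) [ 1 ] ⟨
      ((r ⊕ off i κ) ⊕ off i' κ) ⊕ [ 1 ]    ≡⟨ cong (((r ⊕ off i κ) ⊕ off i' κ) ⊕_) (wrap-yes (last? i) l) ⟨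
      ((r ⊕ off i κ) ⊕ off i' κ) ⊕ wrap (last? i)   ∎
      where open ≡-Reasoning

  -- Replacing every vertex of a cycle by 2w vertices is the doubling of `C_L[w]`, so each of the w
  -- Hamilton cycles of the latter gives two factors.
  wreathFam : ∀ b x → w * L ≡ b * x → 2 ≤ x → Fam (Fin L × (Fin w × Bool)) (2 * x) (Fin w × Bool) Ring
  wreathFam b x e x≥2 = mapFam (×-assoc 0ℓ _ _ _) (λ {u} {v} → ring {u} {v})
    (blowFam order (λ κ → SymClosure (Rail (rail κ))) (λ _ → SymClosure-sym)
      (λ κ a → fwd (skew-rail κ _ _ (next-remQuot L a))) (railDisj L≥3 rail rail-disj)
      (doubleFam (w * L) b x e x≥2 (≤-trans L≥3 (m≤m+n L ((k + k) * L)))))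
    where
    ring : ∀ {u v : (Fin L × Fin w) × Bool} → (∃ λ κ → SymClosure (Rail (rail κ)) (proj₁ u) (proj₁ v)) →
           Ring (to (×-assoc 0ℓ _ _ _) u) (to (×-assoc 0ℓ _ _ _) v)
    ring {(_ , _) , _} {(_ , _) , _} (_ , fwd (p , _)) = inj₁ p
    ring {(_ , _) , _} {(_ , _) , _} (_ , bwd (p , _)) = inj₂ p

-- Any x ≥ 3 odd is a sum of x steps ±1 in ℤ/3 returning to 0: three times +1, then alternately +1 and -1.
walk : ℕ → Fin 3
walk zero = zero
walk (suc zero) = suc zero
walk (suc (suc zero)) = suc (suc zero)
walk (suc (suc (suc n))) with par n
... | false = zero
... | true = suc zero

walk-moves : ∀ n → walk n ≢ walk (suc n)
walk-moves zero ()
walk-moves (suc zero) ()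
walk-moves (suc (suc zero)) ()
walk-moves (suc (suc (suc n))) e with par n | e
... | false | ()
... | true | ()

walk-closes : ∀ x → 3 ≤ x → par x ≡ true → walk x ≡ zero
walk-closes (suc (suc (suc n))) h odd with par n | odd
... | false | _ = refl
... | true | ()
walk-closes (suc (suc zero)) (s≤s (s≤s ())) odd
walk-closes (suc zero) (s≤s ()) odd

MatchRow : {K R : Set} → (K × Bool) ↔ R → R → R → Set
MatchRow f p q = ∃ λ k → ∃ λ b → p ≡ to f (k , b) × q ≡ to f (k , not b)

-- Rows are grouped in hexagons e₀ l₁ e₂ l₀ e₁ l₂ with antipodes e_s, l_s.
HexRow : {C R : Set} → (C × (Fin 3 × Bool)) ↔ R → R → R → Set
HexRow f p q = ∃ λ c → ∃ λ s → ∃ λ s' → ∃ λ b → s ≢ s' × p ≡ to f (c , s , b) × q ≡ to f (c , s' , not b)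

antipodal : {C R : Set} → (C × (Fin 3 × Bool)) ↔ R → ((C × Fin 3) × Bool) ↔ R
antipodal f = ↔-trans (×-assoc 0ℓ _ _ _) f

-- The hexagons in all columns and the rails between antipodal rows form two C_2x-factors.
module Prism {C R : Set} {c x : ℕ} (x≥3 : 3 ≤ x) (odd : par x ≡ true) (fC : C ↔ Fin c) (hx : (C × (Fin 3 × Bool)) ↔ R) where

  level : Fin x → Bool → Fin 3
  level a false = walk (toℕ a)
  level a true = walk (suc (toℕ a))

  pts : Bool → ((C × Fin 3) × (Fin x × Fin 2)) ↔ (Fin x × R)
  pts b = mk↔ₛ′ f g fg gf
    where
    f : (C × Fin 3) × (Fin x × Fin 2) → Fin x × R
    f ((c , s) , a , d) = a , to hx (c , s ⊕ level a (bool d) , bool d xor b)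
    g₁ : Fin x → C × (Fin 3 × Bool) → (C × Fin 3) × (Fin x × Fin 2)
    g₁ a (c , s , e) = (c , s ⊕ ⊖ level a (e xor b)) , a , unbool (e xor b)
    g : Fin x × R → (C × Fin 3) × (Fin x × Fin 2)
    g (a , p) = g₁ a (from hx p)
    fg₁ : ∀ a t → f (g₁ a t) ≡ (a , to hx t)
    fg₁ a (c , s , e) rewrite to-from 2↔Bool (e xor b) = cong (λ z → a , to hx (c , z)) (cong₂ _,_ (⊖⊕ s (level a (e xor b))) (xor-cancelʳ b e))
    fg : ∀ v → f (g v) ≡ v
    fg (a , p) = trans (fg₁ a (from hx p)) (cong (a ,_) (to-from hx p))
    gf : ∀ v → g (f v) ≡ v
    gf ((c , s) , a , d) = trans (cong (g₁ a) (from-to hx _)) (trans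
      (cong (λ e → (c , (s ⊕ level a (bool d)) ⊕ ⊖ level a e) , a , unbool e) (xor-cancelʳ b (bool d)))
      (cong₂ (λ y z → (c , y) , a , z) (⊕⊖ s (level a (bool d))) (from-to 2↔Bool d)))

  fK : (C × Fin 3) ↔ Fin (c * 3)
  fK = ↔-trans (fC ×-↔ ↔-refl) (↔-sym *↔×)

  prismFactor : Bool → Factor (Fin x × R) (x * 2)
  prismFactor b = mkFactor fK (pts b)

  -- Factor `b` enters each column on side `b`, crosses it along a hexagon edge and comes back to
  -- side `b` of the next column on an antipodal rail. The two factors therefore use complementary
  -- rails.
  Dir : Bool → Fin x × R → Fin x × R → Set
  Dir b (a , p) (a' , q) =
    (a' ≡ a × ∃ λ c → ∃ λ s → p ≡ to hx (c , s ⊕ walk (toℕ a) , b) × q ≡ to hx (c , s ⊕ walk (suc (toℕ a)) , not b))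
    ⊎ (a' ≡ next a × ∃ λ c → ∃ λ s → p ≡ to hx (c , s , not b) × q ≡ to hx (c , s , b))

  walk-next : ∀ (a : Fin x) → walk (toℕ (next a)) ≡ walk (suc (toℕ a))
  walk-next a with nextView a
  ... | inj₁ e = cong walk e
  ... | inj₂ (e , z) = trans (cong walk z) (sym (trans (cong walk e) (walk-closes x x≥3 odd)))

  prism-step : ∀ b {u w} → Step (prismFactor b) u w → SymClosure (Dir b) u w
  prism-step b s with mkFactor-step fK (pts b) s
  ... | (c , s) , (a , zero) , (.a , suc zero) , inj₁ (refl , _) , refl , refl = fwd (inj₁ (refl , c , s , refl , refl))
  ... | (c , s) , (a , zero) , (.a , zero) , inj₁ (refl , ()) , refl , refl
  ... | (c , s) , (a , suc zero) , (.a , zero) , inj₁ (refl , ()) , refl , refl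
  ... | (c , s) , (a , suc zero) , (.a , suc zero) , inj₁ (refl , ()) , refl , refl
  ... | (c , s) , (a , zero) , (.(next a) , _) , inj₂ (refl , () , _) , refl , refl
  ... | (c , s) , (a , suc zero) , (.(next a) , zero) , inj₂ (refl , _ , _) , refl , refl =
    fwd (inj₂ (refl , c , s ⊕ walk (suc (toℕ a)) , refl , cong (λ z → to hx (c , s ⊕ z , b)) (walk-next a)))
  ... | (c , s) , (a , suc zero) , (.(next a) , suc zero) , inj₂ (refl , _ , ()) , refl , refl

  side : R → Bool
  side p = proj₂ (proj₂ (from hx p))

  pos : R → Fin 3
  pos p = proj₁ (proj₂ (from hx p))

  side-to : ∀ {p t} → p ≡ to hx t → side p ≡ proj₂ (proj₂ t)
  side-to {t = t} refl = cong (λ z → proj₂ (proj₂ z)) (from-to hx t)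

  pos-to : ∀ {p t} → p ≡ to hx t → pos p ≡ proj₁ (proj₂ t)
  pos-to {t = t} refl = cong (λ z → proj₁ (proj₂ z)) (from-to hx t)

  -- The hypotheses describe a hexagon edge traversed from both ends. Combining them gives 2
  -- `walk n` = 2 `walk (suc n)` in ℤ/3, so the walk would stand still.
  no-turn : ∀ n {s t} → s ⊕ walk n ≡ t ⊕ walk (suc n) → s ⊕ walk (suc n) ≡ t ⊕ walk n → ⊥
  no-turn n {s} {t} p q = walk-moves n (to-injective (double↔ 1) (⊕-cancelˡ (s ⊕ t) (begin
    (s ⊕ t) ⊕ (A ⊕ A)   ≡⟨ ⊕-interchange s t A A ⟩
    (s ⊕ A) ⊕ (t ⊕ A)   ≡⟨ cong₂ _⊕_ p (sym q) ⟩
    (t ⊕ B) ⊕ (s ⊕ B)   ≡⟨ ⊕-comm (t ⊕ B) (s ⊕ B) ⟩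
    (s ⊕ B) ⊕ (t ⊕ B)   ≡⟨ ⊕-interchange s t B B ⟨
    (s ⊕ t) ⊕ (B ⊕ B)   ∎)))
    where open ≡-Reasoning
          A = walk n
          B = walk (suc n)

  dir-disj₁ : ∀ b b' {u w} → Dir b u w → Dir b' u w → b ≡ b'
  dir-disj₁ b b' {a , p} {_ , q} (inj₁ (_ , _ , _ , e , _)) (inj₁ (_ , _ , _ , e' , _)) = trans (sym (side-to e)) (side-to e')
  dir-disj₁ b b' {a , p} {_ , q} (inj₂ (_ , _ , _ , _ , e)) (inj₂ (_ , _ , _ , _ , e')) = trans (sym (side-to e)) (side-to e')
  dir-disj₁ b b' {a , p} {_ , q} (inj₁ (e , _)) (inj₂ (e' , _)) = ⊥-elim (next≢ (≤-trans (n≤1+n 2) x≥3) a (trans (sym e') e))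
  dir-disj₁ b b' {a , p} {_ , q} (inj₂ (e , _)) (inj₁ (e' , _)) = ⊥-elim (next≢ (≤-trans (n≤1+n 2) x≥3) a (trans (sym e) e'))

  dir-disj₂ : ∀ b b' {u w} → Dir b u w → Dir b' w u → ⊥
  dir-disj₂ b b' {a , p} {.a , q} (inj₁ (refl , _ , _ , e , f)) (inj₁ (_ , _ , _ , e' , f')) =
    no-turn (toℕ a) (trans (sym (pos-to e)) (pos-to f')) (trans (sym (pos-to f)) (pos-to e'))
  dir-disj₂ b b' {a , p} {_ , q} (inj₂ (e , _)) (inj₂ (e' , _)) = next²≢ x≥3 a (sym (trans e' (cong next e)))
  dir-disj₂ b b' {a , p} {.a , q} (inj₁ (refl , _)) (inj₂ (e' , _)) = next≢ (≤-trans (n≤1+n 2) x≥3) a (sym e')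
  dir-disj₂ b b' {a , p} {_ , q} (inj₂ (e , _)) (inj₁ (refl , _)) = next≢ (≤-trans (n≤1+n 2) x≥3) _ (sym e)

  prism-disj : ∀ b b' {u w} → SymClosure (Dir b) u w → SymClosure (Dir b') u w → b ≡ b'
  prism-disj b b' (fwd d) (fwd d') = dir-disj₁ b b' d d'
  prism-disj b b' (bwd d) (bwd d') = dir-disj₁ b b' d d'
  prism-disj b b' (fwd d) (bwd d') = ⊥-elim (dir-disj₂ b b' d d')
  prism-disj b b' (bwd d) (fwd d') = ⊥-elim (dir-disj₂ b b' d d')

  Within : Fin x × R → Fin x × R → Set
  Within (a , p) (a' , q) = (a ≡ a' × HexRow hx p q) ⊎ (Ring (a , p) (a' , q) × MatchRow (antipodal hx) p q)

  prism-within : ∀ b {u w} → SymClosure (Dir b) u w → Within u w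
  prism-within b {a , p} {_ , q} (fwd (inj₁ (refl , c , s , e , f))) = inj₁ (refl , c , _ , _ , b , (λ z → walk-moves (toℕ a) (⊕-cancelˡ s z)) , e , f)
  prism-within b {a , p} {_ , q} (bwd (inj₁ (refl , c , s , e , f))) =
    inj₁ (refl , c , _ , _ , not b , (λ z → walk-moves (toℕ a) (⊕-cancelˡ s (sym z))) , f , trans e (cong (λ z → to hx (c , _ , z)) (sym (not-involutive b))))
  prism-within b {a , p} {_ , q} (fwd (inj₂ (n , c , s , e , f))) = inj₂ (inj₁ n , (c , s) , not b , e , trans f (cong (λ z → to hx (c , s , z)) (sym (not-involutive b))))
  prism-within b {a , p} {_ , q} (bwd (inj₂ (n , c , s , e , f))) = inj₂ (inj₂ n , (c , s) , b , f , e)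

  prismFam : Fam (Fin x × R) (x * 2) Bool Within
  prismFam = classFam prismFactor (λ b → SymClosure (Dir b)) (λ _ → SymClosure-sym) prism-step prism-disj prism-within

-- Cells for odd x

-- Walecki's Hamilton cycles: cycle i consists of the pairs with sum 2i or 2i + 1.
module Walecki (m h : ℕ) (2h≤M : h + h ≤ suc m) where

  open Zigzag m public

  Class : ℕ → Fin (suc M) → Fin (suc M) → Set
  Class n b c = b ≢ c × ⌊ toℕ (S b c) /2⌋ ≡ n

  Class-sym : ∀ n → Symmetric (Class n)
  Class-sym n b c (b≢c , e) = (λ z → b≢c (sym z)) , trans (cong (λ s → ⌊ toℕ s /2⌋) (S-comm c b)) e

  ham : Fin h → Fin (suc M) ↔ Fin (suc M)
  ham i = zigzag (shift [ toℕ i ])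

  -- Translation by i adds 2i to the alternating sums 0 and 1. As 2i + 1 < 2h ≤ M, nothing is
  -- reduced modulo M, and halving the representative gives i.
  ham-class : ∀ i a → Class (toℕ i) (to (ham i) a) (to (ham i) (next a))
  ham-class i a = (λ e → next≢ (s≤s (s≤s z≤n)) a (sym (to-injective (ham i) e))) ,
    trans (cong (λ s → ⌊ toℕ s /2⌋) (zigzag-sum (shift [ toℕ i ]) (_⊕ ([ toℕ i ] ⊕ [ toℕ i ])) (λ p q → ⊕-interchange p _ q _) a)) (lem (par (toℕ a)))
    where
    sum : ∀ n → n < 2 → ⌊ n + (toℕ i + toℕ i) /2⌋ ≡ toℕ i → ⌊ toℕ ([ n ] ⊕ ([ toℕ i ] ⊕ [ toℕ i ])) /2⌋ ≡ toℕ i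
    sum n n<2 e = trans (cong ⌊_/2⌋ (trans (cong toℕ (trans (cong ([ n ] ⊕_) ([]-⊕ (toℕ i) (toℕ i))) ([]-⊕ n (toℕ i + toℕ i))))
      (toℕ-[]< (<-≤-trans (bound n<2) 2h≤M)))) e
      where
      bound : n < 2 → n + (toℕ i + toℕ i) < h + h
      bound (s≤s n≤1) = ≤-trans (s≤s (+-monoˡ-≤ (toℕ i + toℕ i) n≤1)) (≤-trans (≤-reflexive (cong suc (sym (+-suc (toℕ i) (toℕ i))))) (+-mono-≤ (toℕ<n i) (toℕ<n i)))
    lem : ∀ b → ⌊ toℕ (bit b ⊕ ([ toℕ i ] ⊕ [ toℕ i ])) /2⌋ ≡ toℕ i
    lem false = trans (cong (λ z → ⌊ toℕ (z ⊕ ([ toℕ i ] ⊕ [ toℕ i ])) /2⌋) (sym ([]-toℕ zero))) (sum 0 (s≤s z≤n) (sym (n≡⌊n+n/2⌋ (toℕ i))))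
    lem true = sum 1 (s≤s (s≤s z≤n)) (sym (n≡⌈n+n/2⌉ (toℕ i)))

-- Inside a column the degree is R - 1 = 1 + 2 + 2q, from the mates, `hex₀` and the q other hexagon
-- factors: q = 1 for R = 6 and q = 4 for R = 12. Between columns a 1-factorization of `K_R` is used
-- that contains the q antipodal matchings, so R - 1 = 1 + s + q and s = 3 or 6. Straight rails are
-- counted with `base`.
record RowData (R r s q c : ℕ) : Set where
  field
    hexes       : Fin q → (Fin c × (Fin 3 × Bool)) ↔ Fin R
    base        : (Fin r × Bool) ↔ Fin R
    match       : Fin s → (Fin r × Bool) ↔ Fin R
    hex₀        : Factor (Fin R) 6
    rmate       : Fin R → Fin R
    rmate-noFix : ∀ p → rmate p ≢ p
    rmate-inv   : ∀ p → rmate (rmate p) ≡ p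
    -- colours of the pairs of rows inside a column, and of the rails between consecutive columns
    rung rail   : Fin R → Fin R → ℕ
    rung-sym    : ∀ p q → rung p q ≡ rung q p
    rail-sym    : ∀ p q → rail p q ≡ rail q p
    rung-mate   : ∀ p → rung p (rmate p) ≡ 0
    rung-hex₀   : ∀ {p q} → Step hex₀ p q → rung p q ≡ 1
    rung-hexes  : ∀ i {p q} → HexRow (hexes i) p q → rung p q ≡ 2 + toℕ i
    rail-base   : ∀ k b b' → rail (to base (k , b)) (to base (k , b')) ≡ 0
    rail-match  : ∀ j {p q} → MatchRow (match j) p q → rail p q ≡ 1 + toℕ j
    rail-hexes  : ∀ i {p q} → MatchRow (antipodal (hexes i)) p q → rail p q ≡ 1 + (s + toℕ i)

module CellOdd {R r s q c : ℕ} (D : RowData R r s q c) (h : ℕ) where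

  open RowData D

  x : ℕ
  x = 3 + (h + h)

  odd : par x ≡ true
  odd = cong (λ b → not (not (not b))) (par-double h)

  x≥3 : 3 ≤ x
  x≥3 = s≤s (s≤s (s≤s z≤n))

  V : Set
  V = Fin x × Fin R

  RailIs : ℕ → V → V → Set
  RailIs n u@(_ , p) w@(_ , q) = Ring u w × rail p q ≡ n

  baseFam : Fam V (2 * x) Bool (RailIs 0)
  baseFam = mapFam (spread base) (λ { {k , _ , b} {.k , _ , b'} (refl , e) → e , rail-base k b b' })
    (copyFam ↔-refl (doubleFam x 1 x (sym (+-identityʳ x)) (s≤s (s≤s z≤n)) x≥3))

  crossFam : ∀ {J : Set} {K : J → Set} {k : ℕ} (code : J → ℕ) → (∀ i j → code i ≡ code j → i ≡ j) →
    (∀ j → K j ↔ Fin k) → (f : ∀ j → (K j × Bool) ↔ Fin R) →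
    (∀ j {p q} → MatchRow (f j) p q → rail p q ≡ code j) → Fam V (2 * x) J (λ u w → ∃ λ j → RailIs (code j) u w)
  crossFam code inj fK f ok = railFamIn x≥3 (λ j → Cross.crossFactor odd (fK j) (f j)) (λ j → Cross.crossRail odd (fK j) (f j))
    (λ j → Cross.cross-step odd (fK j) (f j)) (λ i j e e' → inj i j (trans (sym (ok i e)) (ok j e')))
    λ { j {_ , _} {_ , _} (fwd (e , m)) → j , inj₁ e , ok j m
      ; j {_ , p} {_ , q} (bwd (e , m)) → j , inj₂ e , trans (rail-sym p q) (ok j m) }

  matchFam : Fam V (2 * x) (Fin s) (λ u w → ∃ λ (j : Fin s) → RailIs (1 + toℕ j) u w)
  matchFam = crossFam (λ j → 1 + toℕ j) (λ i j e → toℕ-injective (suc-injective e)) (λ _ → ↔-refl) match rail-match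

  hexFam : Fam V (2 * x) (Fin q) (λ u w → ∃ λ (i : Fin q) → RailIs (1 + (s + toℕ i)) u w)
  hexFam = crossFam (λ j → 1 + (s + toℕ j)) (λ i j e → toℕ-injective (+-cancelˡ-≡ s _ _ (suc-injective e)))
    (λ _ → ↔-sym *↔×) (λ i → antipodal (hexes i)) rail-hexes

  apart : ∀ {m n u w} → m ≢ n → RailIs m u w → RailIs n u w → ⊥
  apart ne (_ , e) (_ , e') = ne (trans (sym e) e')

  match≢hex : ∀ (j : Fin s) (i : ℕ) → 1 + toℕ j ≢ 1 + (s + i)
  match≢hex j i e = 1+n≰n (≤-trans (toℕ<n j) (≤-trans (m≤m+n s i) (≤-reflexive (sym (suc-injective e)))))

  -- For both tables 2 + s + q = R, so by degree all rails are used: two factors take the straight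
  -- and `base` rails, and every other matching of the rows gives one.
  ordinary : Fam V (2 * x) (Bool ⊎ (Fin s ⊎ Fin q)) Ring
  ordinary = weakenFam (λ { (inj₁ (e , _)) → e ; (inj₂ (inj₁ (_ , e , _))) → e ; (inj₂ (inj₂ (_ , e , _))) → e })
    (unionFam (λ { e (inj₁ (_ , e')) → apart (λ ()) e e' ; e (inj₂ (_ , e')) → apart (λ ()) e e' }) baseFam
      (unionFam (λ { (j , e) (i , e') → apart (match≢hex j (toℕ i)) e e' }) matchFam hexFam))

  PrismIs : Fin q → V → V → Set
  PrismIs i u@(a , p) w@(b , q) = (a ≡ b × rung p q ≡ 2 + toℕ i) ⊎ RailIs (1 + (s + toℕ i)) u w

  ring-loop : ∀ {a : Fin x} → ¬ (a ≡ next a ⊎ a ≡ next a)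
  ring-loop {a} (inj₁ e) = next≢ (s≤s (s≤s z≤n)) a (sym e)
  ring-loop {a} (inj₂ e) = next≢ (s≤s (s≤s z≤n)) a (sym e)

  prismDisj : ∀ i j {u w} → PrismIs i u w → PrismIs j u w → i ≡ j
  prismDisj i j (inj₁ (_ , e)) (inj₁ (_ , e')) = toℕ-injective (+-cancelˡ-≡ 2 _ _ (trans (sym e) e'))
  prismDisj i j {_ , _} {_ , _} (inj₂ (_ , e)) (inj₂ (_ , e')) = toℕ-injective (+-cancelˡ-≡ s _ _ (suc-injective (trans (sym e) e')))
  prismDisj i j {a , _} (inj₁ (refl , _)) (inj₂ (e , _)) = ⊥-elim (ring-loop e)
  prismDisj i j {a , _} (inj₂ (e , _)) (inj₁ (refl , _)) = ⊥-elim (ring-loop e)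

  prisms : Fam V (2 * x) (Fin q × Bool) (λ u w → ∃ λ i → PrismIs i u w)
  prisms = subst (λ N → Fam V N (Fin q × Bool) (λ u w → ∃ λ i → PrismIs i u w)) (*-comm x 2)
    (sumFam prismDisj λ i → weakenFam (λ { {_ , _} {_ , _} (inj₁ (e , m)) → inj₁ (e , rung-hexes i m)
                                         ; {_ , _} {_ , _} (inj₂ (e , m)) → inj₂ (e , rail-hexes i m) })
      (Prism.prismFam x≥3 odd ↔-refl (hexes i)))

  -- Here M = 2h + 2, so there are M + 1 = x columns, and h + 1 Hamilton cycles exhaust the pairs of
  -- columns. Cycle 0 becomes the special one.
  open Walecki (suc (h + h)) (suc h) (≤-reflexive (cong suc (+-suc h h)))

  Special : V → V → Set
  Special (a , p) (b , q) = (a ≡ b × 2 ≤ rung p q) ⊎ Class 0 a b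

  -- Over this one cycle the antipodal rails form no cross factors: with the hexagons of the
  -- columns, each hexagon factor yields two prism factors instead.
  special : Fam V (2 * x) (Bool ⊎ (Fin s ⊎ (Fin q × Bool))) Special
  special = mapFam (ham zero ×-↔ ↔-refl) within'
    (unionFam (λ { e (inj₁ (_ , e')) → apart (λ ()) e e'
                 ; {_ , _} {_ , _} e (inj₂ (_ , inj₂ e')) → apart (λ ()) e e'
                 ; {_ , _} {_ , _} (e , _) (inj₂ (_ , inj₁ (refl , _))) → ring-loop e }) baseFam
      (unionFam (λ { {_ , _} {_ , _} (j , e) (i , inj₂ e') → apart (match≢hex j (toℕ i)) e e'
                   ; {_ , _} {_ , _} (_ , e , _) (_ , inj₁ (refl , _)) → ring-loop e }) matchFam prisms))
    where
    ring : ∀ {u w : V} → Ring u w → Special (to (ham zero ×-↔ ↔-refl) u) (to (ham zero ×-↔ ↔-refl) w)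
    ring {a , _} {b , _} (inj₁ refl) = inj₂ (ham-class zero a)
    ring {a , _} {b , _} (inj₂ refl) = inj₂ (Class-sym 0 (to (ham zero) b) (to (ham zero) (next b)) (ham-class zero b))
    within' : ∀ {u w : V} → RailIs 0 u w ⊎ ((∃ λ (j : Fin s) → RailIs (1 + toℕ j) u w) ⊎ (∃ λ i → PrismIs i u w)) →
      Special (to (ham zero ×-↔ ↔-refl) u) (to (ham zero ×-↔ ↔-refl) w)
    within' {u} {w} (inj₁ (e , _)) = ring {u} {w} e
    within' {u} {w} (inj₂ (inj₁ (_ , e , _))) = ring {u} {w} e
    within' {u@(_ , _)} {w@(_ , _)} (inj₂ (inj₂ (_ , inj₂ (e , _)))) = ring {u} {w} e
    within' {_ , _} {_ , _} (inj₂ (inj₂ (i , inj₁ (refl , e)))) = inj₁ (refl , subst (2 ≤_) (sym e) (m≤m+n 2 (toℕ i)))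

  others : Fam V (2 * x) (Fin h × (Bool ⊎ (Fin s ⊎ Fin q))) (λ u w → ∃ λ (i : Fin h) → On (Class (1 + toℕ i)) u w)
  others = blowFam (λ i → ham (suc i)) (λ i → Class (1 + toℕ i)) (λ i → Class-sym (1 + toℕ i)) (λ i → ham-class (suc i))
    (λ i j (_ , e) (_ , e') → toℕ-injective (suc-injective (trans (sym e) e'))) ordinary

  Hex : V → V → Set
  Hex (a , p) (b , q) = a ≡ b × rung p q ≡ 1

  size : ℕ
  size = (2 + (s + q * 2)) + h * (2 + (s + q))

  cell : Design V (2 * x) size
  cell = mkDesign {Eh = Hex} {E = λ u w → Special u w ⊎ (∃ λ (i : Fin h) → On (Class (1 + toℕ i)) u w)}
    (λ { (a , p) → a , rmate p }) (λ { (a , p) e → rmate-noFix p (,-injectiveʳ e) }) (λ { (a , p) → cong (a ,_) (rmate-inv p) })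
    (copyFactor ↔-refl hex₀) hexWithin
    (unionFam (λ { {_ , _} {_ , _} (inj₁ (refl , _)) (_ , ne , _) → ne refl
                 ; {_ , _} {_ , _} (inj₂ (_ , e)) (_ , _ , e') → case trans (sym e) e' of λ () }) special others)
    (↔-sym (↔-trans +↔⊎ ((↔-trans +↔⊎ (2↔Bool ⊎-↔ (↔-trans +↔⊎ (↔-refl ⊎-↔ (↔-trans *↔× (↔-refl ×-↔ 2↔Bool))))))
      ⊎-↔ (↔-trans *↔× (↔-refl ×-↔ (↔-trans +↔⊎ (2↔Bool ⊎-↔ +↔⊎)))))))
    (λ { (a , p) (_ , e) → case trans (sym e) (rung-mate p) of λ () })
    (λ { (a , p) (inj₁ (inj₁ (_ , e))) → case subst (2 ≤_) (rung-mate p) e of λ ()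
       ; (a , p) (inj₁ (inj₂ (ne , _))) → ne refl
       ; (a , p) (inj₂ (_ , ne , _)) → ne refl })
    (λ { {_ , _} {_ , _} (refl , e) (inj₁ (inj₁ (_ , e'))) → case subst (2 ≤_) e e' of λ { (s≤s ()) }
       ; {_ , _} {_ , _} (refl , e) (inj₁ (inj₂ (ne , _))) → ne refl
       ; {_ , _} {_ , _} (refl , e) (inj₂ (_ , ne , _)) → ne refl })
    where
    hexWithin : ∀ {u w} → Edge (copyFactor ↔-refl hex₀) u w → Hex u w
    hexWithin {a , p} {b , q} e with copyFactor-edge ↔-refl hex₀ e
    ... | refl , fwd st = refl , rung-hex₀ st
    ... | refl , bwd st = refl , trans (rung-sym p q) (rung-hex₀ st)

-- Row tables for six and twelve rows, verified by decision procedures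

allBool? : {P : Bool → Set} → (∀ b → Dec (P b)) → Dec (∀ b → P b)
allBool? d with d false | d true
... | yes p | yes q = yes λ { false → p ; true → q }
... | no ¬p | _ = no λ f → ¬p (f false)
... | _ | no ¬q = no λ f → ¬q (f true)

pairAt : ∀ {k R} → Vec (Fin R × Fin R) k → Fin k × Bool → Fin R
pairAt T (i , false) = proj₁ (lookup T i)
pairAt T (i , true) = proj₂ (lookup T i)

findPair : ∀ {k R} → Vec (Fin R × Fin R) (suc k) → Fin R → Fin (suc k) × Bool
findPair ((a , b) ∷ T) v with a ≟F v | b ≟F v | T
... | yes _ | _ | _ = zero , false
... | no _ | yes _ | _ = zero , true
-- Default for an element missing from the table; reaching it makes the check `PairTable` fail.
... | no _ | no _ | [] = zero , false
... | no _ | no _ | T@(_ ∷ _) with findPair T v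
...   | i , b = suc i , b

PairTable : ∀ {k R} → Vec (Fin R × Fin R) (suc k) → Set
PairTable T = ∀ v → pairAt T (findPair T v) ≡ v

findIn : ∀ {k n R} → Vec (Vec (Fin R) (suc n)) (suc k) → Fin R → Fin (suc k) × Fin (suc n)
findIn (a ∷ T) v with any? (λ j → lookup a j ≟F v) | T
... | yes (j , _) | _ = zero , j
... | no _ | [] = zero , zero
... | no _ | T@(_ ∷ _) with findIn T v
...   | i , j = suc i , j

pairs : ∀ {k R} → R ≡ suc k * 2 → (T : Vec (Fin R × Fin R) (suc k)) → PairTable T → (Fin (suc k) × Bool) ↔ Fin R
pairs {k} e T ok = section↔ (subst (λ n → (Fin (suc k) × Bool) ↔ Fin n) (sym e)
  (↔-trans (↔-refl ×-↔ ↔-sym 2↔Bool) (↔-sym *↔×))) ↔-refl (pairAt T) (findPair T) ok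

cycleAt : ∀ {k n R} → Vec (Vec (Fin R) n) k → Fin k × Fin n → Fin R
cycleAt T (i , j) = lookup (lookup T i) j

CycleTable : ∀ {k n R} → Vec (Vec (Fin R) (suc n)) (suc k) → Set
CycleTable T = ∀ v → cycleAt T (findIn T v) ≡ v

cycles : ∀ {k n R} → R ≡ suc k * suc n → (T : Vec (Vec (Fin R) (suc n)) (suc k)) → CycleTable T → Factor (Fin R) (suc n)
cycles {k} {n} e T ok = record { count = suc k ; pt = section↔
  (subst (λ m → (Fin (suc k) × Fin (suc n)) ↔ Fin m) (sym e) (↔-sym *↔×)) ↔-refl (cycleAt T) (findIn T) ok }

module Tables (c s q : ℕ) {R : ℕ} (e₂ : R ≡ suc c * 3 * 2) (e₆ : R ≡ suc c * 6)
  (H : Vec (Vec (Fin R × Fin R) (suc c * 3)) q) (B : Vec (Fin R × Fin R) (suc c * 3))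
  (M : Vec (Vec (Fin R × Fin R) (suc c * 3)) s) (H₀ : Vec (Vec (Fin R) 6) (suc c)) (mt : Vec (Fin R) R)
  (rungs rails : Vec (Vec ℕ R) R) where

  at : Vec (Vec ℕ R) R → Fin R → Fin R → ℕ
  at T p q = lookup (lookup T p) q

  hexAt : Fin q → Fin (suc c) → Fin 3 → Bool → Fin R
  hexAt i k j b = pairAt (lookup H i) (combine k j , b)

  Isos : Set
  Isos = (∀ i → PairTable (lookup H i)) × PairTable B × (∀ j → PairTable (lookup M j)) × CycleTable H₀

  Mates : Set
  Mates = ∀ p → lookup mt p ≢ p × lookup mt (lookup mt p) ≡ p × at rungs p (lookup mt p) ≡ 0

  Rungs : Set
  Rungs = (∀ p q → at rungs p q ≡ at rungs q p)
    × (∀ i j → at rungs (cycleAt H₀ (i , j)) (cycleAt H₀ (i , next j)) ≡ 1)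
    × (∀ i k j j' b → j ≢ j' → at rungs (hexAt i k j b) (hexAt i k j' (not b)) ≡ 2 + toℕ i)

  Rails : Set
  Rails = (∀ p q → at rails p q ≡ at rails q p)
    × (∀ k b b' → at rails (pairAt B (k , b)) (pairAt B (k , b')) ≡ 0)
    × (∀ j k b → at rails (pairAt (lookup M j) (k , b)) (pairAt (lookup M j) (k , not b)) ≡ 1 + toℕ j)
    × (∀ i k j b → at rails (hexAt i k j b) (hexAt i k j (not b)) ≡ 1 + (s + toℕ i))

  isos? : Dec Isos
  isos? = (all? λ i → all? λ v → _ ≟F _) ×-dec (all? λ v → _ ≟F _) ×-dec (all? λ j → all? λ v → _ ≟F _) ×-dec (all? λ v → _ ≟F _)

  mates? : Dec Mates
  mates? = all? λ p → (¬? (_ ≟F _)) ×-dec (_ ≟F _) ×-dec (_ ≟ℕ _)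

  rungs? : Dec Rungs
  rungs? = (all? λ p → all? λ q → _ ≟ℕ _) ×-dec (all? λ i → all? λ j → _ ≟ℕ _)
    ×-dec (all? λ i → all? λ k → all? λ j → all? λ j' → allBool? λ b → ¬? (j ≟F j') →-dec (_ ≟ℕ _))

  rails? : Dec Rails
  rails? = (all? λ p → all? λ q → _ ≟ℕ _) ×-dec (all? λ k → allBool? λ b → allBool? λ b' → _ ≟ℕ _)
    ×-dec (all? λ j → all? λ k → allBool? λ b → _ ≟ℕ _)
    ×-dec (all? λ i → all? λ k → all? λ j → allBool? λ b → _ ≟ℕ _)

  rowData : True isos? → True mates? → True rungs? → True rails? → RowData R (suc c * 3) s q (suc c)
  rowData ti tm tg tl = record
    { hexes = λ i → ↔-trans (↔-sym (×-assoc 0ℓ _ _ _)) (↔-trans (↔-sym *↔× ×-↔ ↔-refl) (pairs e₂ (lookup H i) (proj₁ is i)))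
    ; base = pairs e₂ B (proj₁ (proj₂ is))
    ; match = λ j → pairs e₂ (lookup M j) (proj₁ (proj₂ (proj₂ is)) j)
    ; hex₀ = cycles e₆ H₀ (proj₂ (proj₂ (proj₂ is)))
    ; rmate = lookup mt
    ; rmate-noFix = λ p → proj₁ (ms p)
    ; rmate-inv = λ p → proj₁ (proj₂ (ms p))
    ; rung = at rungs
    ; rail = at rails
    ; rung-sym = proj₁ gs
    ; rail-sym = proj₁ ls
    ; rung-mate = λ p → proj₂ (proj₂ (ms p))
    ; rung-hex₀ = λ { (step i j refl refl) → proj₁ (proj₂ gs) i j }
    ; rung-hexes = λ { i (k , j , j' , b , ne , refl , refl) → proj₂ (proj₂ gs) i k j j' b ne }
    ; rail-base = proj₁ (proj₂ ls)
    ; rail-match = λ { j (k , b , refl , refl) → proj₁ (proj₂ (proj₂ ls)) j k b }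
    ; rail-hexes = λ { i ((k , j) , b , refl , refl) → proj₂ (proj₂ (proj₂ ls)) i k j b } }
    where
    is : Isos
    is = toWitness ti
    ms : Mates
    ms = toWitness tm
    gs : Rungs
    gs = toWitness tg
    ls : Rails
    ls = toWitness tl

-- Removing the hexagon between {0, 2, 4} and {1, 3, 5} from `K_6` leaves a triangular prism, which
-- splits into the Hamilton cycle `hex₀` and the mates. In the rung table 9 marks the diagonal,
-- which carries no edge; in the rail table the diagonal 0 assigns straight rails to `base`.
rows6 : RowData 6 3 3 1 1
rows6 = Tables.rowData 0 3 1 refl refl
  (((# 0 , # 1) ∷ (# 2 , # 3) ∷ (# 4 , # 5) ∷ [])
   ∷ [])
  ((# 0 , # 2) ∷ (# 1 , # 4) ∷ (# 3 , # 5) ∷ [])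
  (((# 0 , # 3) ∷ (# 1 , # 5) ∷ (# 2 , # 4) ∷ [])
   ∷ ((# 0 , # 4) ∷ (# 1 , # 3) ∷ (# 2 , # 5) ∷ [])
   ∷ ((# 0 , # 5) ∷ (# 1 , # 2) ∷ (# 3 , # 4) ∷ [])
   ∷ [])
  ((# 0 ∷ # 2 ∷ # 4 ∷ # 5 ∷ # 3 ∷ # 1 ∷ [])
   ∷ [])
  (# 4 ∷ # 5 ∷ # 3 ∷ # 2 ∷ # 0 ∷ # 1 ∷ [])
  ((9 ∷ 1 ∷ 1 ∷ 2 ∷ 0 ∷ 2 ∷ [])
   ∷ (1 ∷ 9 ∷ 2 ∷ 1 ∷ 2 ∷ 0 ∷ [])
   ∷ (1 ∷ 2 ∷ 9 ∷ 0 ∷ 1 ∷ 2 ∷ [])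
   ∷ (2 ∷ 1 ∷ 0 ∷ 9 ∷ 2 ∷ 1 ∷ [])
   ∷ (0 ∷ 2 ∷ 1 ∷ 2 ∷ 9 ∷ 1 ∷ [])
   ∷ (2 ∷ 0 ∷ 2 ∷ 1 ∷ 1 ∷ 9 ∷ [])
   ∷ [])
  ((0 ∷ 4 ∷ 0 ∷ 1 ∷ 2 ∷ 3 ∷ [])
   ∷ (4 ∷ 0 ∷ 3 ∷ 2 ∷ 0 ∷ 1 ∷ [])
   ∷ (0 ∷ 3 ∷ 0 ∷ 4 ∷ 1 ∷ 2 ∷ [])
   ∷ (1 ∷ 2 ∷ 4 ∷ 0 ∷ 3 ∷ 0 ∷ [])
   ∷ (2 ∷ 0 ∷ 1 ∷ 3 ∷ 0 ∷ 4 ∷ [])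
   ∷ (3 ∷ 1 ∷ 2 ∷ 0 ∷ 4 ∷ 0 ∷ [])
   ∷ [])
  tt tt tt tt

-- The five hexagon factors are the translates of one under ℤ/5, acting on the rows as two 5-cycles 0 … 4 and
-- 5 … 9 and fixing 10 and 11.
rows12 : RowData 12 6 6 4 2
rows12 = Tables.rowData 1 6 4 refl refl
  (((# 0 , # 7) ∷ (# 5 , # 11) ∷ (# 8 , # 10) ∷ (# 2 , # 1) ∷ (# 6 , # 3) ∷ (# 9 , # 4) ∷ [])
   ∷ ((# 1 , # 8) ∷ (# 6 , # 11) ∷ (# 9 , # 10) ∷ (# 3 , # 2) ∷ (# 7 , # 4) ∷ (# 5 , # 0) ∷ [])
   ∷ ((# 2 , # 9) ∷ (# 7 , # 11) ∷ (# 5 , # 10) ∷ (# 4 , # 3) ∷ (# 8 , # 0) ∷ (# 6 , # 1) ∷ [])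
   ∷ ((# 3 , # 5) ∷ (# 8 , # 11) ∷ (# 6 , # 10) ∷ (# 0 , # 4) ∷ (# 9 , # 1) ∷ (# 7 , # 2) ∷ [])
   ∷ [])
  ((# 0 , # 10) ∷ (# 1 , # 4) ∷ (# 2 , # 6) ∷ (# 3 , # 7) ∷ (# 5 , # 8) ∷ (# 9 , # 11) ∷ [])
  (((# 0 , # 3) ∷ (# 1 , # 5) ∷ (# 2 , # 10) ∷ (# 4 , # 11) ∷ (# 6 , # 7) ∷ (# 8 , # 9) ∷ [])
   ∷ ((# 0 , # 2) ∷ (# 1 , # 3) ∷ (# 4 , # 8) ∷ (# 5 , # 7) ∷ (# 6 , # 9) ∷ (# 10 , # 11) ∷ [])
   ∷ ((# 0 , # 9) ∷ (# 1 , # 7) ∷ (# 2 , # 5) ∷ (# 3 , # 11) ∷ (# 4 , # 10) ∷ (# 6 , # 8) ∷ [])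
   ∷ ((# 0 , # 1) ∷ (# 2 , # 11) ∷ (# 3 , # 10) ∷ (# 4 , # 6) ∷ (# 5 , # 9) ∷ (# 7 , # 8) ∷ [])
   ∷ ((# 0 , # 6) ∷ (# 1 , # 11) ∷ (# 2 , # 8) ∷ (# 3 , # 9) ∷ (# 4 , # 5) ∷ (# 7 , # 10) ∷ [])
   ∷ ((# 0 , # 11) ∷ (# 1 , # 10) ∷ (# 2 , # 4) ∷ (# 3 , # 8) ∷ (# 5 , # 6) ∷ (# 7 , # 9) ∷ [])
   ∷ [])
  ((# 4 ∷ # 10 ∷ # 9 ∷ # 6 ∷ # 7 ∷ # 11 ∷ [])
   ∷ (# 1 ∷ # 3 ∷ # 5 ∷ # 0 ∷ # 8 ∷ # 2 ∷ [])
   ∷ [])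
  (# 9 ∷ # 5 ∷ # 6 ∷ # 7 ∷ # 8 ∷ # 1 ∷ # 2 ∷ # 3 ∷ # 4 ∷ # 0 ∷ # 11 ∷ # 10 ∷ [])
  ((9 ∷ 5 ∷ 5 ∷ 3 ∷ 4 ∷ 1 ∷ 4 ∷ 3 ∷ 1 ∷ 0 ∷ 2 ∷ 2 ∷ [])
   ∷ (5 ∷ 9 ∷ 1 ∷ 1 ∷ 4 ∷ 0 ∷ 2 ∷ 5 ∷ 4 ∷ 2 ∷ 3 ∷ 3 ∷ [])
   ∷ (5 ∷ 1 ∷ 9 ∷ 2 ∷ 2 ∷ 3 ∷ 0 ∷ 3 ∷ 1 ∷ 5 ∷ 4 ∷ 4 ∷ [])
   ∷ (3 ∷ 1 ∷ 2 ∷ 9 ∷ 3 ∷ 1 ∷ 4 ∷ 0 ∷ 4 ∷ 2 ∷ 5 ∷ 5 ∷ [])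
   ∷ (4 ∷ 4 ∷ 2 ∷ 3 ∷ 9 ∷ 3 ∷ 2 ∷ 5 ∷ 0 ∷ 5 ∷ 1 ∷ 1 ∷ [])
   ∷ (1 ∷ 0 ∷ 3 ∷ 1 ∷ 3 ∷ 9 ∷ 5 ∷ 2 ∷ 5 ∷ 4 ∷ 2 ∷ 4 ∷ [])
   ∷ (4 ∷ 2 ∷ 0 ∷ 4 ∷ 2 ∷ 5 ∷ 9 ∷ 1 ∷ 3 ∷ 1 ∷ 3 ∷ 5 ∷ [])
   ∷ (3 ∷ 5 ∷ 3 ∷ 0 ∷ 5 ∷ 2 ∷ 1 ∷ 9 ∷ 2 ∷ 4 ∷ 4 ∷ 1 ∷ [])
   ∷ (1 ∷ 4 ∷ 1 ∷ 4 ∷ 0 ∷ 5 ∷ 3 ∷ 2 ∷ 9 ∷ 3 ∷ 5 ∷ 2 ∷ [])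
   ∷ (0 ∷ 2 ∷ 5 ∷ 2 ∷ 5 ∷ 4 ∷ 1 ∷ 4 ∷ 3 ∷ 9 ∷ 1 ∷ 3 ∷ [])
   ∷ (2 ∷ 3 ∷ 4 ∷ 5 ∷ 1 ∷ 2 ∷ 3 ∷ 4 ∷ 5 ∷ 1 ∷ 9 ∷ 0 ∷ [])
   ∷ (2 ∷ 3 ∷ 4 ∷ 5 ∷ 1 ∷ 4 ∷ 5 ∷ 1 ∷ 2 ∷ 3 ∷ 0 ∷ 9 ∷ [])
   ∷ [])
  ((0 ∷ 4 ∷ 2 ∷ 1 ∷ 10 ∷ 8 ∷ 5 ∷ 7 ∷ 9 ∷ 3 ∷ 0 ∷ 6 ∷ [])
   ∷ (4 ∷ 0 ∷ 7 ∷ 2 ∷ 0 ∷ 1 ∷ 9 ∷ 3 ∷ 8 ∷ 10 ∷ 6 ∷ 5 ∷ [])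
   ∷ (2 ∷ 7 ∷ 0 ∷ 8 ∷ 6 ∷ 3 ∷ 0 ∷ 10 ∷ 5 ∷ 9 ∷ 1 ∷ 4 ∷ [])
   ∷ (1 ∷ 2 ∷ 8 ∷ 0 ∷ 9 ∷ 10 ∷ 7 ∷ 0 ∷ 6 ∷ 5 ∷ 4 ∷ 3 ∷ [])
   ∷ (10 ∷ 0 ∷ 6 ∷ 9 ∷ 0 ∷ 5 ∷ 4 ∷ 8 ∷ 2 ∷ 7 ∷ 3 ∷ 1 ∷ [])
   ∷ (8 ∷ 1 ∷ 3 ∷ 10 ∷ 5 ∷ 0 ∷ 6 ∷ 2 ∷ 0 ∷ 4 ∷ 9 ∷ 7 ∷ [])
   ∷ (5 ∷ 9 ∷ 0 ∷ 7 ∷ 4 ∷ 6 ∷ 0 ∷ 1 ∷ 3 ∷ 2 ∷ 10 ∷ 8 ∷ [])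
   ∷ (7 ∷ 3 ∷ 10 ∷ 0 ∷ 8 ∷ 2 ∷ 1 ∷ 0 ∷ 4 ∷ 6 ∷ 5 ∷ 9 ∷ [])
   ∷ (9 ∷ 8 ∷ 5 ∷ 6 ∷ 2 ∷ 0 ∷ 3 ∷ 4 ∷ 0 ∷ 1 ∷ 7 ∷ 10 ∷ [])
   ∷ (3 ∷ 10 ∷ 9 ∷ 5 ∷ 7 ∷ 4 ∷ 2 ∷ 6 ∷ 1 ∷ 0 ∷ 8 ∷ 0 ∷ [])
   ∷ (0 ∷ 6 ∷ 1 ∷ 4 ∷ 3 ∷ 9 ∷ 10 ∷ 5 ∷ 7 ∷ 8 ∷ 0 ∷ 2 ∷ [])
   ∷ (6 ∷ 5 ∷ 4 ∷ 3 ∷ 1 ∷ 7 ∷ 8 ∷ 9 ∷ 10 ∷ 0 ∷ 2 ∷ 0 ∷ [])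
   ∷ [])
  tt tt tt tt

-- Cells for even x

MatchRow-sym : {K R : Set} (f : (K × Bool) ↔ R) → Symmetric (MatchRow f)
MatchRow-sym f p q (k , b , e , e') = k , not b , e' , trans e (cong (λ z → to f (k , z)) (sym (not-involutive b)))

OMatch : {K R : Set} → (K × Bool) ↔ R → R → R → Set
OMatch f p q = ∃ λ k → p ≡ to f (k , false) × q ≡ to f (k , true)

OMatch⇒ : {K R : Set} (f : (K × Bool) ↔ R) {p q : R} → OMatch f p q → MatchRow f p q
OMatch⇒ f (k , e , e') = k , false , e , e'

OMatch-asym : {K R : Set} (f : (K × Bool) ↔ R) {p q : R} → OMatch f p q → OMatch f q p → ⊥
OMatch-asym f (k , e , _) (k' , _ , e') = case ,-injectiveʳ (to-injective f (trans (sym e) e')) of λ ()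

-- Between two rows, the differences 2n and 2n + 1 form a cycle through all columns.
module Strips (y h : ℕ) (even : suc y ≡ h + h) {K R : Set} {r : ℕ} (fK : K ↔ Fin r) (rows : (K × Bool) ↔ R) where

  x : ℕ
  x = suc y

  V : Set
  V = Fin x × R

  odd : Fin h → Fin x
  odd n = [ suc (toℕ n + toℕ n) ]

  pts : Fin h → (K × (Fin x × Fin 2)) ↔ V
  pts n = mk↔ₛ′ f g fg gf
    where
    disp : Bool → Fin x
    disp false = zero
    disp true = odd n
    f : K × (Fin x × Fin 2) → V
    f (k , a , d) = a ⊕ disp (bool d) , to rows (k , bool d)
    g₁ : Fin x → K × Bool → K × (Fin x × Fin 2)
    g₁ a (k , b) = k , a ⊕ ⊖ disp b , unbool b
    g : V → K × (Fin x × Fin 2)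
    g (a , p) = g₁ a (from rows p)
    fg₁ : ∀ a t → f (g₁ a t) ≡ (a , to rows t)
    fg₁ a (k , b) rewrite to-from 2↔Bool b = cong (_, to rows (k , b)) (⊖⊕ a (disp b))
    fg : ∀ v → f (g v) ≡ v
    fg (a , p) = trans (fg₁ a (from rows p)) (cong (a ,_) (to-from rows p))
    gf : ∀ v → g (f v) ≡ v
    gf (k , a , d) = trans (cong (g₁ (a ⊕ disp (bool d))) (from-to rows (k , bool d)))
      (cong₂ (λ c z → k , c , z) (⊕⊖ a (disp (bool d))) (from-to 2↔Bool d))

  stripFactor : Fin h → Factor V (x * 2)
  stripFactor n = mkFactor fK (pts n)

  Dir : ℕ → V → V → Set
  Dir n (a , p) (b , q) = OMatch rows p q × ⌊ toℕ (b ⊕ ⊖ a) /2⌋ ≡ n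

  odd<x : ∀ (n : Fin h) → suc (toℕ n + toℕ n) < x
  odd<x n = ≤-trans (≤-reflexive (cong suc (sym (+-suc (toℕ n) (toℕ n))))) (≤-trans (+-mono-≤ (toℕ<n n) (toℕ<n n)) (≤-reflexive (sym even)))

  -- The step to the second row adds 2n + 1. The step back lands one column beyond the start, so
  -- seen from the first row its difference is 2n.
  strip-step : ∀ n {u w} → Step (stripFactor n) u w → SymClosure (Dir (toℕ n)) u w
  strip-step n s with mkFactor-step fK (pts n) s
  ... | k , (a , zero) , (.a , suc zero) , inj₁ (refl , _) , refl , refl = fwd ((k , refl , refl) , trans (cong (λ z → ⌊ toℕ z /2⌋) lem)
          (trans (cong ⌊_/2⌋ (toℕ-[]< (odd<x n))) (sym (n≡⌈n+n/2⌉ (toℕ n)))))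
    where
    lem : (a ⊕ odd n) ⊕ ⊖ (a ⊕ zero) ≡ odd n
    lem = trans (cong₂ (λ p q → p ⊕ ⊖ q) (⊕-comm a (odd n)) (⊕-identityʳ a)) (⊕⊖ (odd n) a)
  ... | k , (a , zero) , (.a , zero) , inj₁ (refl , ()) , refl , refl
  ... | k , (a , suc zero) , (.a , zero) , inj₁ (refl , ()) , refl , refl
  ... | k , (a , suc zero) , (.a , suc zero) , inj₁ (refl , ()) , refl , refl
  ... | k , (a , zero) , (.(next a) , _) , inj₂ (refl , () , _) , refl , refl
  ... | k , (a , suc zero) , (.(next a) , suc zero) , inj₂ (refl , _ , ()) , refl , refl
  ... | k , (a , suc zero) , (.(next a) , zero) , inj₂ (refl , _ , _) , refl , refl =
        bwd ((k , refl , refl) , trans (cong (λ z → ⌊ toℕ z /2⌋) lem) (trans (cong ⌊_/2⌋ (toℕ-[]< (<-trans (n<1+n _) (odd<x n)))) (sym (n≡⌊n+n/2⌋ (toℕ n)))))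
    where
    open ≡-Reasoning
    lem : (a ⊕ odd n) ⊕ ⊖ (next a ⊕ zero) ≡ [ toℕ n + toℕ n ]
    lem = begin
      (a ⊕ odd n) ⊕ ⊖ (next a ⊕ zero)                           ≡⟨ cong (λ z → (a ⊕ odd n) ⊕ ⊖ z) (trans (⊕-identityʳ (next a)) (next≡⊕1 a)) ⟩
      (a ⊕ odd n) ⊕ ⊖ (a ⊕ [ 1 ])                               ≡⟨ cong (λ z → (a ⊕ z) ⊕ ⊖ (a ⊕ [ 1 ])) ([]-⊕ 1 (toℕ n + toℕ n)) ⟨
      (a ⊕ ([ 1 ] ⊕ [ toℕ n + toℕ n ])) ⊕ ⊖ (a ⊕ [ 1 ])         ≡⟨ cong (_⊕ ⊖ (a ⊕ [ 1 ])) (⊕-assoc a [ 1 ] [ toℕ n + toℕ n ]) ⟨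
      ((a ⊕ [ 1 ]) ⊕ [ toℕ n + toℕ n ]) ⊕ ⊖ (a ⊕ [ 1 ])         ≡⟨ cong (_⊕ ⊖ (a ⊕ [ 1 ])) (⊕-comm (a ⊕ [ 1 ]) [ toℕ n + toℕ n ]) ⟩
      ([ toℕ n + toℕ n ] ⊕ (a ⊕ [ 1 ])) ⊕ ⊖ (a ⊕ [ 1 ])         ≡⟨ ⊕⊖ [ toℕ n + toℕ n ] (a ⊕ [ 1 ]) ⟩
      [ toℕ n + toℕ n ]                                         ∎

-- The map `φ` selects the pairs of differences used on each matching, so that a cell can withhold
-- differences 0 and 1 on its hexagon rows.
stripFam : ∀ {J I K R : Set} {r} (y h : ℕ) (even : suc y ≡ h + h) (fK : K ↔ Fin r) (rows : I → (K × Bool) ↔ R) →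
  (∀ i j {p q} → MatchRow (rows i) p q → MatchRow (rows j) p q → i ≡ j) →
  (φ : J → I × Fin h) → (∀ i j → φ i ≡ φ j → i ≡ j) →
  Fam (Fin (suc y) × R) (suc y * 2) J (λ u w → ∃ λ j → SymClosure (Strips.Dir y h even fK (rows (proj₁ (φ j))) (toℕ (proj₂ (φ j)))) u w)
stripFam {J} {I} {K} {R} y h even fK rows rd φ φ-inj = classFam (λ j → stripFactor (rows (proj₁ (φ j))) (proj₂ (φ j))) Cl
    (λ _ → SymClosure-sym) (λ j → strip-step (rows (proj₁ (φ j))) (proj₂ (φ j)))
    (λ i j c d → φ-inj i j (lem (proj₁ (φ i)) (proj₁ (φ j)) (proj₂ (φ i)) (proj₂ (φ j)) c d)) (λ j c → j , c)
  where
  open module S (f : (K × Bool) ↔ R) = Strips y h even fK f using (stripFactor; strip-step; Dir)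
  Cl : J → _ → _ → Set
  Cl j = SymClosure (Dir (rows (proj₁ (φ j))) (toℕ (proj₂ (φ j))))
  lem : ∀ i j (m n : Fin h) {u w} → SymClosure (Dir (rows i) (toℕ m)) u w → SymClosure (Dir (rows j) (toℕ n)) u w → (i , m) ≡ (j , n)
  lem i j m n {_ , _} {_ , _} (fwd (o , e)) (fwd (o' , e')) with rd i j (OMatch⇒ (rows i) o) (OMatch⇒ (rows j) o')
  ... | refl = cong (i ,_) (toℕ-injective (trans (sym e) e'))
  lem i j m n {_ , _} {_ , _} (bwd (o , e)) (bwd (o' , e')) with rd i j (OMatch⇒ (rows i) o) (OMatch⇒ (rows j) o')
  ... | refl = cong (i ,_) (toℕ-injective (trans (sym e) e'))
  lem i j m n {_ , _} {_ , _} (fwd (o , e)) (bwd (o' , e')) with rd i j (OMatch⇒ (rows i) o) (MatchRow-sym (rows j) _ _ (OMatch⇒ (rows j) o'))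
  ... | refl = ⊥-elim (OMatch-asym (rows i) o o')
  lem i j m n {_ , _} {_ , _} (bwd (o , e)) (fwd (o' , e')) with rd i j (OMatch⇒ (rows i) o) (MatchRow-sym (rows j) _ _ (OMatch⇒ (rows j) o'))
  ... | refl = ⊥-elim (OMatch-asym (rows i) o o')

-- For even x, two row matchings forming even cycles, together with the straight rails, form two C_2x-factors.
module Torus {K R : Set} {r x : ℕ} (x≥3 : 3 ≤ x) (even : par x ≡ false) (fK : K ↔ Fin r) (rows : Bool → (K × Bool) ↔ R)
  (rows-disj : ∀ {p q} → MatchRow (rows false) p q → MatchRow (rows true) p q → ⊥)
  (side : R → Bool) (side-rows : ∀ b k e → side (to (rows b) (k , e)) ≡ e) where

  V : Set
  V = Fin x × R

  pts : Bool → (K × (Fin x × Fin 2)) ↔ V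
  pts b = mk↔ₛ′ f g fg gf
    where
    f : K × (Fin x × Fin 2) → V
    f (k , a , d) = a , to (rows b) (k , bool d xor (par (toℕ a) xor b))
    g₁ : Fin x → K × Bool → K × (Fin x × Fin 2)
    g₁ a (k , e) = k , a , unbool (e xor (par (toℕ a) xor b))
    g : V → K × (Fin x × Fin 2)
    g (a , p) = g₁ a (from (rows b) p)
    fg₁ : ∀ a t → f (g₁ a t) ≡ (a , to (rows b) t)
    fg₁ a (k , e) = cong (λ z → a , to (rows b) (k , z)) (trans (cong (_xor (par (toℕ a) xor b)) (to-from 2↔Bool (e xor (par (toℕ a) xor b))))
      (xor-cancelʳ (par (toℕ a) xor b) e))
    fg : ∀ v → f (g v) ≡ v
    fg (a , p) = trans (fg₁ a (from (rows b) p)) (cong (a ,_) (to-from (rows b) p))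
    gf : ∀ v → g (f v) ≡ v
    gf (k , a , d) = trans (cong (g₁ a) (from-to (rows b) (k , bool d xor (par (toℕ a) xor b))))
      (cong (λ z → k , a , z) (trans (cong unbool (xor-cancelʳ (par (toℕ a) xor b) (bool d))) (from-to 2↔Bool d)))

  torusFactor : Bool → Factor V (x * 2)
  torusFactor b = mkFactor fK (pts b)

  -- In column a, factor `b` arrives on side `par (toℕ a) xor b`, crosses by matching `b` and leaves
  -- straight from the other side. Since x is even this is consistent around the ring, and the two
  -- factors leave each column on opposite sides.
  Dir : Bool → V → V → Set
  Dir b (a , p) (c , q) = (c ≡ a × MatchRow (rows b) p q) ⊎ (c ≡ next a × p ≡ q × side p ≡ not (par (toℕ a) xor b))

  par-next : ∀ (a : Fin x) → par (toℕ (next a)) ≡ not (par (toℕ a))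
  par-next a with nextView a
  ... | inj₁ e = cong par e
  ... | inj₂ (e , z) = trans (cong par z) (sym (trans (cong par e) even))

  torus-step : ∀ b {u w} → Step (torusFactor b) u w → SymClosure (Dir b) u w
  torus-step b s with mkFactor-step fK (pts b) s
  ... | k , (a , zero) , (.a , suc zero) , inj₁ (refl , _) , refl , refl = fwd (inj₁ (refl , k , _ , refl , refl))
  ... | k , (a , zero) , (.a , zero) , inj₁ (refl , ()) , refl , refl
  ... | k , (a , suc zero) , (.a , zero) , inj₁ (refl , ()) , refl , refl
  ... | k , (a , suc zero) , (.a , suc zero) , inj₁ (refl , ()) , refl , refl
  ... | k , (a , zero) , (.(next a) , _) , inj₂ (refl , () , _) , refl , refl
  ... | k , (a , suc zero) , (.(next a) , suc zero) , inj₂ (refl , _ , ()) , refl , refl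
  ... | k , (a , suc zero) , (.(next a) , zero) , inj₂ (refl , _ , _) , refl , refl =
        fwd (inj₂ (refl , cong (λ z → to (rows b) (k , z)) (sym (trans (cong (_xor b) (par-next a)) (not-xorˡ (par (toℕ a)) b))) , side-rows b k _))

  rows-disj' : ∀ b b' {p q} → MatchRow (rows b) p q → MatchRow (rows b') p q → b ≡ b'
  rows-disj' false false _ _ = refl
  rows-disj' true true _ _ = refl
  rows-disj' false true m m' = ⊥-elim (rows-disj m m')
  rows-disj' true false m m' = ⊥-elim (rows-disj m' m)

  xor-injective : ∀ a {b b'} → not (a xor b) ≡ not (a xor b') → b ≡ b'
  xor-injective false {false} {false} _ = refl
  xor-injective false {true} {true} _ = refl
  xor-injective true {false} {false} _ = refl
  xor-injective true {true} {true} _ = refl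

  x≥2 : 2 ≤ x
  x≥2 = ≤-trans (n≤1+n 2) x≥3

  torus-disj : ∀ b b' {u w} → SymClosure (Dir b) u w → SymClosure (Dir b') u w → b ≡ b'
  torus-disj b b' {a , _} {c , _} (fwd (inj₁ (_ , m))) (fwd (inj₁ (_ , m'))) = rows-disj' b b' m m'
  torus-disj b b' {a , _} {c , _} (bwd (inj₁ (_ , m))) (bwd (inj₁ (_ , m'))) = rows-disj' b b' m m'
  torus-disj b b' {a , _} {c , _} (fwd (inj₁ (_ , m))) (bwd (inj₁ (_ , m'))) = rows-disj' b b' m (MatchRow-sym (rows b') _ _ m')
  torus-disj b b' {a , _} {c , _} (bwd (inj₁ (_ , m))) (fwd (inj₁ (_ , m'))) = rows-disj' b b' m (MatchRow-sym (rows b') _ _ m')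
  torus-disj b b' {a , _} {c , _} (fwd (inj₂ (_ , _ , e))) (fwd (inj₂ (_ , _ , e'))) = xor-injective (par (toℕ a)) (trans (sym e) e')
  torus-disj b b' {a , _} {c , _} (bwd (inj₂ (_ , _ , e))) (bwd (inj₂ (_ , _ , e'))) = xor-injective (par (toℕ c)) (trans (sym e) e')
  torus-disj b b' {a , _} {c , _} (fwd (inj₂ (e , _))) (bwd (inj₂ (e' , _))) = ⊥-elim (next²≢ x≥3 a (sym (trans e' (cong next e))))
  torus-disj b b' {a , _} {c , _} (bwd (inj₂ (e' , _))) (fwd (inj₂ (e , _))) = ⊥-elim (next²≢ x≥3 a (sym (trans e' (cong next e))))
  torus-disj b b' {a , _} {.a , _} (fwd (inj₁ (refl , _))) (fwd (inj₂ (e , _))) = ⊥-elim (next≢ x≥2 a (sym e))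
  torus-disj b b' {a , _} {.a , _} (fwd (inj₁ (refl , _))) (bwd (inj₂ (e , _))) = ⊥-elim (next≢ x≥2 a (sym e))
  torus-disj b b' {a , _} {.a , _} (bwd (inj₁ (refl , _))) (fwd (inj₂ (e , _))) = ⊥-elim (next≢ x≥2 a (sym e))
  torus-disj b b' {a , _} {.a , _} (bwd (inj₁ (refl , _))) (bwd (inj₂ (e , _))) = ⊥-elim (next≢ x≥2 a (sym e))
  torus-disj b b' {a , _} {.a , _} (fwd (inj₂ (e , _))) (fwd (inj₁ (refl , _))) = ⊥-elim (next≢ x≥2 a (sym e))
  torus-disj b b' {a , _} {.a , _} (fwd (inj₂ (e , _))) (bwd (inj₁ (refl , _))) = ⊥-elim (next≢ x≥2 a (sym e))
  torus-disj b b' {a , _} {.a , _} (bwd (inj₂ (e , _))) (fwd (inj₁ (refl , _))) = ⊥-elim (next≢ x≥2 a (sym e))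
  torus-disj b b' {a , _} {.a , _} (bwd (inj₂ (e , _))) (bwd (inj₁ (refl , _))) = ⊥-elim (next≢ x≥2 a (sym e))

  Within : V → V → Set
  Within u@(a , p) w@(c , q) = (a ≡ c × ∃ λ b → MatchRow (rows b) p q) ⊎ (Ring u w × p ≡ q)

  torus-within : ∀ b {u w} → SymClosure (Dir b) u w → Within u w
  torus-within b {_ , _} {_ , _} (fwd (inj₁ (e , m))) = inj₁ (sym e , b , m)
  torus-within b {_ , _} {_ , _} (bwd (inj₁ (e , m))) = inj₁ (e , b , MatchRow-sym (rows b) _ _ m)
  torus-within b {_ , _} {_ , _} (fwd (inj₂ (e , r , _))) = inj₂ (inj₁ e , r)
  torus-within b {_ , _} {_ , _} (bwd (inj₂ (e , r , _))) = inj₂ (inj₂ e , sym r)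

  torusFam : Fam V (x * 2) Bool Within
  torusFam = classFam torusFactor (λ b → SymClosure (Dir b)) (λ _ → SymClosure-sym) torus-step torus-disj torus-within

next↔ : ∀ {n} → Fin n ↔ Fin n
next↔ = mk↔ₛ′ next prev next-prev prev-next

-- The complete graph on x = 2k + 2 columns and two rows.  The sums 2, …, 2k - 1 are left to Walecki's cycles.
-- Rails of the sums ±1 within a row are reserved (colour 3).  The remaining edges over the sums 0, ±1 form
-- two Hamilton cycles (colours 1 and 2) and a perfect matching (colour 0).
module Ladder (k' : ℕ) where

  k : ℕ
  k = suc k'

  open Walecki (k + k) k (n≤1+n (k + k)) public

  x : ℕ
  x = suc M

  x≥3 : 3 ≤ x
  x≥3 = s≤s (s≤s (s≤s z≤n))

  x-even : par x ≡ false
  x-even = cong (λ b → not (not b)) (par-double k)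

  U : Set
  U = Fin x × Bool

  -- These are the columns ∞ and 0. Their pair has sum 0, and the colouring by sums is altered
  -- there.
  apex : ∀ {n} → Fin n → Bool
  apex zero = true
  apex (suc zero) = true
  apex (suc (suc _)) = false

  apex-suc : ∀ {n} (a : Fin (suc n)) → apex (suc a) ≡ true → a ≡ zero
  apex-suc zero _ = refl

  -- Verticals of the two apex columns close up colour 2; all others belong to the matching.
  vertical : Bool → ℕ
  vertical true = 2
  vertical false = 0

  highColour : ∀ {P : Set} → Dec P → Bool → ℕ → ℕ
  highColour (yes _) true _ = 2
  highColour (yes _) false _ = 3
  highColour (no _) _ n = 4 + ⌊ n /2⌋

  lowColour : ℕ → Bool → ℕ
  lowColour _ true = 1
  lowColour n false = n

  -- The argument of type Bool tells whether the edge changes rows, n is the sum of its columns.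
  sumColour : Bool → ℕ → ℕ
  sumColour z zero = lowColour 2 z
  sumColour z (suc zero) = lowColour 3 z
  sumColour z n@(suc (suc _)) = highColour (n ≟ℕ k + k) z n

  -- Colour 1 runs along the column cycle with sums 0 and 1, changing rows at each step. As x is
  -- even this would close after one lap; keeping the row on the apex pair merges the two laps into
  -- one cycle of length 2x. The crossing edges so freed complete the matching.
  apexColour : Bool → ℕ
  apexColour true = 0
  apexColour false = 1

  pairColour : ∀ {P : Set} → Dec P → Bool → Bool → Bool → ℕ → ℕ
  pairColour (yes _) a _ _ _ = vertical a
  pairColour (no _) true true z _ = apexColour z
  pairColour (no _) true false z n = sumColour z n
  pairColour (no _) false _ z n = sumColour z n

  pairColour-comm : ∀ {P Q : Set} (¬p : ¬ P) (¬q : ¬ Q) a b z n → pairColour (no ¬p) a b z n ≡ pairColour (no ¬q) b a z n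
  pairColour-comm _ _ true true z n = refl
  pairColour-comm _ _ true false z n = refl
  pairColour-comm _ _ false true z n = refl
  pairColour-comm _ _ false false z n = refl

  opaque
    colour : U → U → ℕ
    colour (b , e) (c , e') = pairColour (b ≟F c) (apex b) (apex c) (e xor e') (toℕ (S b c))

    colour-sym : ∀ u w → colour u w ≡ colour w u
    colour-sym (b , e) (c , e') with b ≟F c | c ≟F b
    ... | yes refl | yes _ = refl
    ... | yes p | no ¬q = ⊥-elim (¬q (sym p))
    ... | no ¬p | yes q = ⊥-elim (¬p (sym q))
    ... | no ¬p | no ¬q = trans (cong₂ (pairColour (no ¬p) (apex b) (apex c)) (xor-comm e e') (cong toℕ (S-comm b c)))
                                (pairColour-comm ¬p ¬q (apex b) (apex c) (e' xor e) (toℕ (S c b)))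

    colour-vertical : ∀ b e e' → colour (b , e) (b , e') ≡ vertical (apex b)
    colour-vertical b e e' with b ≟F b
    ... | yes _ = refl
    ... | no ¬p = ⊥-elim (¬p refl)

    colour-sum : ∀ {b c} e e' → b ≢ c → ¬ (apex b ≡ true × apex c ≡ true) → colour (b , e) (c , e') ≡ sumColour (e xor e') (toℕ (S b c))
    colour-sum {b} {c} e e' ne na with b ≟F c | apex b | apex c
    ... | yes p | _ | _ = ⊥-elim (ne p)
    ... | no _ | true | true = ⊥-elim (na (refl , refl))
    ... | no _ | true | false = refl
    ... | no _ | false | _ = refl

    colour-apex : ∀ e e' → colour (zero , e) (suc zero , e') ≡ apexColour (e xor e')
    colour-apex e e' = refl

  apex-sum : ∀ (b c : Fin x) → b ≢ c → apex b ≡ true × apex c ≡ true → S b c ≡ zero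
  apex-sum zero zero ne _ = refl
  apex-sum zero (suc zero) ne _ = ⊕-identityʳ zero
  apex-sum (suc zero) zero ne _ = ⊕-identityʳ zero
  apex-sum (suc zero) (suc zero) ne _ = ⊥-elim (ne refl)
  apex-sum zero (suc (suc _)) ne (_ , ())
  apex-sum (suc zero) (suc (suc _)) ne (_ , ())
  apex-sum (suc (suc _)) _ ne (() , _)

  toℕ-1 : toℕ {suc (k + k)} [ 1 ] ≡ 1
  toℕ-1 = toℕ-[]< (s≤s (s≤s z≤n))

  sumColour-top : ∀ z n → n ≡ k + k → sumColour z n ≡ highColour (yes (refl {x = n})) z n
  sumColour-top z zero ()
  sumColour-top z (suc zero) e = case trans (suc-injective e) (+-suc k' k') of λ ()
  sumColour-top z n@(suc (suc _)) e with n ≟ℕ k + k | z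
  ... | yes _ | true = refl
  ... | yes _ | false = refl
  ... | no ¬e | _ = ⊥-elim (¬e e)

  module Base (f : Fin M ↔ Fin M) (f0 : to f zero ≡ zero) where

    -- Rotating the zigzag by one place puts 0 first and ∞ last, so the exceptional apex pair is the
    -- closing step.
    order : Fin x ↔ Fin x
    order = ↔-trans next↔ (zigzag f)

    apex-index : ∀ j → apex (to (zigzag f) j) ≡ true → (j ≡ zero) ⊎ (j ≡ suc zero)
    apex-index zero _ = inj₁ refl
    apex-index (suc i) e = inj₂ (cong suc (to-injective (↔-trans zig↔ f) (trans (apex-suc (to f (zig (toℕ i))) e) (sym f0))))

    next-one : toℕ (next {x} (suc zero)) ≡ 2
    next-one = cong toℕ (next-step {x} {suc zero} {suc (suc zero)} refl)

    not-both : ∀ j → toℕ j ≢ 0 → ¬ (apex (to (zigzag f) j) ≡ true × apex (to (zigzag f) (next j)) ≡ true)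
    not-both j j≢0 (e , e') = lem (apex-index j e) (apex-index (next j) e')
      where
      lem : (j ≡ zero) ⊎ (j ≡ suc zero) → (next j ≡ zero) ⊎ (next j ≡ suc zero) → ⊥
      lem (inj₁ z) _ = j≢0 (cong toℕ z)
      lem (inj₂ z) (inj₁ z') = case trans (sym next-one) (trans (cong (λ j → toℕ (next j)) (sym z)) (cong toℕ z')) of λ ()
      lem (inj₂ z) (inj₂ z') = case trans (sym next-one) (trans (cong (λ j → toℕ (next j)) (sym z)) (cong toℕ z')) of λ ()

    order-step' : ∀ (i i' : Fin x) → next i ≡ i' → toℕ i' ≢ 0 → ∀ e e' → (h : Fin M → Fin M) → (∀ a b → to f a ⊕ to f b ≡ h (a ⊕ b)) →
      colour (to order i , e) (to order i' , e') ≡ sumColour (e xor e') (toℕ (h (bit (par (toℕ i')))))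
    order-step' i .(next i) refl nz e e' h hom = trans (colour-sum e e' (λ z → next≢ (s≤s (s≤s z≤n)) (next i) (sym (to-injective (zigzag f) z)))
        (not-both (next i) nz)) (cong (λ s → sumColour (e xor e') (toℕ s)) (zigzag-sum f h hom (next i)))

    order-step : ∀ (i i' : Fin x) → toℕ i' ≡ suc (toℕ i) → ∀ e e' → (h : Fin M → Fin M) → (∀ a b → to f a ⊕ to f b ≡ h (a ⊕ b)) →
      colour (to order i , e) (to order i' , e') ≡ sumColour (e xor e') (toℕ (h (bit (par (toℕ i')))))
    order-step i i' q = order-step' i i' (next-step (sym q)) (λ z → case trans (sym q) z of λ ())

    order-first : ∀ i → toℕ i ≡ 0 → to order i ≡ suc zero
    order-first i z = trans (cong (to (zigzag f)) (next-step {j = i} {suc zero} (cong suc z))) (cong suc f0)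

    order-last : ∀ i → suc (toℕ i) ≡ x → to order i ≡ zero
    order-last i e = cong (to (zigzag f)) (next-wrap {j = i} {zero} e refl)

  open Base ↔-refl refl using () renaming (order to order₁; order-step to step₁; order-first to first₁; order-last to last₁)
  open Base negate (⊖-unique (⊕-identityʳ zero)) using () renaming (order to order₂; order-step to step₂; order-first to first₂; order-last to last₂)

  pts₁ : (Fin 1 × (Fin 2 × Fin x)) ↔ U
  pts₁ = mk↔ₛ′ f g fg gf
    where
    f : Fin 1 × (Fin 2 × Fin x) → U
    f (_ , ρ , i) = to order₁ i , bool ρ xor par (toℕ i)
    g : U → Fin 1 × (Fin 2 × Fin x)
    g (b , e) = zero , unbool (e xor par (toℕ (from order₁ b))) , from order₁ b
    fg : ∀ v → f (g v) ≡ v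
    fg (b , e) = cong₂ _,_ (to-from order₁ b) (trans (cong (_xor par (toℕ (from order₁ b))) (to-from 2↔Bool (e xor par (toℕ (from order₁ b)))))
      (xor-cancelʳ (par (toℕ (from order₁ b))) e))
    gf : ∀ v → g (f v) ≡ v
    gf (zero , ρ , i) = trans (cong (λ j → zero , unbool ((bool ρ xor par (toℕ i)) xor par (toℕ j)) , j) (from-to order₁ i))
      (cong (λ z → zero , z , i) (trans (cong unbool (xor-cancelʳ (par (toℕ i)) (bool ρ))) (from-to 2↔Bool ρ)))

  -- The row after n steps along the column path with sums -1, 0, -1, ...: it changes at sum -1 and
  -- stays at sum 0.
  turn : ℕ → Bool
  turn zero = false
  turn (suc n) = turn n xor not (par n)

  -- Two complementary lifts of the column path from 0 to ∞, one forward and one backward, joined by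
  -- the verticals of the apex columns.
  pts₂ : (Fin 1 × (Fin 2 × Fin x)) ↔ U
  pts₂ = mk↔ₛ′ f g fg gf
    where
    f : Fin 1 × (Fin 2 × Fin x) → U
    f (_ , zero , i) = to order₂ i , turn (toℕ i)
    f (_ , suc zero , i) = to order₂ (opposite i) , not (turn (toℕ (opposite i)))
    g₁ : Fin x → Bool → Fin 1 × (Fin 2 × Fin x)
    g₁ i false = zero , zero , i
    g₁ i true = zero , suc zero , opposite i
    g : U → Fin 1 × (Fin 2 × Fin x)
    g (b , e) = g₁ (from order₂ b) (e xor turn (toℕ (from order₂ b)))
    fg₁ : ∀ i c → f (g₁ i c) ≡ (to order₂ i , c xor turn (toℕ i))
    fg₁ i false = refl
    fg₁ i true = cong (λ j → to order₂ j , not (turn (toℕ j))) (opposite-involutive i)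
    fg : ∀ v → f (g v) ≡ v
    fg (b , e) = trans (fg₁ (from order₂ b) _) (cong₂ _,_ (to-from order₂ b) (xor-cancelʳ (turn (toℕ (from order₂ b))) e))
    gf : ∀ v → g (f v) ≡ v
    gf (zero , zero , i) = trans (cong (λ j → g₁ j (turn (toℕ i) xor turn (toℕ j))) (from-to order₂ i)) (cong (g₁ i) (xor-same (turn (toℕ i))))
    gf (zero , suc zero , i) = trans (cong (λ j → g₁ j (not (turn (toℕ (opposite i))) xor turn (toℕ j))) (from-to order₂ (opposite i)))
      (trans (cong (g₁ (opposite i)) (trans (not-xorˡ (turn (toℕ (opposite i))) (turn (toℕ (opposite i)))) (cong not (xor-same (turn (toℕ (opposite i)))))))
        (cong (λ j → zero , suc zero , j) (opposite-involutive i)))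

  hamFactor : Bool → Factor U (2 * x)
  hamFactor false = mkFactor {k = 1} ↔-refl pts₁
  hamFactor true = mkFactor {k = 1} ↔-refl pts₂

  code : Bool → ℕ
  code false = 1
  code true = 2

  sumColour-low : ∀ b → sumColour true (toℕ {suc (k + k)} (bit b)) ≡ 1
  sumColour-low false = refl
  sumColour-low true = cong (sumColour true) toℕ-1

  carry-colour₁ : ∀ z p q → Carry p q → colour (to pts₁ (z , p)) (to pts₁ (z , q)) ≡ 1
  carry-colour₁ _ (ρ , i) (.ρ , i') (inj₁ (refl , q)) =
    trans (step₁ i i' q _ _ (λ s → s) (λ _ _ → refl)) (trans (cong (λ z → sumColour z (toℕ (bit (par (toℕ i'))))) lem) (sumColour-low (par (toℕ i'))))
    where
    lem : (bool ρ xor par (toℕ i)) xor (bool ρ xor par (toℕ i')) ≡ true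
    lem = trans (cong ((bool ρ xor par (toℕ i)) xor_) (trans (cong (λ n → bool ρ xor par n) q) (not-xorʳ (bool ρ) (par (toℕ i)))))
      (trans (not-xorʳ (bool ρ xor par (toℕ i)) _) (cong not (xor-same (bool ρ xor par (toℕ i)))))
  carry-colour₁ _ (ρ , i) (.(next ρ) , i') (inj₂ (refl , q , z)) =
    trans (cong₂ (λ b c → colour (b , bool ρ xor par (toℕ i)) (c , bool (next ρ) xor par (toℕ i'))) (last₁ i q) (first₁ i' z)) (trans (colour-apex _ _) (cong apexColour lem))
    where
    open ≡-Reasoning
    par-i : par (toℕ i) ≡ true
    par-i = trans (cong par (suc-injective q)) (cong not (par-double k))
    lem : (bool ρ xor par (toℕ i)) xor (bool (next ρ) xor par (toℕ i')) ≡ false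
    lem = begin
      (bool ρ xor par (toℕ i)) xor (bool (next ρ) xor par (toℕ i'))   ≡⟨ cong₂ (λ p q → (bool ρ xor p) xor (q xor par (toℕ i'))) par-i (bool-next ρ) ⟩
      (bool ρ xor true) xor (not (bool ρ) xor par (toℕ i'))           ≡⟨ cong (λ n → (bool ρ xor true) xor (not (bool ρ) xor par n)) z ⟩
      (bool ρ xor true) xor (not (bool ρ) xor false)                  ≡⟨ cong₂ _xor_ (not-xorʳ (bool ρ) false) (not-xorˡ (bool ρ) false) ⟩
      not (bool ρ xor false) xor not (bool ρ xor false)               ≡⟨ xor-same (not (bool ρ xor false)) ⟩
      false                                                           ∎

  step-colour₁ : ∀ {u w} → Step (hamFactor false) u w → colour u w ≡ 1
  step-colour₁ = mkFactor-elim {k = 1} ↔-refl pts₁ (λ u w → colour u w ≡ 1) carry-colour₁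

  toℕ-neg1 : toℕ {suc (k + k)} (⊖ [ 1 ]) ≡ k + k
  toℕ-neg1 = trans (cong toℕ (trans (⊖-def [ 1 ]) (cong (λ n → [ suc (k + k) ∸ n ]) toℕ-1))) (toℕ-[]< (n<1+n (k + k)))

  turn-colour : ∀ n → sumColour (turn n xor turn (suc n)) (toℕ {suc (k + k)} (⊖ bit (par (suc n)))) ≡ 2
  turn-colour n = trans (cong (λ z → sumColour z (toℕ {suc (k + k)} (⊖ bit (par (suc n))))) (xor-self (turn n) (not (par n)))) (lem (par n))
    where
    lem : ∀ b → sumColour (not b) (toℕ {suc (k + k)} (⊖ bit (not b))) ≡ 2
    lem false = sumColour-top true (toℕ {suc (k + k)} (⊖ [ 1 ])) toℕ-neg1
    lem true = cong (λ s → sumColour false (toℕ {suc (k + k)} s)) (⊖-unique (⊕-identityʳ zero))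

  forward : ∀ (i i' : Fin x) → toℕ i' ≡ suc (toℕ i) → ∀ c → colour (to order₂ i , c xor turn (toℕ i)) (to order₂ i' , c xor turn (toℕ i')) ≡ 2
  forward i i' q c = trans (step₂ i i' q _ _ ⊖_ (λ a b → sym (⊖-⊕ a b)))
    (trans (cong₂ (λ z s → sumColour z (toℕ (⊖ bit (par s)))) (trans (cancel c _ _) (cong (λ n → turn (toℕ i) xor turn n) q)) q) (turn-colour (toℕ i)))
    where
    cancel : ∀ c a b → (c xor a) xor (c xor b) ≡ a xor b
    cancel false a b = refl
    cancel true false b = not-involutive b
    cancel true true b = refl

  opposite-zero : ∀ {n} (i : Fin (suc n)) → toℕ i ≡ 0 → suc (toℕ (opposite i)) ≡ suc n
  opposite-zero {n} i z = cong suc (trans (opposite-prop i) (cong (n ∸_) z))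

  opposite-last : ∀ {n} (i : Fin (suc n)) → suc (toℕ i) ≡ suc n → toℕ (opposite i) ≡ 0
  opposite-last {n} i e = trans (opposite-prop i) (m≤n⇒m∸n≡0 (≤-reflexive (sym (suc-injective e))))

  opposite-step : ∀ {n} (i i' : Fin n) → toℕ i' ≡ suc (toℕ i) → toℕ (opposite i) ≡ suc (toℕ (opposite i'))
  opposite-step {suc n} i i' q = trans (opposite-prop i) (trans
    (+-∸-assoc 1 (≤-trans (≤-reflexive (sym q)) (≤-pred (toℕ<n i')))) (cong suc (sym (trans (opposite-prop i') (cong (n ∸_) q)))))

  carry-colour₂ : ∀ z p q → Carry p q → colour (to pts₂ (z , p)) (to pts₂ (z , q)) ≡ 2
  carry-colour₂ _ (zero , i) (.zero , i') (inj₁ (refl , q)) = forward i i' q false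
  carry-colour₂ _ (suc zero , i) (.(suc zero) , i') (inj₁ (refl , q)) =
    trans (colour-sym (to order₂ (opposite i) , _) (to order₂ (opposite i') , _)) (forward (opposite i') (opposite i) (opposite-step i i' q) true)
  carry-colour₂ _ (zero , i) (.(next zero) , i') (inj₂ (refl , q , z)) =
    trans (cong₂ (λ b c → colour (b , turn (toℕ i)) (c , not (turn (toℕ (opposite i'))))) (last₂ i q) (last₂ (opposite i') (opposite-zero i' z)))
      (colour-vertical zero (turn (toℕ i)) (not (turn (toℕ (opposite i')))))
  carry-colour₂ _ (suc zero , i) (.(next (suc zero)) , i') (inj₂ (refl , q , z)) =
    trans (cong₂ (λ b c → colour (b , not (turn (toℕ (opposite i)))) (c , turn (toℕ i'))) (first₂ (opposite i) (opposite-last i q)) (first₂ i' z))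
      (colour-vertical (suc zero) (not (turn (toℕ (opposite i)))) (turn (toℕ i')))

  step-colour₂ : ∀ {u w} → Step (hamFactor true) u w → colour u w ≡ 2
  step-colour₂ = mkFactor-elim {k = 1} ↔-refl pts₂ (λ u w → colour u w ≡ 2) carry-colour₂

  step-colour : ∀ h {u w} → Step (hamFactor h) u w → colour u w ≡ code h
  step-colour false = step-colour₁
  step-colour true = step-colour₂

  code-injective : ∀ h h' → code h ≡ code h' → h ≡ h'
  code-injective false false _ = refl
  code-injective true true _ = refl

  hamFam : Fam U (2 * x) Bool (λ u w → ∃ λ h → colour u w ≡ code h)
  hamFam = classFam hamFactor (λ h u w → colour u w ≡ code h) (λ h u w e → trans (colour-sym w u) e) step-colour
    (λ h h' e e' → code-injective h h' (trans (sym e) e')) (λ h e → h , e)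

  sumColour-mid : ∀ z n (i : Fin k') → ⌊ n /2⌋ ≡ 1 + toℕ i → 4 ≤ sumColour z n
  sumColour-mid z (suc (suc n)) i e with suc (suc n) ≟ℕ k + k
  ... | no _ = s≤s (s≤s (s≤s (s≤s z≤n)))
  ... | yes q = ⊥-elim (<-irrefl (sym (trans (n≡⌊n+n/2⌋ k) (trans (cong ⌊_/2⌋ (sym q)) e))) (s≤s (toℕ<n i)))

  class-colour : ∀ (i : Fin k') {b c} e e' → Class (1 + toℕ i) b c → 4 ≤ colour (b , e) (c , e')
  class-colour i {b} {c} e e' (ne , q) = subst (4 ≤_) (sym (colour-sum e e' ne
      (λ a → case trans (sym q) (cong (λ s → ⌊ toℕ s /2⌋) (apex-sum b c ne a)) of λ ()))) (sumColour-mid (e xor e') _ i q)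

  restFam : Fam U (2 * x) (Fin k' × Bool) (λ u w → 4 ≤ colour u w)
  restFam = weakenFam (λ { {_ , e} {_ , e'} (i , c) → class-colour i e e' c })
    (blowFam (λ i → ham (suc i)) (λ i → Class (1 + toℕ i)) (λ i → Class-sym (1 + toℕ i)) (λ i → ham-class (suc i))
      (λ i j (_ , e) (_ , e') → toℕ-injective (suc-injective (trans (sym e) e'))) (doubleFam x 1 x (sym (+-identityʳ x)) (s≤s (s≤s z≤n)) x≥3))

  Used : U → U → Set
  Used u w = (∃ λ h → colour u w ≡ code h) ⊎ 4 ≤ colour u w

  ladderFam : Fam U (2 * x) (Bool ⊎ (Fin k' × Bool)) Used
  ladderFam = unionFam (λ { (false , e) h → case subst (4 ≤_) e h of λ { (s≤s ()) } ; (true , e) h → case subst (4 ≤_) e h of λ { (s≤s (s≤s ())) } }) hamFam restFam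

  -- The Hamilton cycle of the columns formed by the sums 1 and -1.
  outer : Fin x ↔ Fin x
  outer = zigzag (↔-trans (double↔ k) (shift [ k ]))

  -- Doubling turns the sums 0 and 1 into 0 and 2, and the shift by k adds 2k = -1. The resulting
  -- sums -1 and 1 are nonzero, so the apex pair is avoided.
  outer-colour : ∀ a e → colour (to outer a , e) (to outer (next a) , e) ≡ 3
  outer-colour a e = trans (colour-sum e e (λ z → next≢ (s≤s (s≤s z≤n)) a (sym (to-injective outer z)))
      (λ ap → nonzero (trans (sym sum) (apex-sum _ _ (λ z → next≢ (s≤s (s≤s z≤n)) a (sym (to-injective outer z))) ap))))
    (trans (cong₂ (λ z s → sumColour z (toℕ s)) (xor-same e) sum) (final (par (toℕ a))))
    where
    open ≡-Reasoning
    H : Fin M → Fin M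
    H s = (s ⊕ s) ⊕ ([ k ] ⊕ [ k ])
    sum : S (to outer a) (to outer (next a)) ≡ H (bit (par (toℕ a)))
    sum = zigzag-sum (↔-trans (double↔ k) (shift [ k ])) H
      (λ p q → trans (⊕-interchange (p ⊕ p) [ k ] (q ⊕ q) [ k ]) (cong (_⊕ ([ k ] ⊕ [ k ])) (⊕-interchange p p q q))) a
    H0 : H (bit false) ≡ [ k + k ]
    H0 = trans (cong₂ _⊕_ (⊕-identityʳ zero) ([]-⊕ k k)) (⊕-identityˡ [ k + k ])
    H1 : H (bit true) ≡ [ 1 ]
    H1 = begin
      ([ 1 ] ⊕ [ 1 ]) ⊕ ([ k ] ⊕ [ k ])   ≡⟨ cong (([ 1 ] ⊕ [ 1 ]) ⊕_) ([]-⊕ k k) ⟩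
      ([ 1 ] ⊕ [ 1 ]) ⊕ [ k + k ]         ≡⟨ ⊕-assoc [ 1 ] [ 1 ] [ k + k ] ⟩
      [ 1 ] ⊕ ([ 1 ] ⊕ [ k + k ])         ≡⟨ cong ([ 1 ] ⊕_) ([]-⊕ 1 (k + k)) ⟩
      [ 1 ] ⊕ [ suc (k + k) ]             ≡⟨ cong ([ 1 ] ⊕_) [M]≡0 ⟩
      [ 1 ] ⊕ zero                        ≡⟨ ⊕-identityʳ [ 1 ] ⟩
      [ 1 ]                               ∎
    toℕ-kk : toℕ {suc (k + k)} [ k + k ] ≡ k + k
    toℕ-kk = toℕ-[]< (n<1+n (k + k))
    nonzero : H (bit (par (toℕ a))) ≢ zero
    nonzero z with par (toℕ a)
    ... | false = case trans (sym toℕ-kk) (cong toℕ (trans (sym H0) z)) of λ ()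
    ... | true = case trans (sym toℕ-1) (cong toℕ (trans (sym H1) z)) of λ ()
    final : ∀ b → sumColour false (toℕ (H (bit b))) ≡ 3
    final false = trans (cong (λ s → sumColour false (toℕ s)) H0) (sumColour-top false _ toℕ-kk)
    final true = trans (cong (λ s → sumColour false (toℕ s)) H1) (cong (sumColour false) toℕ-1)

  mateU : U → U
  mateU (zero , e) = suc zero , not e
  mateU (suc zero , e) = zero , not e
  mateU (b@(suc (suc _)) , e) = b , not e

  mateU-noFix : ∀ u → mateU u ≢ u
  mateU-noFix (zero , e) ()
  mateU-noFix (suc zero , e) ()
  mateU-noFix (suc (suc _) , e) p = not-¬ refl (sym (,-injectiveʳ p))

  mateU-involutive : ∀ u → mateU (mateU u) ≡ u
  mateU-involutive (zero , e) = cong (zero ,_) (not-involutive e)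
  mateU-involutive (suc zero , e) = cong (suc zero ,_) (not-involutive e)
  mateU-involutive (b@(suc (suc _)) , e) = cong (b ,_) (not-involutive e)

  mateU-colour : ∀ u → colour u (mateU u) ≡ 0
  mateU-colour (zero , e) = trans (colour-apex e (not e)) (cong apexColour (trans (not-xorʳ e e) (cong not (xor-same e))))
  mateU-colour (suc zero , e) = trans (colour-sym (suc zero , e) (zero , not e)) (trans (colour-apex (not e) e) (cong apexColour (trans (not-xorˡ e e) (cong not (xor-same e)))))
  mateU-colour (b@(suc (suc _)) , e) = colour-vertical b e (not e)

-- A 1-factorization of K₆; the union of the matchings 1 and 2 is the hexagon 0 1 5 3 4 2.
K₆ : Vec (Vec (Fin 6 × Fin 6) 3) 5
K₆ = ((# 5 , # 0) ∷ (# 1 , # 4) ∷ (# 2 , # 3) ∷ [])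
   ∷ ((# 5 , # 3) ∷ (# 0 , # 1) ∷ (# 4 , # 2) ∷ [])
   ∷ ((# 5 , # 1) ∷ (# 0 , # 2) ∷ (# 4 , # 3) ∷ [])
   ∷ ((# 5 , # 4) ∷ (# 0 , # 3) ∷ (# 1 , # 2) ∷ [])
   ∷ ((# 5 , # 2) ∷ (# 0 , # 4) ∷ (# 1 , # 3) ∷ [])
   ∷ []

-- The diagonal is 0 like the pairs of matching 0: edges inside a row and edges between its two rows
-- lie in the same ladder.
kinds : Vec (Vec ℕ 6) 6
kinds = (0 ∷ 1 ∷ 2 ∷ 3 ∷ 4 ∷ 0 ∷ [])
      ∷ (1 ∷ 0 ∷ 3 ∷ 4 ∷ 0 ∷ 2 ∷ [])
      ∷ (2 ∷ 3 ∷ 0 ∷ 0 ∷ 1 ∷ 4 ∷ [])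
      ∷ (3 ∷ 4 ∷ 0 ∷ 0 ∷ 2 ∷ 1 ∷ [])
      ∷ (4 ∷ 0 ∷ 1 ∷ 2 ∷ 0 ∷ 3 ∷ [])
      ∷ (0 ∷ 2 ∷ 4 ∷ 1 ∷ 3 ∷ 0 ∷ [])
      ∷ []

-- The bipartition of the hexagon; matchings 1 and 2 list the row of side `false` first in every
-- pair.
side : Fin 6 → Bool
side = lookup (false ∷ true ∷ true ∷ true ∷ false ∷ false ∷ [])

kind : Fin 6 → Fin 6 → ℕ
kind p q = lookup (lookup kinds p) q

K₆-ok : ∀ i → PairTable (lookup K₆ i)
K₆-ok = toWitness {a? = all? λ i → all? λ v → _ ≟F _} tt

ν : Fin 5 → (Fin 3 × Bool) ↔ Fin 6
ν i = pairs refl (lookup K₆ i) (K₆-ok i)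

kind-sym : ∀ p q → kind p q ≡ kind q p
kind-sym = toWitness {a? = all? λ p → all? λ q → _ ≟ℕ _} tt

kind-diag : ∀ p → kind p p ≡ 0
kind-diag = toWitness {a? = all? λ p → _ ≟ℕ _} tt

kind-match : ∀ i {p q} → MatchRow (ν i) p q → kind p q ≡ toℕ i
kind-match i (k , b , refl , refl) = check i k b
  where
  check : ∀ i k b → kind (pairAt (lookup K₆ i) (k , b)) (pairAt (lookup K₆ i) (k , not b)) ≡ toℕ i
  check = toWitness {a? = all? λ i → all? λ k → allBool? λ b → _ ≟ℕ _} tt

kind-strip : ∀ k e e' → kind (to (ν zero) (k , e)) (to (ν zero) (k , e')) ≡ 0
kind-strip = toWitness {a? = all? λ k → allBool? λ e → allBool? λ e' → kind (pairAt (lookup K₆ zero) (k , e)) (pairAt (lookup K₆ zero) (k , e')) ≟ℕ 0} tt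

hexRows : Bool → Fin 5
hexRows false = # 1
hexRows true = # 2

side-hex : ∀ b k e → side (to (ν (hexRows b)) (k , e)) ≡ e
side-hex = toWitness {a? = allBool? λ b → all? λ k → allBool? λ e → side (pairAt (lookup K₆ (hexRows b)) (k , e)) ≟B e} tt

hexagon : Fin 6 → Fin 6
hexagon = lookup (# 0 ∷ # 1 ∷ # 5 ∷ # 3 ∷ # 4 ∷ # 2 ∷ [])

hexagon⁻¹ : Fin 6 → Fin 6
hexagon⁻¹ = lookup (# 0 ∷ # 1 ∷ # 5 ∷ # 3 ∷ # 4 ∷ # 2 ∷ [])

hexagon↔ : Fin 6 ↔ Fin 6
hexagon↔ = section↔ ↔-refl ↔-refl hexagon hexagon⁻¹ (toWitness {a? = all? λ v → hexagon (hexagon⁻¹ v) ≟F v} tt)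

data OnHexagon (p q : Fin 6) : Set where
  one : kind p q ≡ 1 → OnHexagon p q
  two : kind p q ≡ 2 → OnHexagon p q

hexagon-kind : ∀ j → OnHexagon (hexagon j) (hexagon (next j))
hexagon-kind j = [ one , two ]′ (check j)
  where
  check : ∀ j → (kind (hexagon j) (hexagon (next j)) ≡ 1) ⊎ (kind (hexagon j) (hexagon (next j)) ≡ 2)
  check = toWitness {a? = all? λ j → (_ ≟ℕ _) ⊎-dec (_ ≟ℕ _)} tt

hexagon-side : ∀ j → side (hexagon (next j)) ≡ not (side (hexagon j))
hexagon-side = toWitness {a? = all? λ j → _ ≟B _} tt

OnHexagon-sym : ∀ {p q} → OnHexagon p q → OnHexagon q p
OnHexagon-sym {p} {q} (one e) = one (trans (kind-sym q p) e)
OnHexagon-sym {p} {q} (two e) = two (trans (kind-sym q p) e)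

OnHexagon≤2 : ∀ {p q} → OnHexagon p q → kind p q ≢ 0 × ¬ (3 ≤ kind p q)
OnHexagon≤2 (one e) = (λ z → case trans (sym e) z of λ ()) , (λ h → case subst (3 ≤_) e h of λ { (s≤s ()) })
OnHexagon≤2 (two e) = (λ z → case trans (sym e) z of λ ()) , (λ h → case subst (3 ≤_) e h of λ { (s≤s (s≤s ())) })

module CellEven (k' : ℕ) where

  open Ladder k'

  V : Set
  V = Fin x × Fin 6

  level : Fin 6 → Bool
  level p = proj₂ (from (ν zero) p)

  low : V → U
  low (b , p) = b , level p

  level-ν : ∀ k e → level (to (ν zero) (k , e)) ≡ e
  level-ν k e = cong proj₂ (from-to (ν zero) (k , e))

  strips : (Fin 3 × U) ↔ V
  strips = spread (ν zero)

  low-strips : ∀ k u → low (to strips (k , u)) ≡ u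
  low-strips k (b , e) = cong (b ,_) (level-ν k e)

  Inner : V → V → Set
  Inner u w = kind (proj₂ u) (proj₂ w) ≡ 0 × Used (low u) (low w)

  innerFam : Fam V (2 * x) (Bool ⊎ (Fin k' × Bool)) Inner
  innerFam = mapFam strips (λ { {k , u} {.k , w} (refl , e) → kind-strip k (proj₂ u) (proj₂ w) , subst₂ Used (sym (low-strips k u)) (sym (low-strips k w)) e })
    (copyFam ↔-refl ladderFam)

  Twist : V → V → Set
  Twist u w = (proj₁ u ≡ proj₁ w × OnHexagon (proj₂ u) (proj₂ w)) ⊎ (kind (proj₂ u) (proj₂ w) ≡ 0 × colour (low u) (low w) ≡ 3)

  hexRows-kind : ∀ b {p q} → MatchRow (ν (hexRows b)) p q → OnHexagon p q
  hexRows-kind false m = one (kind-match (# 1) m)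
  hexRows-kind true m = two (kind-match (# 2) m)

  -- The torus is laid over the columns in the order `outer`, so its straight rails are edges of the
  -- reserved colour 3.
  twistFam : Fam V (2 * x) Bool Twist
  twistFam = subst (λ N → Fam V N Bool Twist) (*-comm x 2) (mapFam (outer ×-↔ ↔-refl)
    (λ { {_ , p} {_ , q} (inj₁ (refl , b , m)) → inj₁ (refl , hexRows-kind b m)
       ; {a , p} {_ , _} (inj₂ (inj₁ refl , refl)) → inj₂ (kind-diag p , outer-colour a (level p))
       ; {_ , p} {a , _} (inj₂ (inj₂ refl , refl)) → inj₂ (kind-diag p , trans (colour-sym (to outer (next a) , level p) (to outer a , level p)) (outer-colour a (level p))) })
    (Torus.torusFam x≥3 x-even ↔-refl (λ b → ν (hexRows b)) (λ m m' → case trans (sym (kind-match (# 1) m)) (kind-match (# 2) m') of λ ()) side side-hex))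

  even : x ≡ suc k + suc k
  even = cong suc (sym (+-suc k k))

  StripIx : Set
  StripIx = (Fin 2 × Fin k) ⊎ (Fin 2 × Fin (suc k))

  bump : Fin 2 → Fin 4
  bump b = suc (suc b)

  -- Matchings 1 and 2 start at the pair of differences 2 and 3, since 0 is spent on `twistFam` and
  -- 1 on `hexFactor`; matchings 3 and 4 use all k + 1 pairs.
  φ : StripIx → Fin 4 × Fin (suc k)
  φ (inj₁ (zero , m)) = zero , suc m
  φ (inj₁ (suc zero , m)) = suc zero , suc m
  φ (inj₂ (b , m)) = bump b , m

  φ-injective : ∀ i j → φ i ≡ φ j → i ≡ j
  φ-injective (inj₁ (zero , m)) (inj₁ (zero , .m)) refl = refl
  φ-injective (inj₁ (suc zero , m)) (inj₁ (suc zero , .m)) refl = refl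
  φ-injective (inj₂ (b , m)) (inj₂ (.b , .m)) refl = refl
  φ-injective (inj₁ (zero , m)) (inj₁ (suc zero , m')) ()
  φ-injective (inj₁ (suc zero , m)) (inj₁ (zero , m')) ()
  φ-injective (inj₁ (zero , m)) (inj₂ (b , m')) ()
  φ-injective (inj₁ (suc zero , m)) (inj₂ (b , m')) ()
  φ-injective (inj₂ (b , m)) (inj₁ (zero , m')) ()
  φ-injective (inj₂ (b , m)) (inj₁ (suc zero , m')) ()

  HexDir : V → V → Set
  HexDir (b , p) (c , q) = side p ≡ false × side q ≡ true × c ≡ b ⊕ [ 1 ]

  Far : V → V → Set
  Far u w = proj₁ u ≢ proj₁ w × ¬ SymClosure HexDir u w

  Strip : V → V → Set
  Strip u w = (3 ≤ kind (proj₂ u) (proj₂ w)) ⊎ (kind (proj₂ u) (proj₂ w) ≢ 0 × Far u w)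

  Strip-sym : Symmetric Strip
  Strip-sym (b , p) (c , q) (inj₁ h) = inj₁ (subst (3 ≤_) (kind-sym p q) h)
  Strip-sym (b , p) (c , q) (inj₂ (ne , f , g)) = inj₂ ((λ z → ne (trans (kind-sym p q) z)) , (λ z → f (sym z)) , (λ z → g (SymClosure-sym _ _ z)))

  open module S (i : Fin 4) = Strips (suc (k + k)) (suc k) even ↔-refl (ν (suc i)) using (Dir)

  hexRow-sides : ∀ b {p q} → OMatch (ν (hexRows b)) p q → side p ≡ false × side q ≡ true
  hexRow-sides b (k , refl , refl) = side-hex b k false , side-hex b k true

  -- The differences 0 and 1 on the hexagon are the pair number 0.
  far : ∀ {m u w} b → OMatch (ν (hexRows b)) (proj₂ u) (proj₂ w) → ⌊ toℕ (proj₁ w ⊕ ⊖ proj₁ u) /2⌋ ≡ suc m → Far u w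
  far {m} {a , p} {c , q} b o e = near , not-hex
    where
    near : a ≢ c
    near refl = case trans (sym e) (cong (λ z → ⌊ toℕ z /2⌋) (⊕-inverseʳ a)) of λ ()
    not-hex : ¬ SymClosure HexDir (a , p) (c , q)
    not-hex (fwd (_ , _ , refl)) = case trans (sym e) (trans (cong (λ z → ⌊ toℕ z /2⌋) (trans (cong (_⊕ ⊖ a) (⊕-comm a [ 1 ])) (⊕⊖ [ 1 ] a)))
      (cong ⌊_/2⌋ (toℕ-[]< {suc (k + k)} (s≤s (s≤s z≤n))))) of λ ()
    not-hex (bwd (s , _ , _)) = case trans (sym s) (proj₂ (hexRow-sides b o)) of λ ()

  dir⇒strip : ∀ j {u w} → Dir (proj₁ (φ j)) (toℕ (proj₂ (φ j))) u w → Strip u w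
  dir⇒strip (inj₂ (b , m)) {_ , _} {_ , _} (o , _) = inj₁ (subst (3 ≤_) (sym (kind-match (suc (bump b)) (OMatch⇒ (ν (suc (bump b))) o))) (s≤s (s≤s (s≤s z≤n))))
  dir⇒strip (inj₁ (zero , m)) {u@(_ , _)} {w@(_ , _)} (o , e) =
    inj₂ (proj₁ (OnHexagon≤2 (hexRows-kind false (OMatch⇒ (ν (# 1)) o))) , far {u = u} {w} false o e)
  dir⇒strip (inj₁ (suc zero , m)) {u@(_ , _)} {w@(_ , _)} (o , e) =
    inj₂ (proj₁ (OnHexagon≤2 (hexRows-kind true (OMatch⇒ (ν (# 2)) o))) , far {u = u} {w} true o e)

  stripsFam : Fam V (2 * x) StripIx Strip
  stripsFam = subst (λ N → Fam V N StripIx Strip) (*-comm x 2)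
    (weakenFam (λ { (j , fwd d) → dir⇒strip j d ; {u} {w} (j , bwd d) → Strip-sym w u (dir⇒strip j d) })
      (stripFam (suc (k + k)) (suc k) even ↔-refl (λ i → ν (suc i))
        (λ i j m m' → toℕ-injective (suc-injective (trans (sym (kind-match (suc i) m)) (kind-match (suc j) m')))) φ φ-injective))

  shiftBy : Bool → Fin x
  shiftBy false = zero
  shiftBy true = [ 1 ]

  -- Moving the rows of side `true` by one column gives every hexagon edge the difference 1, which
  -- separates these hexagons from those inside the columns.
  hexFactor : Factor V 6
  hexFactor = record { count = x ; pt = mk↔ₛ′ (λ { (a , j) → a ⊕ shiftBy (side (hexagon j)) , hexagon j })
    (λ { (a , p) → a ⊕ ⊖ shiftBy (side p) , from hexagon↔ p })
    (λ { (a , p) → cong₂ _,_ (trans (cong (λ q → (a ⊕ ⊖ shiftBy (side p)) ⊕ shiftBy (side q)) (to-from hexagon↔ p)) (⊖⊕ a (shiftBy (side p)))) (to-from hexagon↔ p) })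
    (λ { (a , j) → cong₂ _,_ (⊕⊖ a (shiftBy (side (hexagon j)))) (from-to hexagon↔ j) }) }

  Hex : V → V → Set
  Hex u w = OnHexagon (proj₂ u) (proj₂ w) × SymClosure HexDir u w

  hex-step : ∀ {u w} → Step hexFactor u w → Hex u w
  hex-step (step a j refl refl) = hexagon-kind j , lem (side (hexagon j)) (side (hexagon (next j))) refl refl (hexagon-side j)
    where
    lem : ∀ s s' → side (hexagon j) ≡ s → side (hexagon (next j)) ≡ s' → s' ≡ not s →
      SymClosure HexDir (a ⊕ shiftBy s , hexagon j) (a ⊕ shiftBy s' , hexagon (next j))
    lem false true e e' _ = fwd (e , e' , cong (_⊕ [ 1 ]) (sym (⊕-identityʳ a)))
    lem true false e e' _ = bwd (e' , e , cong (_⊕ [ 1 ]) (sym (⊕-identityʳ a)))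
    lem false false e e' ()
    lem true true e e' ()

  hex-within : ∀ {u w} → Edge hexFactor u w → Hex u w
  hex-within (fwd s) = hex-step s
  hex-within (bwd s) = let (o , d) = hex-step s in OnHexagon-sym o , SymClosure-sym _ _ d

  mateV : V → V
  mateV v = to strips (proj₁ (from strips v) , mateU (proj₂ (from strips v)))

  mate-noFix : ∀ v → mateV v ≢ v
  mate-noFix v e = mateU-noFix _ (,-injectiveʳ (to-injective strips (trans e (sym (to-from strips v)))))

  mate-involutive : ∀ v → mateV (mateV v) ≡ v
  mate-involutive v = trans (cong (λ z → to strips (proj₁ z , mateU (proj₂ z))) (from-to strips (proj₁ (from strips v) , mateU (proj₂ (from strips v)))))
    (trans (cong (λ z → to strips (proj₁ (from strips v) , z)) (mateU-involutive (proj₂ (from strips v)))) (to-from strips v))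

  mate-kind : ∀ v → kind (proj₂ v) (proj₂ (mateV v)) ≡ 0
  mate-kind v@(b , p) = trans (cong (λ z → kind z (proj₂ (mateV v))) (sym (to-from (ν zero) p))) (kind-strip (proj₁ (from (ν zero) p)) (level p) (proj₂ (mateU (low v))))

  mate-colour : ∀ v → colour (low v) (low (mateV v)) ≡ 0
  mate-colour v = trans (cong (colour (low v)) (low-strips (proj₁ (from strips v)) (mateU (proj₂ (from strips v))))) (mateU-colour (low v))

  size : ℕ
  size = (2 + k' * 2) + (2 + (2 * k + 2 * suc k))

  used≢0 : ∀ {u w n} → Used u w → colour u w ≡ n → n ≢ 0 × n ≢ 3
  used≢0 (inj₁ (false , e)) e' = lem (trans (sym e') e)
    where lem : ∀ {n} → n ≡ 1 → n ≢ 0 × n ≢ 3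
          lem refl = (λ ()) , (λ ())
  used≢0 (inj₁ (true , e)) e' = lem (trans (sym e') e)
    where lem : ∀ {n} → n ≡ 2 → n ≢ 0 × n ≢ 3
          lem refl = (λ ()) , (λ ())
  used≢0 (inj₂ h) e' = lem (subst (4 ≤_) e' h)
    where lem : ∀ {n} → 4 ≤ n → n ≢ 0 × n ≢ 3
          lem (s≤s (s≤s (s≤s (s≤s _)))) = (λ ()) , (λ ())

  strip≢0 : ∀ {u w} → Strip u w → kind (proj₂ u) (proj₂ w) ≢ 0
  strip≢0 (inj₁ h) z = case subst (3 ≤_) z h of λ ()
  strip≢0 (inj₂ (ne , _)) z = ne z

  hexdir-column : ∀ {u w} → SymClosure HexDir u w → proj₁ u ≢ proj₁ w
  hexdir-column {b , _} {c , _} (fwd (_ , _ , e)) z = next≢ (s≤s (s≤s z≤n)) b (trans (next≡⊕1 b) (trans (sym e) (sym z)))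
  hexdir-column {b , _} {c , _} (bwd (_ , _ , e)) z = next≢ (s≤s (s≤s z≤n)) c (trans (next≡⊕1 c) (trans (sym e) z))

  cell : Design V (2 * x) size
  cell = mkDesign {Eh = Hex} {E = λ u w → Inner u w ⊎ (Twist u w ⊎ Strip u w)} mateV mate-noFix mate-involutive hexFactor hex-within
    (unionFam (λ { (z , _) (inj₁ (inj₁ (_ , o))) → proj₁ (OnHexagon≤2 o) z
                 ; (_ , us) (inj₁ (inj₂ (_ , e))) → proj₂ (used≢0 us e) refl
                 ; {u} {w} (z , _) (inj₂ s) → strip≢0 {u} {w} s z })
      innerFam (unionFam (λ { (inj₁ (_ , o)) (inj₁ h) → proj₂ (OnHexagon≤2 o) h
                            ; (inj₁ (e , _)) (inj₂ (_ , f , _)) → f e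
                            ; {u} {w} (inj₂ (z , _)) s → strip≢0 {u} {w} s z }) twistFam stripsFam))
    (↔-sym (↔-trans +↔⊎ (↔-trans +↔⊎ (2↔Bool ⊎-↔ (↔-trans *↔× (↔-refl ×-↔ 2↔Bool)))
      ⊎-↔ (↔-trans +↔⊎ (2↔Bool ⊎-↔ (↔-trans +↔⊎ (*↔× ⊎-↔ *↔×)))))))
    (λ v (o , _) → proj₁ (OnHexagon≤2 o) (mate-kind v))
    (λ { v (inj₁ (_ , us)) → proj₁ (used≢0 us (mate-colour v)) refl
       ; v (inj₂ (inj₁ (inj₁ (_ , o)))) → proj₁ (OnHexagon≤2 o) (mate-kind v)
       ; v (inj₂ (inj₁ (inj₂ (_ , e)))) → case trans (sym e) (mate-colour v) of λ ()
       ; v (inj₂ (inj₂ s)) → strip≢0 {v} {mateV v} s (mate-kind v) })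
    (λ { (o , _) (inj₁ (z , _)) → proj₁ (OnHexagon≤2 o) z
       ; {u} {w} (_ , d) (inj₂ (inj₁ (inj₁ (e , _)))) → hexdir-column {u} {w} d e
       ; (o , _) (inj₂ (inj₁ (inj₂ (z , _)))) → proj₁ (OnHexagon≤2 o) z
       ; (o , _) (inj₂ (inj₂ (inj₁ h))) → proj₂ (OnHexagon≤2 o) h
       ; (_ , d) (inj₂ (inj₂ (inj₂ (_ , _ , nd)))) → nd d })

-- The case x = 2, t = 1, where the ladder of columns degenerates.
module K₁₂ where

  hexagons : Vec (Vec (Fin 12) 6) 2
  hexagons = (# 0 ∷ # 1 ∷ # 2 ∷ # 3 ∷ # 4 ∷ # 5 ∷ [])
    ∷ (# 6 ∷ # 7 ∷ # 8 ∷ # 9 ∷ # 10 ∷ # 11 ∷ [])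
    ∷ []

  squares : Vec (Vec (Vec (Fin 12) 4) 3) 4
  squares = ((# 0 ∷ # 9 ∷ # 4 ∷ # 11 ∷ []) ∷ (# 1 ∷ # 6 ∷ # 5 ∷ # 7 ∷ []) ∷ (# 2 ∷ # 8 ∷ # 3 ∷ # 10 ∷ []) ∷ [])
    ∷ ((# 0 ∷ # 6 ∷ # 4 ∷ # 7 ∷ []) ∷ (# 1 ∷ # 5 ∷ # 10 ∷ # 8 ∷ []) ∷ (# 2 ∷ # 9 ∷ # 3 ∷ # 11 ∷ []) ∷ [])
    ∷ ((# 0 ∷ # 4 ∷ # 1 ∷ # 10 ∷ []) ∷ (# 2 ∷ # 6 ∷ # 3 ∷ # 7 ∷ []) ∷ (# 5 ∷ # 8 ∷ # 11 ∷ # 9 ∷ []) ∷ [])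
    ∷ ((# 0 ∷ # 2 ∷ # 5 ∷ # 3 ∷ []) ∷ (# 1 ∷ # 9 ∷ # 7 ∷ # 11 ∷ []) ∷ (# 4 ∷ # 8 ∷ # 6 ∷ # 10 ∷ []) ∷ [])
    ∷ []

  mates : Vec (Fin 12) 12
  mates = # 8 ∷ # 3 ∷ # 4 ∷ # 1 ∷ # 2 ∷ # 11 ∷ # 9 ∷ # 10 ∷ # 0 ∷ # 6 ∷ # 7 ∷ # 5 ∷ []

  colours : Vec (Vec ℕ 12) 12
  colours = (9 ∷ 1 ∷ 5 ∷ 5 ∷ 4 ∷ 1 ∷ 3 ∷ 3 ∷ 0 ∷ 2 ∷ 4 ∷ 2 ∷ [])
    ∷ (1 ∷ 9 ∷ 1 ∷ 0 ∷ 4 ∷ 3 ∷ 2 ∷ 2 ∷ 3 ∷ 5 ∷ 4 ∷ 5 ∷ [])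
    ∷ (5 ∷ 1 ∷ 9 ∷ 1 ∷ 0 ∷ 5 ∷ 4 ∷ 4 ∷ 2 ∷ 3 ∷ 2 ∷ 3 ∷ [])
    ∷ (5 ∷ 0 ∷ 1 ∷ 9 ∷ 1 ∷ 5 ∷ 4 ∷ 4 ∷ 2 ∷ 3 ∷ 2 ∷ 3 ∷ [])
    ∷ (4 ∷ 4 ∷ 0 ∷ 1 ∷ 9 ∷ 1 ∷ 3 ∷ 3 ∷ 5 ∷ 2 ∷ 5 ∷ 2 ∷ [])
    ∷ (1 ∷ 3 ∷ 5 ∷ 5 ∷ 1 ∷ 9 ∷ 2 ∷ 2 ∷ 4 ∷ 4 ∷ 3 ∷ 0 ∷ [])
    ∷ (3 ∷ 2 ∷ 4 ∷ 4 ∷ 3 ∷ 2 ∷ 9 ∷ 1 ∷ 5 ∷ 0 ∷ 5 ∷ 1 ∷ [])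
    ∷ (3 ∷ 2 ∷ 4 ∷ 4 ∷ 3 ∷ 2 ∷ 1 ∷ 9 ∷ 1 ∷ 5 ∷ 0 ∷ 5 ∷ [])
    ∷ (0 ∷ 3 ∷ 2 ∷ 2 ∷ 5 ∷ 4 ∷ 5 ∷ 1 ∷ 9 ∷ 1 ∷ 3 ∷ 4 ∷ [])
    ∷ (2 ∷ 5 ∷ 3 ∷ 3 ∷ 2 ∷ 4 ∷ 0 ∷ 5 ∷ 1 ∷ 9 ∷ 1 ∷ 4 ∷ [])
    ∷ (4 ∷ 4 ∷ 2 ∷ 2 ∷ 5 ∷ 3 ∷ 5 ∷ 0 ∷ 3 ∷ 1 ∷ 9 ∷ 1 ∷ [])
    ∷ (2 ∷ 5 ∷ 3 ∷ 3 ∷ 2 ∷ 0 ∷ 1 ∷ 5 ∷ 4 ∷ 4 ∷ 1 ∷ 9 ∷ [])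
    ∷ []

  colour : Fin 12 → Fin 12 → ℕ
  colour p q = lookup (lookup colours p) q

  colour-sym : ∀ p q → colour p q ≡ colour q p
  colour-sym = toWitness {a? = all? λ p → all? λ q → _ ≟ℕ _} tt

  hexes-ok : CycleTable hexagons
  hexes-ok = toWitness {a? = all? λ v → _ ≟F _} tt

  squares-ok : ∀ i → CycleTable (lookup squares i)
  squares-ok = toWitness {a? = all? λ i → all? λ v → _ ≟F _} tt

  hex-colour : ∀ i j → colour (cycleAt hexagons (i , j)) (cycleAt hexagons (i , next j)) ≡ 1
  hex-colour = toWitness {a? = all? λ i → all? λ j → _ ≟ℕ _} tt

  square-colour : ∀ s i j → colour (cycleAt (lookup squares s) (i , j)) (cycleAt (lookup squares s) (i , next j)) ≡ 2 + toℕ s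
  square-colour = toWitness {a? = all? λ s → all? λ i → all? λ j → _ ≟ℕ _} tt

  mates-ok : ∀ p → lookup mates p ≢ p × lookup mates (lookup mates p) ≡ p × colour p (lookup mates p) ≡ 0
  mates-ok = toWitness {a? = all? λ p → (¬? (_ ≟F _)) ×-dec (_ ≟F _) ×-dec (_ ≟ℕ _)} tt

  hexFactor : Factor (Fin 12) 6
  hexFactor = cycles refl hexagons hexes-ok

  hex-within : ∀ {u w} → Edge hexFactor u w → colour u w ≡ 1
  hex-within (fwd (step i j refl refl)) = hex-colour i j
  hex-within {u} {w} (bwd (step i j refl refl)) = trans (colour-sym u w) (hex-colour i j)

  squareFam : Fam (Fin 12) 4 (Fin 4) (λ u w → 2 ≤ colour u w)
  squareFam = classFam (λ s → cycles refl (lookup squares s) (squares-ok s)) (λ s u w → colour u w ≡ 2 + toℕ s)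
    (λ s u w e → trans (colour-sym w u) e) (λ { s (step i j refl refl) → square-colour s i j })
    (λ s s' e e' → toℕ-injective (+-cancelˡ-≡ 2 _ _ (trans (sym e) e'))) (λ s e → subst (2 ≤_) (sym e) (m≤m+n 2 (toℕ s)))

  design : Design (Fin 12) 4 4
  design = mkDesign {Eh = λ u w → colour u w ≡ 1} (lookup mates) (λ p → proj₁ (mates-ok p)) (λ p → proj₁ (proj₂ (mates-ok p))) hexFactor hex-within squareFam ↔-refl
    (λ p e → case trans (sym e) (proj₂ (proj₂ (mates-ok p))) of λ ())
    (λ p h → case subst (2 ≤_) (proj₂ (proj₂ (mates-ok p))) h of λ ())
    (λ e h → case subst (2 ≤_) e h of λ { (s≤s ()) })

-- Layers

match↔ : ∀ {A B : Set} {m n} → A ↔ Fin m → B ↔ Fin n → m ≡ n → A ↔ B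
match↔ f g refl = ↔-trans f (↔-sym g)

×↔ : ∀ {A B : Set} {m n} → A ↔ Fin m → B ↔ Fin n → (A × B) ↔ Fin (m * n)
×↔ f g = ↔-trans (f ×-↔ g) (↔-sym *↔×)

famOf : ∀ {V N c} (D : Design V N c) → Fam V N (Fin c) (λ u w → ∃ λ i → Edge (main D i) u w)
famOf D = record { factor = main D ; within = λ i e → i , e ; disj = mainDisj D }

assemble : ∀ {Q W I : Set} {n N c i} {E : Q × W → Q × W → Set} → Q ↔ Fin n → Design W N c → Fam (Q × W) N I E →
  (∀ q a b → ¬ E (q , a) (q , b)) → I ↔ Fin i → Design (Q × W) N (c + i)
assemble {Q} {W} {E = E} fQ D F out fI = mkDesign {Eh = Copies (Edge (hex D))} {E = λ u w → Copies (λ u w → ∃ λ i → Edge (main D i) u w) u w ⊎ E u w}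
  (λ { (q , u) → q , mate D u }) (λ { (q , u) e → noFix D u (,-injectiveʳ e) }) (λ { (q , u) → cong (q ,_) (involut D u) })
  (copyFactor fQ (hex D)) (λ { {_ , _} {_ , _} e → copyFactor-edge fQ (hex D) e })
  (unionFam (λ { {q , a} {_ , b} (refl , _) e → out q a b e }) (copyFam fQ (famOf D)) F)
  (↔-trans (↔-refl ⊎-↔ fI) (↔-sym +↔⊎))
  (λ { (q , u) (_ , e) → hexMate D e refl })
  (λ { (q , u) (inj₁ (_ , i , e)) → mainMate D i e refl ; (q , u) (inj₂ e) → out q _ _ e })
  (λ { {_ , _} {_ , _} (_ , e) (inj₁ (_ , i , e')) → hexMain D i e e' ; {q , a} {_ , b} (refl , _) (inj₂ e') → out q a b e' })

-- The bound stands inside because groups form a cycle only from three on; with one group, or one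
-- merged pair, the cell is the whole design.
RingFamily : Set → ℕ → Set → ℕ → Set
RingFamily W N J t = 3 ≤ t → Fam (Fin t × W) N J Ring

assembleOdd : ∀ {W J : Set} {N c j} s → Design W N c → RingFamily W N J (suc (s + s)) → J ↔ Fin j →
  Design (Fin (suc (s + s)) × W) N (c + s * j)
assembleOdd {c = c} zero D _ _ = mapDesign (mk↔ₛ′ (λ u → zero , u) proj₂ (λ { (zero , u) → refl }) (λ _ → refl))
  (subst (Design _ _) (sym (+-identityʳ c)) D)
assembleOdd (suc r) D R fJ = assemble ↔-refl D
  (blowFam ham (λ i → Class (toℕ i)) (λ i → Class-sym (toℕ i)) ham-class (λ i j (_ , e) (_ , e') → toℕ-injective (trans (sym e) e'))
    (R (s≤s (≤-trans (≤-reflexive (cong suc (sym (+-suc 0 0)))) (s≤s (≤-trans (s≤s z≤n) (≤-reflexive (sym (+-suc r r)))))))))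
  (λ { q a b (_ , ne , _) → ne refl }) (×↔ ↔-refl fJ)
  where open Walecki (r + suc r) (suc r) ≤-refl

-- The pairs of columns with sum -1, left over by Walecki's cycles when the number of columns is even.
module Leftover (s : ℕ) where

  open Walecki (s + s) s (n≤1+n (s + s)) public

  -- The pairs are k and 2s - k. At k = s both coincide, so s is paired with ∞.
  small : Fin (suc s) → Fin (suc M)
  small k with toℕ k ≟ℕ s
  ... | yes _ = zero
  ... | no _ = suc [ toℕ k ]

  pair : Fin (suc s) × Bool → Fin (suc M)
  pair (k , false) = small k
  pair (k , true) = suc [ s + s ∸ toℕ k ]

  unpair : Fin (suc M) → Fin (suc s) × Bool
  unpair zero = fromℕ s , false
  unpair (suc a) with toℕ a <? s
  ... | yes p = fromℕ< (≤-trans p (n≤1+n s)) , false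
  ... | no ¬p = fromℕ< {s + s ∸ toℕ a} (s≤s (≤-trans (∸-monoʳ-≤ (s + s) (≮⇒≥ ¬p)) (≤-reflexive (m+n∸n≡m s s)))) , true

  pair-unpair : ∀ v → pair (unpair v) ≡ v
  pair-unpair zero with toℕ (fromℕ s) ≟ℕ s
  ... | yes _ = refl
  ... | no ¬p = ⊥-elim (¬p (toℕ-fromℕ s))
  pair-unpair (suc a) with toℕ a <? s
  ... | no ¬p = cong suc (trans (cong (λ n → [ s + s ∸ n ]) (toℕ-fromℕ< {s + s ∸ toℕ a} _)) (trans (cong [_] (m∸[m∸n]≡n (≤-pred (toℕ<n a)))) ([]-toℕ a)))
  ... | yes p with toℕ (fromℕ< (≤-trans p (n≤1+n s))) ≟ℕ s
  ...   | yes e = ⊥-elim (<-irrefl (trans (sym (toℕ-fromℕ< _)) e) p)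
  ...   | no _ = cong suc (trans (cong [_] (toℕ-fromℕ< _)) ([]-toℕ a))

  pair↔ : (Fin (suc s) × Bool) ↔ Fin (suc M)
  pair↔ = section↔ (×↔ ↔-refl (↔-sym 2↔Bool)) (subst (λ n → Fin (suc M) ↔ Fin n) (eq s) ↔-refl) pair unpair pair-unpair
    where
    open +-*-Solver
    eq : ∀ s → suc (suc (s + s)) ≡ suc s * 2
    eq = solve 1 (λ s → con 2 :+ (s :+ s) := (con 1 :+ s) :* con 2) refl

  pair-sum : ∀ k → toℕ (S (pair (k , false)) (pair (k , true))) ≡ s + s
  pair-sum k with toℕ k ≟ℕ s
  ... | yes e = trans (cong toℕ (trans ([]-⊕ (s + s ∸ toℕ k) (s + s ∸ toℕ k)) (cong (λ n → [ n + n ]) (trans (cong (s + s ∸_) e) (m+n∸n≡m s s)))))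
    (toℕ-[]< (n<1+n (s + s)))
  ... | no _ = trans (cong toℕ (trans ([]-⊕ (toℕ k) (s + s ∸ toℕ k)) (cong [_] (m+[n∸m]≡n (≤-trans (≤-pred (toℕ<n k)) (m≤m+n s s))))))
    (toℕ-[]< (n<1+n (s + s)))

  not-ham : ∀ k b b' (i : Fin s) → ¬ Class (toℕ i) (pair (k , b)) (pair (k , b'))
  not-ham k false false i (ne , _) = ne refl
  not-ham k true true i (ne , _) = ne refl
  not-ham k false true i (_ , e) = <-irrefl (trans (sym e) (trans (cong ⌊_/2⌋ (pair-sum k)) (sym (n≡⌊n+n/2⌋ s)))) (toℕ<n i)
  not-ham k true false i c = not-ham k false true i (Class-sym (toℕ i) (pair (k , true)) (pair (k , false)) c)

assembleEven : ∀ {W J : Set} {N c j} s → Design (Bool × W) N c → RingFamily W N J (suc (suc (s + s))) → J ↔ Fin j →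
  Design (Fin (suc (suc (s + s))) × W) N (c + s * j)
assembleEven {c = c} zero D _ _ = mapDesign (↔-sym 2↔Bool ×-↔ ↔-refl) (subst (Design _ _) (sym (+-identityʳ c)) D)
assembleEven {W} {J} {N} s@(suc r) D R fJ = mapDesign join (assemble ↔-refl D
  (mapFam {E' = λ u w → ∃ λ (i : Fin s) → On (Class (toℕ i)) (to join u) (to join w)} (↔-sym join)
    (λ { {u} {w} (i , e) → i , subst₂ (On (Class (toℕ i))) (sym (to-from join u)) (sym (to-from join w)) e })
    (blowFam ham (λ i → Class (toℕ i)) (λ i → Class-sym (toℕ i)) ham-class (λ i j (_ , e) (_ , e') → toℕ-injective (trans (sym e) e'))
      (R (s≤s (s≤s (s≤s z≤n))))))
  (λ { q (b , _) (b' , _) (i , e) → not-ham q b b' i e }) (×↔ ↔-refl fJ))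
  where
  open Leftover s
  join : (Fin (suc s) × (Bool × W)) ↔ (Fin (suc M) × W)
  join = ↔-trans (↔-sym (×-assoc 0ℓ _ _ _)) (pair↔ ×-↔ ↔-refl)

-- Joining the groups, for odd and for even x

module OddCycles (h : ℕ) where

  x k w : ℕ
  x = 3 + (h + h)
  -- Chosen so that w = 2k + 1 = 3x: a group of 6x vertices is 3x doubled points.
  k = 4 + (h + (h + h))
  w = suc (k + k)

  w≡3x : w ≡ 3 * x
  w≡3x = solve 1 (λ h → con 1 :+ ((con 4 :+ (h :+ (h :+ h))) :+ (con 4 :+ (h :+ (h :+ h)))) := con 3 :* (con 3 :+ (h :+ h))) refl h
    where open +-*-Solver

  W : Set
  W = Fin x × Fin 6

  W↔ : W ↔ Fin (x * 6)
  W↔ = ×↔ ↔-refl ↔-refl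

  ring : ∀ t → RingFamily W (2 * x) (Fin w × Bool) t
  ring t t≥3 = mapFam (↔-refl ×-↔ match↔ (×↔ ↔-refl (↔-sym 2↔Bool)) W↔ size) (λ { {_ , _} {_ , _} e → e })
    (Wreath.wreathFam t k t≥3 (3 * t) x len (s≤s (s≤s z≤n)))
    where
    open +-*-Solver
    size : w * 2 ≡ x * 6
    size = trans (cong (_* 2) w≡3x) (solve 1 (λ x → con 3 :* x :* con 2 := x :* con 6) refl x)
    len : w * t ≡ 3 * t * x
    len = trans (cong (_* t) w≡3x) (solve 2 (λ x t → con 3 :* x :* t := con 3 :* t :* x) refl x t)

  J↔ : (Fin w × Bool) ↔ Fin (w * 2)
  J↔ = ×↔ ↔-refl (↔-sym 2↔Bool)

  odd : ∀ s → Design (Fin (suc (s + s)) × W) (2 * x) (CellOdd.size rows6 h + s * (w * 2))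
  odd s = assembleOdd s (CellOdd.cell rows6 h) (ring (suc (s + s))) J↔

  even : ∀ s → Design (Fin (suc (suc (s + s))) × W) (2 * x) (CellOdd.size rows12 h + s * (w * 2))
  even s = assembleEven s (mapDesign (match↔ (×↔ ↔-refl ↔-refl) (×↔ (↔-sym 2↔Bool) W↔)
      (solve 1 (λ x → x :* con 12 := con 2 :* (x :* con 6)) refl x)) (CellOdd.cell rows12 h)) (ring (suc (suc (s + s)))) J↔
    where open +-*-Solver

module EvenCycles (r : ℕ) where

  x : ℕ
  x = suc (suc (r + r))

  W : Set
  W = Fin 3 × Fin x

  W↔ : W ↔ Fin (3 * x)
  W↔ = ×↔ ↔-refl ↔-refl

  module _ (t : ℕ) (t≥3 : 3 ≤ t * 2) where

    L : ℕ
    L = t * 2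

    Rows : Set
    Rows = Fin L × Fin 3

    turned : Bool → Fin L ↔ Fin L
    turned false = ↔-refl
    turned true = next↔

    -- A cycle of even length is the union of two perfect matchings; δ selects one of them, the
    -- second being the first rotated by one place.
    ringPair : Bool → (Fin t × Bool) ↔ Fin L
    ringPair δ = ↔-trans (×↔ ↔-refl (↔-sym 2↔Bool)) (turned δ)

    lift : Bool → Fin 3 → Fin 3
    lift false _ = zero
    lift true ρ = ρ

    -- Row s of one group meets row s + ρ of the next; as ρ runs through ℤ/3 all nine pairs of rows
    -- occur once.
    rows : Bool × Fin 3 → ((Fin t × Fin 3) × Bool) ↔ Rows
    rows (δ , ρ) = mk↔ₛ′
      (λ { ((q , s) , b) → to (ringPair δ) (q , b) , s ⊕ lift b ρ })
      (λ { (a , s) → (proj₁ (from (ringPair δ) a) , s ⊕ ⊖ lift (proj₂ (from (ringPair δ) a)) ρ) , proj₂ (from (ringPair δ) a) })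
      (λ { (a , s) → cong₂ _,_ (to-from (ringPair δ) a) (⊖⊕ s (lift (proj₂ (from (ringPair δ) a)) ρ)) })
      (λ { ((q , s) , b) → trans (cong (λ z → (proj₁ z , (s ⊕ lift b ρ) ⊕ ⊖ lift (proj₂ z) ρ) , proj₂ z) (from-to (ringPair δ) (q , b)))
                                 (cong (λ z → (q , z) , b) (⊕⊖ s (lift b ρ))) })

    rail : Bool × Fin 3 → Fin L → Fin 3 → Fin 3 → Set
    rail (δ , ρ) a s s' = par (toℕ a) ≡ δ × s' ≡ s ⊕ ρ

    even-position : ∀ (q : Fin t) → toℕ {L} (combine q (zero {1})) ≡ 2 * toℕ q
    even-position q = trans (toℕ-combine q (zero {1})) (+-identityʳ _)

    odd-position : ∀ (q : Fin t) → next {L} (combine q (zero {1})) ≡ combine q (suc zero)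
    odd-position q = next-step (trans (cong suc (even-position q)) (sym (trans (toℕ-combine q (suc (zero {0}))) (+-comm _ 1))))

    par-even : ∀ (q : Fin t) → par (toℕ {L} (combine q (zero {1}))) ≡ false
    par-even q = trans (cong par (trans (even-position q) (cong (toℕ q +_) (+-identityʳ (toℕ q))))) (par-double (toℕ q))

    par-odd : ∀ (q : Fin t) → par (toℕ {L} (combine q (suc (zero {0})))) ≡ true
    par-odd q = trans (cong par (trans (toℕ-combine q (suc (zero {0}))) (+-comm _ 1)))
      (cong not (trans (cong par (sym (even-position q))) (par-even q)))

    ringPair-next : ∀ δ (q : Fin t) → to (ringPair δ) (q , true) ≡ next (to (ringPair δ) (q , false))
    ringPair-next false q = sym (odd-position q)
    ringPair-next true q = cong next (sym (odd-position q))

    ringPair-par : ∀ δ (q : Fin t) → par (toℕ (to (ringPair δ) (q , false))) ≡ δ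
    ringPair-par false q = par-even q
    ringPair-par true q = trans (cong (λ a → par (toℕ a)) (odd-position q)) (par-odd q)

    rows-rail : ∀ i {p q} → MatchRow (rows i) p q → SymClosure (Rail (rail i)) p q
    rows-rail (δ , ρ) ((q , s) , false , refl , refl) = fwd (ringPair-next δ q , ringPair-par δ q , cong (_⊕ ρ) (sym (⊕-identityʳ s)))
    rows-rail (δ , ρ) ((q , s) , true , refl , refl) = bwd (ringPair-next δ q , ringPair-par δ q , cong (_⊕ ρ) (sym (⊕-identityʳ s)))

    rail-disj : ∀ i j {a s s'} → rail i a s s' → rail j a s s' → i ≡ j
    rail-disj (δ , ρ) (δ' , ρ') {s = s} (e , f) (e' , f') = cong₂ _,_ (trans (sym e) e') (⊕-cancelˡ s (trans (sym f) f'))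

    ringFam : Fam (Fin L × W) (2 * x) ((Bool × Fin 3) × Fin (suc r)) Ring
    ringFam = subst (λ N → Fam (Fin L × W) N ((Bool × Fin 3) × Fin (suc r)) Ring) (*-comm x 2)
      (mapFam (mk↔ₛ′ (λ { (c , (a , s)) → a , s , c }) (λ { (a , s , c) → c , (a , s) }) (λ _ → refl) (λ _ → refl))
        (λ { {_ , (_ , _)} {_ , (_ , _)} (j , fwd (o , _)) → ring₁ (rows-rail (proj₁ j) (OMatch⇒ (rows (proj₁ j)) o))
           ; {_ , (_ , _)} {_ , (_ , _)} (j , bwd (o , _)) → ring₂ (rows-rail (proj₁ j) (OMatch⇒ (rows (proj₁ j)) o)) })
        (stripFam (suc (r + r)) (suc r) (cong suc (sym (+-suc r r))) (×↔ ↔-refl ↔-refl) rows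
          (λ i j m m' → railDisj t≥3 rail rail-disj i j (rows-rail i m) (rows-rail j m')) (λ j → j) (λ _ _ e → e)))
      where
      ring₁ : ∀ {i a s b s'} → SymClosure (Rail (rail i)) (a , s) (b , s') → b ≡ next a ⊎ a ≡ next b
      ring₁ (fwd (e , _)) = inj₁ e
      ring₁ (bwd (e , _)) = inj₂ e
      ring₂ : ∀ {i a s b s'} → SymClosure (Rail (rail i)) (b , s') (a , s) → b ≡ next a ⊎ a ≡ next b
      ring₂ (fwd (e , _)) = inj₂ e
      ring₂ (bwd (e , _)) = inj₁ e

  double : ∀ s → suc s * 2 ≡ suc (suc (s + s))
  double = solve 1 (λ s → (con 1 :+ s) :* con 2 := con 2 :+ (s :+ s)) refl
    where open +-*-Solver

  ring : ∀ s → RingFamily W (2 * x) ((Bool × Fin 3) × Fin (suc r)) (suc (suc (s + s)))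
  ring s = subst (RingFamily W (2 * x) _) (double s) (ringFam (suc s))

  layered : ∀ {c} → Design (Bool × W) (2 * x) c → ∀ s → Design (Fin (suc (suc (s + s))) × W) (2 * x) (c + s * (2 * 3 * suc r))
  layered D s = assembleEven s D (ring s) (×↔ (×↔ (↔-sym 2↔Bool) ↔-refl) ↔-refl)

-- Parity cases and the count of the factors

data Parity : ℕ → Set where
  even : ∀ n → Parity (n + n)
  odd  : ∀ n → Parity (suc (n + n))

parity : ∀ n → Parity n
parity zero = even zero
parity (suc n) with parity n
... | even m = odd m
... | odd m = subst Parity (cong suc (+-suc m m)) (even (suc m))

-- The equation for c is the degree count 1 + 2 + 2c = 6xt - 1: mate, hexagon factor and c further
-- factors.
finish : ∀ {V c} x t → 2 ≤ x → Design V (2 * x) c → V ↔ Fin (6 * x * t) → c + 2 ≡ 3 * x * t → HWP (6 * x * t) 6 (2 * x) 1 (3 * x * t ∸ 2)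
finish {V} {c} x t x≥2 D f e = subst (HWP (6 * x * t) 6 (2 * x) 1) (trans (sym (m+n∸n≡m c 2)) (cong (_∸ 2) e))
  (design⇒HWP f (≤-trans (n≤1+n 3) (*-monoʳ-≤ 2 x≥2)) total (trans (cong (_% 2) six) (m*n%n≡0 (3 * x * t) 2)) D)
  where
  open +-*-Solver
  six : 6 * x * t ≡ 3 * x * t * 2
  six = solve 2 (λ x t → con 6 :* x :* t := con 3 :* x :* t :* con 2) refl x t
  total : 2 + (1 + c) * 2 ≡ 6 * x * t
  total = trans (solve 1 (λ c → con 2 :+ (con 1 :+ c) :* con 2 := (c :+ con 2) :* con 2) refl c) (trans (cong (_* 2) e) (sym six))

solution : ∀ x t → 1 ≤ t → 2 ≤ x → HWP (6 * x * t) 6 (2 * x) 1 (3 * x * t ∸ 2)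
solution x t t≥1 x≥2 with parity x
solution .(zero + zero) t t≥1 () | even zero
solution .(suc r + suc r) (suc s) t≥1 x≥2 | even (suc r) = go r (+-suc r r) x≥2
  where
  open +-*-Solver
  go : ∀ r → r + suc r ≡ suc (r + r) → 2 ≤ suc (r + suc r) → HWP (6 * suc (r + suc r) * suc s) 6 (2 * suc (r + suc r)) 1 (3 * suc (r + suc r) * suc s ∸ 2)
  go r e h rewrite e = finish (suc (suc (r + r))) (suc s) h (EvenCycles.layered r (cell r) s)
      (match↔ (×↔ ↔-refl (×↔ ↔-refl ↔-refl)) ↔-refl
        (solve 2 (λ r s → (con 2 :+ (s :+ s)) :* (con 3 :* (con 2 :+ (r :+ r))) := con 6 :* (con 2 :+ (r :+ r)) :* (con 1 :+ s)) refl r s))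
      (tally r)
    where
    size : ℕ → ℕ
    size zero = 4
    size (suc k') = CellEven.size k'
    cell : ∀ r → Design (Bool × EvenCycles.W r) (2 * suc (suc (r + r))) (size r)
    cell zero = mapDesign (match↔ ↔-refl (×↔ (↔-sym 2↔Bool) (×↔ ↔-refl ↔-refl)) refl) K₁₂.design
    cell (suc k') = mapDesign (match↔ (×↔ ↔-refl ↔-refl) (×↔ (↔-sym 2↔Bool) (×↔ ↔-refl ↔-refl))
      (solve 1 (λ x → x :* con 6 := con 2 :* (con 3 :* x)) refl (suc (suc (suc k' + suc k'))))) (CellEven.cell k')
    tally : ∀ r → size r + s * (2 * 3 * suc r) + 2 ≡ 3 * suc (suc (r + r)) * suc s
    tally zero = solve 1 (λ s → con 4 :+ s :* con 6 :+ con 2 := con 6 :* (con 1 :+ s)) refl s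
    tally (suc k) = solve 2 (λ k s → ((con 2 :+ k :* con 2) :+ (con 2 :+ (con 2 :* (con 1 :+ k) :+ con 2 :* (con 2 :+ k)))) :+ s :* (con 6 :* (con 2 :+ k)) :+ con 2
      := con 3 :* (con 2 :+ ((con 1 :+ k) :+ (con 1 :+ k))) :* (con 1 :+ s)) refl k s
solution .(suc (zero + zero)) t t≥1 (s≤s ()) | odd zero
solution .(suc (suc h + suc h)) t t≥1 x≥2 | odd (suc h) = go (+-suc h h) x≥2 (parity t) t≥1
  where
  open +-*-Solver
  go : h + suc h ≡ suc (h + h) → 2 ≤ suc (suc (h + suc h)) → Parity t → 1 ≤ t →
    HWP (6 * suc (suc (h + suc h)) * t) 6 (2 * suc (suc (h + suc h))) 1 (3 * suc (suc (h + suc h)) * t ∸ 2)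
  go e b p c rewrite e = byParity t p c
    where
    X : ℕ
    X = suc (suc (suc (h + h)))
    byParity : ∀ t → Parity t → 1 ≤ t → HWP (6 * X * t) 6 (2 * X) 1 (3 * X * t ∸ 2)
    byParity .(zero + zero) (even zero) ()
    byParity .(suc s + suc s) (even (suc s)) _ = subst (λ t → HWP (6 * X * suc t) 6 (2 * X) 1 (3 * X * suc t ∸ 2)) (sym (+-suc s s))
      (finish X (suc (suc (s + s))) b (OddCycles.even h s)
        (match↔ (×↔ ↔-refl (×↔ ↔-refl ↔-refl)) ↔-refl
          (solve 2 (λ h s → (con 2 :+ (s :+ s)) :* ((con 3 :+ (h :+ h)) :* con 6) := con 6 :* (con 3 :+ (h :+ h)) :* (con 2 :+ (s :+ s))) refl h s))
        (solve 2 (λ h s → ((con 2 :+ (con 6 :+ con 8)) :+ h :* con 12) :+ s :* ((con 1 :+ ((con 4 :+ (h :+ (h :+ h))) :+ (con 4 :+ (h :+ (h :+ h))))) :* con 2) :+ con 2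
          := con 3 :* (con 3 :+ (h :+ h)) :* (con 2 :+ (s :+ s))) refl h s))
    byParity .(suc (s + s)) (odd s) _ = finish X (suc (s + s)) b (OddCycles.odd h s)
        (match↔ (×↔ ↔-refl (×↔ ↔-refl ↔-refl)) ↔-refl
          (solve 2 (λ h s → (con 1 :+ (s :+ s)) :* ((con 3 :+ (h :+ h)) :* con 6) := con 6 :* (con 3 :+ (h :+ h)) :* (con 1 :+ (s :+ s))) refl h s))
        (solve 2 (λ h s → ((con 2 :+ (con 3 :+ con 2)) :+ h :* con 6) :+ s :* ((con 1 :+ ((con 4 :+ (h :+ (h :+ h))) :+ (con 4 :+ (h :+ (h :+ h))))) :* con 2) :+ con 2
          := con 3 :* (con 3 :+ (h :+ h)) :* (con 1 :+ (s :+ s))) refl h s)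

theorem4 : (x t : ℕ) → t ≥ 1 → x ≥ 2 → ¬ (6 ∣ x) →
    ¬ (gcd 6 (2 * x) ≡ 1) → ¬ (gcd 6 (2 * x) ≡ 2 × x ≡ 3) →
    HWP (6 * x * t) 6 (2 * x) 1 (3 * x * t ∸ 2) ⇔ (6 ∣ 6 * x * t × 2 * x ∣ 6 * x * t)
theorem4 x t t≥1 x≥2 _ _ _ = mk⇔
  (λ _ → divides (x * t) (solve 2 (λ x t → con 6 :* x :* t := x :* t :* con 6) refl x t)
       , divides (3 * t) (solve 2 (λ x t → con 6 :* x :* t := con 3 :* t :* (con 2 :* x)) refl x t))
  (λ _ → solution x t t≥1 x≥2)
  where open +-*-Solver
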